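{- For every pair $(b,k)$ in the list $(6,6),(7,6),(8,6),(9,6),(10,6),(11,6),(12,6),(13,6),(14,6),(8,7),(9,7),(10,7),(11,7),(12,7),(13,7),(14,7),(10,8),(11,8),(12,8),(13,8),(14,8),(11,9),(12,9),(13,9),(14,9),(13,10),(14,10),(14,11)$, we have the strict inequality $$R_{(b,k)}<\left(\frac{1}{\log\frac{b}{k-3}}+\frac{b^{k-1}}{b^{\underline{k-1}}\,\log(b-k+2)}\right)^{ -1},$$ where $b^{\underline{k-1}}=b(b-1)\cdots(b-k+2)$.
   Context: For integers $b\ge k\ge 2$ and $n\ge1$, a $(b,k)$-hash code of length $n$ is a subset $C\subseteq\{1,\dots,b\}^n$ such that for any $k$ distinct elements of $C$ there is a coordinate $i$ in which their $i$-th entries are pairwise distinct. $A(b,k,n)$ denotes the largest size of such a code and $R_{(b,k)}=\limsup_{n\to\infty}\frac1n\log_2 A(b,k,n)$. All logarithms are to base 2. -}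

module Defs where

open import Data.Nat using (ℕ; zero; suc; _+_; _*_; _∸_; _^_; _≤_; _<_)
open import Data.Fin using (Fin)
open import Data.Vec using (Vec; lookup)
open import Data.List using (List; length; []; _∷_)
open import Data.List.Membership.Propositional using (_∈_)
open import Data.List.Relation.Unary.Unique.Propositional using (Unique)
open import Data.Product using (_×_; _,_; ∃-syntax)
open import Relation.Binary.PropositionalEquality using (_≡_)
open import Function.Definitions using (Injective)

falling : ℕ → ℕ → ℕ
falling b zero    = 1
falling b (suc m) = b * falling (b ∸ 1) m

IsHashCode : (b k n : ℕ) → List (Vec (Fin b) n) → Set
IsHashCode b k n C =
  Unique C ×
  ((f : Fin k → Vec (Fin b) n) → Injective _≡_ _≡_ f → (∀ j → f j ∈ C) →
     ∃[ i ] Injective _≡_ _≡_ (λ j → lookup (f j) i))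

-- "R_(b,k) ≤ c" witnessed eventually, with c = p / q (q > 0):
-- there is N with  |C|^q ≤ 2^(p n)  (i.e. log |C| ≤ (p/q) n)  for every
-- (b,k)-hash code C of every length n ≥ N.
EventuallyRateAtMost : (b k p q : ℕ) → Set
EventuallyRateAtMost b k p q =
  ∃[ N ] ((n : ℕ) → N ≤ n → (C : List (Vec (Fin b) n)) → IsHashCode b k n C →
           length C ^ q ≤ 2 ^ (p * n))

-- p/q < ( 1/log(b/(k-3)) + b^(k-1) / (falling b (k-1) · log(b-k+2)) )^(-1),
-- expressed with rational witnesses a = a1/a2 and d = d1/d2 such that
--   1/log(b/(k-3)) < a1/a2       ⟺  2^a2 · (k-3)^a1 < b^a1
--   b^(k-1)/(fall · log(b-k+2)) < d1/d2  ⟺  2^(b^(k-1) · d2) < (b-k+2)^(fall · d1)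
--   (p/q)(a1/a2 + d1/d2) < 1     ⟺  p (a1 d2 + d1 a2) < q a2 d2.
BelowBound : (b k p q : ℕ) → Set
BelowBound b k p q =
  ∃[ a1 ] ∃[ a2 ] ∃[ d1 ] ∃[ d2 ]
    (0 < a1 × 0 < a2 × 0 < d1 × 0 < d2 ×
     2 ^ a2 * (k ∸ 3) ^ a1 < b ^ a1 ×
     2 ^ (b ^ (k ∸ 1) * d2) < (b ∸ k + 2) ^ (falling b (k ∸ 1) * d1) ×
     p * (a1 * d2 + d1 * a2) < q * a2 * d2)

-- R_(b,k) < bound  ⟺  ∃ rational c = p/q < bound with R_(b,k) ≤ c eventually.
RateBelowBound : (b k : ℕ) → Set
RateBelowBound b k =
  ∃[ p ] ∃[ q ] (0 < q × BelowBound b k p q × EventuallyRateAtMost b k p q)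

pairs : List (ℕ × ℕ)
pairs =
  (6 , 6) ∷ (7 , 6) ∷ (8 , 6) ∷ (9 , 6) ∷ (10 , 6) ∷ (11 , 6) ∷ (12 , 6) ∷
  (13 , 6) ∷ (14 , 6) ∷ (8 , 7) ∷ (9 , 7) ∷ (10 , 7) ∷ (11 , 7) ∷ (12 , 7) ∷
  (13 , 7) ∷ (14 , 7) ∷ (10 , 8) ∷ (11 , 8) ∷ (12 , 8) ∷ (13 , 8) ∷ (14 , 8) ∷
  (11 , 9) ∷ (12 , 9) ∷ (13 , 9) ∷ (14 , 9) ∷ (13 , 10) ∷ (14 , 10) ∷
  (14 , 11) ∷ []

{-# OPTIONS --safe #-}
module Submission where

-- Fix N = k - 2 and r = b - N. For N distinct codewords x and every coordinate i, the words whose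
-- i-th symbol together with those of x are pairwise distinct span a complete r-partite graph, and these
-- graphs cover all pairs of remaining words; Hansel's lemma gives log |C| ≤ ∑ᵢ τᵢ log r, where τᵢ is the
-- probability that x and a random y ∈ C are separated at i. The words x are drawn from a random member of
-- a partition of C into groups that use at most s symbols at each coordinate of a chosen set L; pigeonhole
-- affords |L| ≈ log |C| / log (b/s).
--
-- Outside L, let p_ω be the symbol distribution of group ω and q their mean. Writing H_j for j! times the
-- elementary symmetric polynomial and v_a = p_a H_{N-1}(p without a), the expectation of τᵢ is
-- E H_N(p_ω) - N ⟨q , E v⟩. For symbols i, l one has v_i - v_l = (p_i - p_l) g_{il} with
-- g_{il} = H_{N-1}(p without i, l) ≥ 0, so the covariance of q and E v is at least
-- -E (p_i - p_l)² (c - g_{il})² / 4c summed over pairs, for any c > 0, and this is paid for by the deficit of H_N(p_ω)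
-- from its maximum, which is itself an explicit positive combination of the (p_i - p_l)². Hence E τᵢ is at most its
-- value F for uniform distributions, with a gain proportional to the variance of q.
--
-- With s = N - 1 nothing is separated on L, which gives the stated bound, and strictly more if linearly many
-- coordinates have a non-uniform q. Otherwise choose L among nearly uniform coordinates and s = N: there
-- E τᵢ ≲ (b - N)/b · N!/Nᴺ, and for the listed pairs the larger L outweighs this.
--
-- All logarithms are replaced by rational bounds s/i, i.e. inequalities 2ˢ yⁱ ≤ xⁱ.

open import Defs
open import Algebra.Structures using (IsCommutativeSemiring)
open import Data.Empty using (⊥; ⊥-elim)
open import Data.Fin.Base as Fin using (Fin; zero; suc)
open import Data.Fin.Properties as Fin using (_≟_)
import Data.Integer.Base as ℤ
import Data.Integer.Properties as ℤ
import Data.Integer.Tactic.RingSolver as ℤ-Solver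
open import Data.List.Base using (List; []; _∷_; _++_; allFin; concat; drop; filter; length; map; take)
open import Data.List.Membership.Propositional using (_∈_)
open import Data.List.Membership.Propositional.Properties using (∈-++⁺ˡ)
open import Data.List.Properties using (++-assoc; ++-identityʳ; length-++; length-drop; length-tabulate; length-take; map-tabulate; take++drop≡id)
open import Data.List.Relation.Binary.Permutation.Propositional using (_↭_; ↭-refl; ↭-reflexive; ↭-sym; ↭-trans; ↭⇒↭ₛ; prep; swap)
open import Data.List.Relation.Binary.Permutation.Propositional.Properties using (All-resp-↭; ∈-resp-↭; ++-comm; ++⁺ʳ; ++⁺ˡ; shift; ↭-length)
import Data.List.Relation.Binary.Permutation.Setoid.Properties as Setoid↭
open import Data.List.Relation.Unary.All as All using (All; []; _∷_)
open import Data.List.Relation.Unary.All.Properties using (++⁻ʳ; ++⁻ˡ; all-filter; concat⁺; map⁺; take⁺)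
open import Data.List.Relation.Unary.AllPairs as AllPairs using (AllPairs; []; _∷_)
open import Data.List.Relation.Unary.Unique.Propositional using (Unique)
open import Data.Nat.Base as ℕ using (ℕ; zero; suc; z≤n; s≤s; NonZero; >-nonZero; >-nonZero⁻¹)
open import Data.Nat.DivMod using (_/_; _%_; m≡m%n+[m/n]*n; m%n<n; m/n*n≤m)
import Data.Nat.Properties as ℕ
import Data.Nat.Tactic.RingSolver as ℕ-Solver
open import Data.Product.Base using (_×_; _,_; ∃-syntax; Σ-syntax; proj₁; proj₂)
open import Data.Sum.Base using (_⊎_; inj₁; inj₂)
open import Data.Vec.Base as Vec using (Vec; []; _∷_; lookup; toList)
open import Data.Vec.Functional using () renaming (_∷_ to _◂_)
open import Data.Vec.Membership.Propositional.Properties using (∈-lookup; ∈-toList⁺)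
open import Data.Vec.Properties using (length-toList; lookup-map)
open import Function.Base using (_∘_; id)
open import Function.Definitions using (Injective)
open import Level using (Level)
open import Relation.Binary.PropositionalEquality using (_≡_; _≢_; refl; sym; trans; cong; cong₂; subst; subst₂; setoid; module ≡-Reasoning)
open import Relation.Nullary using (Dec; yes; no; ¬_; ¬?)
open import Relation.Nullary.Decidable using (_×-dec_; _⊎-dec_; True; toWitness)

-- With a single group, q would equal p_ω, and g ≥ 0 makes p and v similarly ordered, so their
-- covariance could not be negative. After averaging, the factors g differ from group to group, q
-- and E v may be ordered differently, and the covariance can be negative. This is the main
-- obstacle. The loss would vanish if every g were equal to c, so c is chosen such that the deficit
-- pays for every possible value of g, with a remainder that becomes the gain.
--
-- The rate is bounded by contradiction: for a fraction p/q just below the target, a code with |C|^q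
-- > 2^(pn) first affords the set L by its size and then violates Hansel's inequality.
--
-- Whether a coordinate is nearly uniform must be decided for C itself, since L depends on the
-- answer and the groups depend on L. The answer is carried over to the union of the groups, which
-- misses at most a share 1/`e` of C.
--
-- Distributions appear as integer vectors of total `m`, and means over groups as sums, so all
-- inequalities are homogeneous and free of division.

length-allFin : ∀ n → length (allFin n) ≡ n
length-allFin n = length-tabulate {n = n} id

-- Finite sums and sums over distinct tuples in a commutative semiring

module Sum {R : Set} {_+_ _*_ : R → R → R} {0# 1# : R}
           (isSemiring : IsCommutativeSemiring _≡_ _+_ _*_ 0# 1#) where

  open IsCommutativeSemiring isSemiring
    using (+-assoc; +-comm; +-identityˡ; +-identityʳ; *-assoc; *-comm; *-identityˡ; zeroˡ; zeroʳ; distribˡ)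

  -- Module parameters cannot be given a fixity.
  infixl 6 _⊕_
  infixl 7 _⊗_
  _⊕_ _⊗_ : R → R → R
  _⊕_ = _+_
  _⊗_ = _*_

  private
    variable
      a : Level
      A B : Set a

  ∑ : List A → (A → R) → R
  ∑ []       f = 0#
  ∑ (x ∷ xs) f = f x + ∑ xs f

  ∑-cong : (xs : List A) {f g : A → R} → (∀ x → f x ≡ g x) → ∑ xs f ≡ ∑ xs g
  ∑-cong []       eq = refl
  ∑-cong (x ∷ xs) eq = cong₂ _+_ (eq x) (∑-cong xs eq)

  interchange : ∀ w x y z → (w ⊕ x) ⊕ (y ⊕ z) ≡ (w ⊕ y) ⊕ (x ⊕ z)
  interchange w x y z = begin
    (w ⊕ x) ⊕ (y ⊕ z) ≡⟨ +-assoc w x (y + z) ⟩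
    w ⊕ (x ⊕ (y ⊕ z)) ≡⟨ cong (w +_) (+-assoc x y z) ⟨
    w ⊕ (x ⊕ y ⊕ z)   ≡⟨ cong (λ t → w ⊕ (t ⊕ z)) (+-comm x y) ⟩
    w ⊕ (y ⊕ x ⊕ z)   ≡⟨ cong (w +_) (+-assoc y x z) ⟩
    w ⊕ (y ⊕ (x ⊕ z)) ≡⟨ +-assoc w y (x + z) ⟨
    (w ⊕ y) ⊕ (x ⊕ z) ∎
    where open ≡-Reasoning

  ∑-+ : (xs : List A) (f g : A → R) → ∑ xs (λ x → f x ⊕ g x) ≡ ∑ xs f ⊕ ∑ xs g
  ∑-+ []       f g = sym (+-identityˡ 0#)
  ∑-+ (x ∷ xs) f g =
    trans (cong ((f x ⊕ g x) +_) (∑-+ xs f g)) (interchange (f x) (g x) (∑ xs f) (∑ xs g))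

  ∑-*ˡ : (xs : List A) (c : R) (f : A → R) → ∑ xs (λ x → c ⊗ f x) ≡ c ⊗ ∑ xs f
  ∑-*ˡ []       c f = sym (zeroʳ c)
  ∑-*ˡ (x ∷ xs) c f =
    trans (cong ((c ⊗ f x) +_) (∑-*ˡ xs c f)) (sym (distribˡ c (f x) (∑ xs f)))

  ∑-*ʳ : (xs : List A) (c : R) (f : A → R) → ∑ xs (λ x → f x ⊗ c) ≡ ∑ xs f ⊗ c
  ∑-*ʳ xs c f =
    trans (∑-cong xs (λ x → *-comm (f x) c)) (trans (∑-*ˡ xs c f) (*-comm c (∑ xs f)))

  ∑-0 : (xs : List A) {f : A → R} → (∀ x → f x ≡ 0#) → ∑ xs f ≡ 0#
  ∑-0 []       eq = refl
  ∑-0 (x ∷ xs) eq = trans (cong₂ _+_ (eq x) (∑-0 xs eq)) (+-identityˡ 0#)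

  ∑-swap : (xs : List A) (ys : List B) (f : A → B → R) →
           ∑ xs (λ x → ∑ ys (f x)) ≡ ∑ ys (λ y → ∑ xs (λ x → f x y))
  ∑-swap []       ys f = sym (∑-0 ys (λ _ → refl))
  ∑-swap (x ∷ xs) ys f =
    trans (cong (∑ ys (f x) +_) (∑-swap xs ys f)) (sym (∑-+ ys (f x) (λ y → ∑ xs (λ x′ → f x′ y))))

  ∑-++ : (xs ys : List A) (f : A → R) → ∑ (xs ++ ys) f ≡ ∑ xs f ⊕ ∑ ys f
  ∑-++ []       ys f = sym (+-identityˡ _)
  ∑-++ (x ∷ xs) ys f = trans (cong (f x +_) (∑-++ xs ys f)) (sym (+-assoc _ _ _))

  ∑-concat : (xss : List (List A)) (f : A → R) → ∑ (concat xss) f ≡ ∑ xss (λ xs → ∑ xs f)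
  ∑-concat []         f = refl
  ∑-concat (xs ∷ xss) f = trans (∑-++ xs (concat xss) f) (cong (∑ xs f +_) (∑-concat xss f))

  ∑-↭ : {xs ys : List A} → xs ↭ ys → (f : A → R) → ∑ xs f ≡ ∑ ys f
  ∑-↭ _↭_.refl      f = refl
  ∑-↭ (prep x p)    f = cong (f x +_) (∑-↭ p f)
  ∑-↭ (swap x y p)  f = begin
    f x ⊕ (f y ⊕ _) ≡⟨ +-assoc _ _ _ ⟨
    f x ⊕ f y ⊕ _   ≡⟨ cong₂ _+_ (+-comm (f x) (f y)) (∑-↭ p f) ⟩
    f y ⊕ f x ⊕ _   ≡⟨ +-assoc _ _ _ ⟩
    f y ⊕ (f x ⊕ _) ∎
    where open ≡-Reasoning
  ∑-↭ (_↭_.trans p q) f = trans (∑-↭ p f) (∑-↭ q f)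

  ∑-map : (h : A → B) (xs : List A) (f : B → R) → ∑ (map h xs) f ≡ ∑ xs (f ∘ h)
  ∑-map h []       f = refl
  ∑-map h (x ∷ xs) f = cong (f (h x) +_) (∑-map h xs f)

  ∑Fin : ∀ {n} → (Fin n → R) → R
  ∑Fin {n} = ∑ (allFin n)

  ∑Fin-suc : ∀ {n} (f : Fin (suc n) → R) → ∑Fin f ≡ f zero ⊕ ∑Fin (f ∘ suc)
  ∑Fin-suc {n} f = cong (f zero +_)
    (trans (cong (λ xs → ∑ xs f) (sym (map-tabulate id suc))) (∑-map suc (allFin n) f))

  -- One minus the Kronecker delta, as an element of the semiring: deleting a symbol becomes a
  -- multiplication, and identities about it need no case distinction.
  off : ∀ {n} → Fin n → Fin n → R
  off zero    zero    = 0#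
  off zero    (suc _) = 1#
  off (suc _) zero    = 1#
  off (suc l) (suc a) = off l a

  off-refl : ∀ {n} (l : Fin n) → off l l ≡ 0#
  off-refl zero    = refl
  off-refl (suc l) = off-refl l

  off-sym : ∀ {n} (l a : Fin n) → off l a ≡ off a l
  off-sym zero    zero    = refl
  off-sym zero    (suc _) = refl
  off-sym (suc _) zero    = refl
  off-sym (suc l) (suc a) = off-sym l a

  off-idem : ∀ {n} (l a : Fin n) → off l a ⊗ off l a ≡ off l a
  off-idem zero    zero    = zeroˡ 0#
  off-idem zero    (suc _) = *-identityˡ 1#
  off-idem (suc _) zero    = *-identityˡ 1#
  off-idem (suc l) (suc a) = off-idem l a

  off-≢ : ∀ {n} {i l : Fin n} → i ≢ l → off i l ≡ 1#
  off-≢ {i = zero}  {zero}  i≢l = ⊥-elim (i≢l refl)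
  off-≢ {i = zero}  {suc l} i≢l = refl
  off-≢ {i = suc i} {zero}  i≢l = refl
  off-≢ {i = suc i} {suc l} i≢l = off-≢ (i≢l ∘ cong suc)

  -- The removed term is added back on the left because a semiring has no subtraction.
  ∑Fin-off : ∀ {n} (l : Fin n) (f : Fin n → R) → ∑Fin (λ a → off l a ⊗ f a) ⊕ f l ≡ ∑Fin f
  ∑Fin-off zero f = begin
    ∑Fin (λ a → off zero a ⊗ f a) ⊕ f zero                 ≡⟨ cong (_⊕ f zero) (∑Fin-suc (λ a → off zero a ⊗ f a)) ⟩
    0# ⊗ f zero ⊕ ∑Fin (λ a → 1# ⊗ f (suc a)) ⊕ f zero     ≡⟨ cong (λ t → t ⊕ ∑Fin (λ a → 1# ⊗ f (suc a)) ⊕ f zero) (zeroˡ (f zero)) ⟩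
    0# ⊕ ∑Fin (λ a → 1# ⊗ f (suc a)) ⊕ f zero              ≡⟨ cong (_⊕ f zero) (+-identityˡ _) ⟩
    ∑Fin (λ a → 1# ⊗ f (suc a)) ⊕ f zero                   ≡⟨ +-comm _ _ ⟩
    f zero ⊕ ∑Fin (λ a → 1# ⊗ f (suc a))                   ≡⟨ cong (f zero +_) (∑-cong (allFin _) (λ a → *-identityˡ (f (suc a)))) ⟩
    f zero ⊕ ∑Fin (f ∘ suc)                                ≡⟨ ∑Fin-suc f ⟨
    ∑Fin f                                                 ∎
    where open ≡-Reasoning
  ∑Fin-off (suc l) f = begin
    ∑Fin (λ a → off (suc l) a ⊗ f a) ⊕ f (suc l)                    ≡⟨ cong (_⊕ f (suc l)) (∑Fin-suc (λ a → off (suc l) a ⊗ f a)) ⟩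
    1# ⊗ f zero ⊕ ∑Fin (λ a → off l a ⊗ f (suc a)) ⊕ f (suc l)      ≡⟨ +-assoc _ _ _ ⟩
    1# ⊗ f zero ⊕ (∑Fin (λ a → off l a ⊗ f (suc a)) ⊕ f (suc l))    ≡⟨ cong₂ _+_ (*-identityˡ (f zero)) (∑Fin-off l (f ∘ suc)) ⟩
    f zero ⊕ ∑Fin (f ∘ suc)                                         ≡⟨ ∑Fin-suc f ⟨
    ∑Fin f                                                          ∎
    where open ≡-Reasoning

  del : ∀ {n} → Fin n → (Fin n → R) → Fin n → R
  del l p a = off l a ⊗ p a

  del-comm : ∀ {n} (i l : Fin n) (p : Fin n → R) → ∀ a → del i (del l p) a ≡ del l (del i p) a
  del-comm i l p a = begin
    off i a ⊗ (off l a ⊗ p a) ≡⟨ *-assoc _ _ _ ⟨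
    off i a ⊗ off l a ⊗ p a   ≡⟨ cong (_⊗ p a) (*-comm _ _) ⟩
    off l a ⊗ off i a ⊗ p a   ≡⟨ *-assoc _ _ _ ⟩
    off l a ⊗ (off i a ⊗ p a) ∎
    where open ≡-Reasoning

  -- ∑ p(a₁)⋯p(aⱼ) over the j-tuples of pairwise distinct symbols, i.e. j! times
  -- the j-th elementary symmetric polynomial.
  H : ∀ {n} → ℕ → (Fin n → R) → R
  H zero    p = 1#
  H (suc j) p = ∑Fin (λ a → p a ⊗ H j (del a p))

  H-cong : ∀ {n} j {p q : Fin n → R} → (∀ a → p a ≡ q a) → H j p ≡ H j q
  H-cong zero    eq = refl
  H-cong (suc j) eq = ∑-cong (allFin _)
    (λ a → cong₂ _*_ (eq a) (H-cong j (λ c → cong (off a c ⊗_) (eq c))))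

  on : ∀ {n} → Fin n → Fin n → R
  on zero    zero    = 1#
  on zero    (suc _) = 0#
  on (suc _) zero    = 0#
  on (suc l) (suc a) = on l a

  on-refl : ∀ {n} (l : Fin n) → on l l ≡ 1#
  on-refl zero    = refl
  on-refl (suc l) = on-refl l

  on-≢ : ∀ {n} {i l : Fin n} → i ≢ l → on i l ≡ 0#
  on-≢ {i = zero}  {zero}  i≢l = ⊥-elim (i≢l refl)
  on-≢ {i = zero}  {suc l} i≢l = refl
  on-≢ {i = suc i} {zero}  i≢l = refl
  on-≢ {i = suc i} {suc l} i≢l = on-≢ (i≢l ∘ cong suc)

  ∑Fin-on : ∀ {n} (l : Fin n) (f : Fin n → R) → ∑Fin (λ a → on l a ⊗ f a) ≡ f l
  ∑Fin-on zero f = begin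
    ∑Fin (λ a → on zero a ⊗ f a)                 ≡⟨ ∑Fin-suc (λ a → on zero a ⊗ f a) ⟩
    1# ⊗ f zero ⊕ ∑Fin (λ a → 0# ⊗ f (suc a))    ≡⟨ cong₂ _+_ (*-identityˡ (f zero)) (∑-0 (allFin _) (λ a → zeroˡ (f (suc a)))) ⟩
    f zero ⊕ 0#                                  ≡⟨ +-identityʳ (f zero) ⟩
    f zero                                       ∎
    where open ≡-Reasoning
  ∑Fin-on (suc l) f = begin
    ∑Fin (λ a → on (suc l) a ⊗ f a)              ≡⟨ ∑Fin-suc (λ a → on (suc l) a ⊗ f a) ⟩
    0# ⊗ f zero ⊕ ∑Fin (λ a → on l a ⊗ f (suc a)) ≡⟨ cong₂ _+_ (zeroˡ (f zero)) (∑Fin-on l (f ∘ suc)) ⟩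
    0# ⊕ f (suc l)                               ≡⟨ +-identityˡ (f (suc l)) ⟩
    f (suc l)                                    ∎
    where open ≡-Reasoning

-- Integer inequalities for sums over tuples of distinct symbols

module DistinctTuples where

  open import Data.Integer.Base using (ℤ; +_; -[1+_]; 0ℤ; 1ℤ; _+_; _*_; _-_; -_; _^_; _≤_; _<_; +≤+; +<+; nonNegative; positive)
  open import Data.Integer.Properties using (≤-refl; ≤-trans; ≤-reflexive)
  open ℤ-Solver using (solve-∀)
  open Sum ℤ.+-*-isCommutativeSemiring

  private
    variable
      ℓ : Level
      Ix : Set ℓ
      b : ℕ

  0≤+ : ∀ {x y} → 0ℤ ≤ x → 0ℤ ≤ y → 0ℤ ≤ x + y
  0≤+ = ℤ.+-mono-≤

  0≤* : ∀ {x y} → 0ℤ ≤ x → 0ℤ ≤ y → 0ℤ ≤ x * y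
  0≤* {x} 0≤x 0≤y =
    ≤-trans (≤-reflexive (sym (ℤ.*-zeroʳ x))) (ℤ.*-monoˡ-≤-nonNeg x {{nonNegative 0≤x}} 0≤y)

  0≤^ : ∀ {x} j → 0ℤ ≤ x → 0ℤ ≤ x ^ j
  0≤^ zero    0≤x = +≤+ ℕ.z≤n
  0≤^ (suc j) 0≤x = 0≤* 0≤x (0≤^ j 0≤x)

  0≤x*x : ∀ x → 0ℤ ≤ x * x
  0≤x*x (+ n)        = subst (0ℤ ≤_) (ℤ.pos-* n n) (+≤+ ℕ.z≤n)
  0≤x*x -[1+ n ]     = +≤+ ℕ.z≤n

  ≤-by-difference : ∀ {x y e} → 0ℤ ≤ e → e ≡ y - x → x ≤ y
  ≤-by-difference 0≤e eq = ℤ.0≤i-j⇒j≤i (subst (0ℤ ≤_) eq 0≤e)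

  ∑-mono : (xs : List Ix) {f g : Ix → ℤ} → (∀ x → f x ≤ g x) → ∑ xs f ≤ ∑ xs g
  ∑-mono []       f≤g = ≤-refl
  ∑-mono (x ∷ xs) f≤g = ℤ.+-mono-≤ (f≤g x) (∑-mono xs f≤g)

  0≤∑ : (xs : List Ix) {f : Ix → ℤ} → (∀ x → 0ℤ ≤ f x) → 0ℤ ≤ ∑ xs f
  0≤∑ []       0≤f = ≤-refl
  0≤∑ (x ∷ xs) 0≤f = 0≤+ (0≤f x) (0≤∑ xs 0≤f)

  ∑-linear : (xs : List Ix) (c₁ c₂ c₃ c₄ : ℤ) (f₁ f₂ f₃ f₄ : Ix → ℤ) →
             ∑ xs (λ x → c₁ * f₁ x + c₂ * f₂ x + c₃ * f₃ x + c₄ * f₄ x) ≡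
             c₁ * ∑ xs f₁ + c₂ * ∑ xs f₂ + c₃ * ∑ xs f₃ + c₄ * ∑ xs f₄
  ∑-linear xs c₁ c₂ c₃ c₄ f₁ f₂ f₃ f₄ =
    trans (∑-+ xs (λ x → c₁ * f₁ x + c₂ * f₂ x + c₃ * f₃ x) (λ x → c₄ * f₄ x)) (cong₂ _+_
      (trans (∑-+ xs (λ x → c₁ * f₁ x + c₂ * f₂ x) (λ x → c₃ * f₃ x)) (cong₂ _+_
        (trans (∑-+ xs (λ x → c₁ * f₁ x) (λ x → c₂ * f₂ x))
          (cong₂ _+_ (∑-*ˡ xs c₁ f₁) (∑-*ˡ xs c₂ f₂)))
        (∑-*ˡ xs c₃ f₃)))
      (∑-*ˡ xs c₄ f₄))

  ∑∑ : (xs : List Ix) → (Ix → Ix → ℤ) → ℤ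
  ∑∑ xs f = ∑ xs (λ i → ∑ xs (f i))

  ∑∑-*ˡ : (xs : List Ix) (c : ℤ) (f : Ix → Ix → ℤ) → ∑∑ xs (λ i l → c * f i l) ≡ c * ∑∑ xs f
  ∑∑-*ˡ xs c f = trans (∑-cong xs (λ i → ∑-*ˡ xs c (f i))) (∑-*ˡ xs c (λ i → ∑ xs (f i)))

  ∑∑-+ : (xs : List Ix) (f g : Ix → Ix → ℤ) → ∑∑ xs (λ i l → f i l + g i l) ≡ ∑∑ xs f + ∑∑ xs g
  ∑∑-+ xs f g = trans (∑-cong xs (λ i → ∑-+ xs (f i) (g i))) (∑-+ xs (λ i → ∑ xs (f i)) (λ i → ∑ xs (g i)))

  ∑∑-cong : (xs : List Ix) {f g : Ix → Ix → ℤ} → (∀ i l → f i l ≡ g i l) → ∑∑ xs f ≡ ∑∑ xs g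
  ∑∑-cong xs eq = ∑-cong xs (λ i → ∑-cong xs (eq i))

  ∑∑-mono : (xs : List Ix) {f g : Ix → Ix → ℤ} → (∀ i l → f i l ≤ g i l) → ∑∑ xs f ≤ ∑∑ xs g
  ∑∑-mono xs f≤g = ∑-mono xs (λ i → ∑-mono xs (f≤g i))

  0≤∑∑ : (xs : List Ix) {f : Ix → Ix → ℤ} → (∀ i l → 0ℤ ≤ f i l) → 0ℤ ≤ ∑∑ xs f
  0≤∑∑ xs 0≤f = 0≤∑ xs (λ i → 0≤∑ xs (0≤f i))

  -- The identity behind Chebyshev's sum inequality. The weight `χ` is later the indicator of a
  -- support, or constantly 1.
  ∑∑-differences : (xs : List Ix) (χ q v : Ix → ℤ) →
    ∑∑ xs (λ i l → (χ i * χ l) * ((q i - q l) * (v i - v l))) ≡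
    + 2 * (∑ xs χ * ∑ xs (λ i → χ i * (q i * v i)) - ∑ xs (λ i → χ i * q i) * ∑ xs (λ i → χ i * v i))
  ∑∑-differences xs χ q v = begin
    ∑∑ xs (λ i l → (χ i * χ l) * ((q i - q l) * (v i - v l)))
      ≡⟨ ∑∑-cong xs (λ i l → expand (χ i) (χ l) (q i) (q l) (v i) (v l)) ⟩
    ∑∑ xs (λ i l → (χ i * (q i * v i)) * χ l + χ i * (χ l * (q l * v l)) +
                   (- (χ i * q i)) * (χ l * v l) + (- (χ i * v i)) * (χ l * q l))
      ≡⟨ ∑-cong xs (λ i → ∑-linear xs (χ i * (q i * v i)) (χ i) (- (χ i * q i)) (- (χ i * v i))
                            χ (λ l → χ l * (q l * v l)) (λ l → χ l * v l) (λ l → χ l * q l)) ⟩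
    ∑ xs (λ i → (χ i * (q i * v i)) * Sχ + χ i * Sqv + (- (χ i * q i)) * Sv + (- (χ i * v i)) * Sq)
      ≡⟨ ∑-cong xs (λ i → regroup (χ i * (q i * v i)) Sχ (χ i) Sqv (χ i * q i) Sv (χ i * v i) Sq) ⟩
    ∑ xs (λ i → Sχ * (χ i * (q i * v i)) + Sqv * χ i + (- Sv) * (χ i * q i) + (- Sq) * (χ i * v i))
      ≡⟨ ∑-linear xs Sχ Sqv (- Sv) (- Sq) (λ i → χ i * (q i * v i)) χ (λ i → χ i * q i) (λ i → χ i * v i) ⟩
    Sχ * Sqv + Sqv * Sχ + (- Sv) * Sq + (- Sq) * Sv
      ≡⟨ collect Sχ Sqv Sv Sq ⟩
    + 2 * (Sχ * Sqv - Sq * Sv) ∎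
    where
    open ≡-Reasoning
    Sχ  = ∑ xs χ
    Sqv = ∑ xs (λ i → χ i * (q i * v i))
    Sq  = ∑ xs (λ i → χ i * q i)
    Sv  = ∑ xs (λ i → χ i * v i)
    expand : ∀ x x′ q q′ v v′ → (x * x′) * ((q - q′) * (v - v′)) ≡
             (x * (q * v)) * x′ + x * (x′ * (q′ * v′)) + (- (x * q)) * (x′ * v′) + (- (x * v)) * (x′ * q′)
    expand = solve-∀
    regroup : ∀ a A b B c C d D → a * A + b * B + (- c) * C + (- d) * D ≡ A * a + B * b + (- C) * c + (- D) * d
    regroup = solve-∀
    collect : ∀ x y z w → x * y + y * x + (- z) * w + (- w) * z ≡ + 2 * (x * y - w * z)
    collect = solve-∀

  ∑-1 : (xs : List Ix) → ∑ xs (λ _ → 1ℤ) ≡ + length xs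
  ∑-1 []       = refl
  ∑-1 (x ∷ xs) = cong (λ t → 1ℤ + t) (∑-1 xs)

  ∑∑-differences₁ : (xs : List Ix) (q v : Ix → ℤ) →
    ∑∑ xs (λ i l → (q i - q l) * (v i - v l)) ≡
    + 2 * (+ length xs * ∑ xs (λ i → q i * v i) - ∑ xs q * ∑ xs v)
  ∑∑-differences₁ xs q v = begin
    ∑∑ xs (λ i l → (q i - q l) * (v i - v l))
      ≡⟨ ∑∑-cong xs (λ i l → ℤ.*-identityˡ ((q i - q l) * (v i - v l))) ⟨
    ∑∑ xs (λ i l → (1ℤ * 1ℤ) * ((q i - q l) * (v i - v l)))
      ≡⟨ ∑∑-differences xs (λ _ → 1ℤ) q v ⟩
    + 2 * (∑ xs (λ _ → 1ℤ) * ∑ xs (λ i → 1ℤ * (q i * v i)) - ∑ xs (λ i → 1ℤ * q i) * ∑ xs (λ i → 1ℤ * v i))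
      ≡⟨ cong (+ 2 *_) (cong₂ _-_
           (cong₂ _*_ (∑-1 xs) (∑-cong xs (λ i → ℤ.*-identityˡ (q i * v i))))
           (cong₂ _*_ (∑-cong xs (λ i → ℤ.*-identityˡ (q i))) (∑-cong xs (λ i → ℤ.*-identityˡ (v i))))) ⟩
    + 2 * (+ length xs * ∑ xs (λ i → q i * v i) - ∑ xs q * ∑ xs v) ∎
    where open ≡-Reasoning

  -- Twice the gap between the two sides is the double sum of the squares (c i - c l)², by the
  -- identity above with `q` = `v` = `c`.
  cauchy-schwarz : (xs : List Ix) (c : Ix → ℤ) → ∑ xs c * ∑ xs c ≤ + length xs * ∑ xs (λ x → c x * c x)
  cauchy-schwarz xs c = ℤ.*-cancelˡ-≤-pos _ _ (+ 2) (≤-by-difference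
    (subst (0ℤ ≤_) (∑∑-differences₁ xs c c) (0≤∑∑ xs (λ i l → 0≤x*x (c i - c l))))
    (distrib (+ length xs * ∑ xs (λ x → c x * c x)) (∑ xs c * ∑ xs c)))
    where
    distrib : ∀ x y → + 2 * (x - y) ≡ + 2 * x - + 2 * y
    distrib = solve-∀

  0≤off : (l a : Fin b) → 0ℤ ≤ off l a
  0≤off zero    zero    = +≤+ ℕ.z≤n
  0≤off zero    (suc _) = +≤+ ℕ.z≤n
  0≤off (suc _) zero    = +≤+ ℕ.z≤n
  0≤off (suc l) (suc a) = 0≤off l a

  0≤del : (l : Fin b) {p : Fin b → ℤ} → (∀ a → 0ℤ ≤ p a) → ∀ a → 0ℤ ≤ del l p a
  0≤del l 0≤p a = 0≤* (0≤off l a) (0≤p a)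

  0≤H : ∀ j {p : Fin b → ℤ} → (∀ a → 0ℤ ≤ p a) → 0ℤ ≤ H j p
  0≤H zero    0≤p = +≤+ ℕ.z≤n
  0≤H (suc j) 0≤p = 0≤∑ (allFin _) (λ a → 0≤* (0≤p a) (0≤H j (0≤del a 0≤p)))

  -- A tuple of distinct symbols either avoids `l` or has it at exactly one of its `suc j`
  -- positions, and all positions contribute equally.
  H-split : ∀ j (l : Fin b) (p : Fin b → ℤ) →
            H (suc j) p ≡ H (suc j) (del l p) + + suc j * (p l * H j (del l p))
  H-split zero l p = begin
    ∑Fin (λ a → p a * 1ℤ)                               ≡⟨ ∑Fin-off l (λ a → p a * 1ℤ) ⟨
    ∑Fin (λ a → off l a * (p a * 1ℤ)) + p l * 1ℤ        ≡⟨ cong₂ _+_ (∑-cong (allFin _) (λ a → ℤ.*-assoc (off l a) (p a) 1ℤ)) (ℤ.*-identityˡ (p l * 1ℤ)) ⟨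
    ∑Fin (λ a → del l p a * 1ℤ) + + 1 * (p l * 1ℤ)      ∎
    where open ≡-Reasoning
  H-split (suc j) l p = begin
    ∑Fin F                                              ≡⟨ ∑Fin-off l F ⟨
    ∑Fin (λ a → off l a * F a) + F l                    ≡⟨ cong (λ t → t + F l) (∑-cong (allFin _) term) ⟩
    ∑Fin (λ a → X a + s * (p l * Y a)) + F l            ≡⟨ cong (λ t → t + F l) (∑-+ (allFin _) X (λ a → s * (p l * Y a))) ⟩
    ∑Fin X + ∑Fin (λ a → s * (p l * Y a)) + F l         ≡⟨ cong (λ t → ∑Fin X + t + F l) (trans (∑-*ˡ (allFin _) s (λ a → p l * Y a)) (cong (s *_) (∑-*ˡ (allFin _) (p l) Y))) ⟩
    ∑Fin X + s * (p l * ∑Fin Y) + p l * ∑Fin Y          ≡⟨ collect (∑Fin X) s (p l * ∑Fin Y) ⟩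
    ∑Fin X + (1ℤ + s) * (p l * ∑Fin Y)                  ∎
    where
    open ≡-Reasoning
    s = + suc j
    F X Y : Fin _ → ℤ
    F a = p a * H (suc j) (del a p)
    X a = del l p a * H (suc j) (del a (del l p))
    Y a = del l p a * H j (del a (del l p))
    collect : ∀ x s y → x + s * y + y ≡ x + (1ℤ + s) * y
    collect = solve-∀
    arrange : ∀ o pa pl X s Y → o * (pa * (X + s * ((o * pl) * Y))) ≡ (o * pa) * X + s * (pl * (((o * o) * pa) * Y))
    arrange = solve-∀
    term : ∀ a → off l a * F a ≡ X a + s * (p l * Y a)
    term a = begin
      off l a * (p a * H (suc j) (del a p))
        ≡⟨ cong (λ t → off l a * (p a * t)) (H-split j l (del a p)) ⟩
      off l a * (p a * (H (suc j) (del l (del a p)) + s * ((off a l * p l) * H j (del l (del a p)))))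
        ≡⟨ cong (λ t → off l a * (p a * t)) (cong₂ _+_ (H-cong (suc j) (del-comm l a p))
             (cong (s *_) (cong₂ _*_ (cong (_* p l) (off-sym a l)) (H-cong j (del-comm l a p))))) ⟩
      off l a * (p a * (H (suc j) (del a (del l p)) + s * ((off l a * p l) * H j (del a (del l p)))))
        ≡⟨ arrange (off l a) (p a) (p l) (H (suc j) (del a (del l p))) s (H j (del a (del l p))) ⟩
      X a + s * (p l * ((off l a * off l a * p a) * H j (del a (del l p))))
        ≡⟨ cong (λ t → X a + s * (p l * ((t * p a) * H j (del a (del l p))))) (off-idem l a) ⟩
      X a + s * (p l * Y a) ∎

  V : ℕ → (Fin b → ℤ) → Fin b → ℤ
  V j p a = p a * H j (del a p)

  g : ℕ → (Fin b → ℤ) → Fin b → Fin b → ℤ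
  g j p i l = H j (del l (del i p))

  H-del : ∀ j (p : Fin b → ℤ) a → H (suc j) (del a p) ≡ H (suc j) p - + suc j * V j p a
  H-del j p a = begin
    H (suc j) (del a p)                                           ≡⟨ cancel _ (+ suc j * V j p a) ⟩
    H (suc j) (del a p) + + suc j * V j p a - + suc j * V j p a   ≡⟨ cong (λ t → t - + suc j * V j p a) (H-split j a p) ⟨
    H (suc j) p - + suc j * V j p a                               ∎
    where
    open ≡-Reasoning
    cancel : ∀ x y → x ≡ x + y - y
    cancel = solve-∀

  -- One identity with three uses. For `q` = `p` the left side is H of the next order, which drives
  -- the inductions on tuple length; for `q` the sum over all groups it evaluates the separated
  -- triples; for `q` = 1 it counts the symbols that a tuple avoids.
  ∑-H-del : ∀ j (p q : Fin b → ℤ) →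
            ∑Fin (λ a → q a * H (suc j) (del a p)) ≡
            ∑Fin q * H (suc j) p - + suc j * ∑Fin (λ a → q a * V j p a)
  ∑-H-del j p q = begin
    ∑Fin (λ a → q a * H (suc j) (del a p))
      ≡⟨ ∑-cong (allFin _) (λ a → trans (cong (q a *_) (H-del j p a)) (arrange (q a) T s (V j p a))) ⟩
    ∑Fin (λ a → T * q a + (- s) * (q a * V j p a))
      ≡⟨ ∑-+ (allFin _) (λ a → T * q a) (λ a → (- s) * (q a * V j p a)) ⟩
    ∑Fin (λ a → T * q a) + ∑Fin (λ a → (- s) * (q a * V j p a))
      ≡⟨ cong₂ _+_ (∑-*ˡ (allFin _) T q) (∑-*ˡ (allFin _) (- s) (λ a → q a * V j p a)) ⟩
    T * ∑Fin q + (- s) * ∑Fin (λ a → q a * V j p a)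
      ≡⟨ finish T (∑Fin q) s (∑Fin (λ a → q a * V j p a)) ⟩
    ∑Fin q * T - s * ∑Fin (λ a → q a * V j p a) ∎
    where
    open ≡-Reasoning
    s = + suc j
    T = H (suc j) p
    arrange : ∀ q T s v → q * (T - s * v) ≡ T * q + (- s) * (q * v)
    arrange = solve-∀
    finish : ∀ T m s v → T * m + (- s) * v ≡ m * T - s * v
    finish = solve-∀

  -- Expand `H` without `i` according to `l`, and `H` without `l` according to `i`: the terms that
  -- use both symbols are the same and cancel.
  V-difference : ∀ j (p : Fin b → ℤ) i l → V j p i - V j p l ≡ (p i - p l) * g j p i l
  V-difference zero p i l = arrange (p i) (p l)
    where
    arrange : ∀ x y → x * 1ℤ - y * 1ℤ ≡ (x - y) * 1ℤ
    arrange = solve-∀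
  V-difference (suc j) p i l = begin
    p i * H (suc j) (del i p) - p l * H (suc j) (del l p)
      ≡⟨ cong₂ (λ t u → p i * t - p l * u) (H-split j l (del i p)) (H-split j i (del l p)) ⟩
    p i * (G + s * (off i l * p l * Y)) - p l * (H (suc j) (del i (del l p)) + s * (off l i * p i * H j (del i (del l p))))
      ≡⟨ cong (λ t → p i * (G + s * (off i l * p l * Y)) - p l * t) (cong₂ _+_ (H-cong (suc j) (del-comm i l p))
           (cong (s *_) (cong₂ _*_ (cong (_* p i) (off-sym l i)) (H-cong j (del-comm i l p))))) ⟩
    p i * (G + s * (off i l * p l * Y)) - p l * (G + s * (off i l * p i * Y))
      ≡⟨ arrange (p i) (p l) G s (off i l) Y ⟩
    (p i - p l) * G ∎
    where
    open ≡-Reasoning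
    s = + suc j
    G = H (suc j) (del l (del i p))
    Y = H j (del l (del i p))
    arrange : ∀ x y G s o Y → x * (G + s * (o * y * Y)) - y * (G + s * (o * x * Y)) ≡ (x - y) * G
    arrange = solve-∀

  -- Chebyshev's inequality: by `V-difference` and g ≥ 0, `p` and `V` are ordered alike, so
  -- (∑χ)(∑pV) ≥ (∑p)(∑V), and ∑V is `H` again. For `χ` the indicator of a support, equality holds
  -- at the uniform distribution on it.
  H-step-≤ : ∀ j (χ p : Fin b → ℤ) → (∀ a → 0ℤ ≤ χ a) → (∀ a → 0ℤ ≤ p a) → (∀ a → χ a * p a ≡ p a) →
             ∑Fin χ * H (suc j) p ≤ (∑Fin χ - + j) * (∑Fin p * H j p)
  H-step-≤ zero χ p 0≤χ 0≤p χp≡p = ≤-reflexive (begin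
    ∑Fin χ * ∑Fin (λ a → p a * 1ℤ)       ≡⟨ cong (∑Fin χ *_) (∑-*ʳ (allFin _) 1ℤ p) ⟩
    ∑Fin χ * (∑Fin p * 1ℤ)               ≡⟨ cong (_* (∑Fin p * 1ℤ)) (ℤ.+-identityʳ (∑Fin χ)) ⟨
    (∑Fin χ - 0ℤ) * (∑Fin p * 1ℤ)        ∎)
    where open ≡-Reasoning
  H-step-≤ (suc j) χ p 0≤χ 0≤p χp≡p = ≤-by-difference
    (0≤* {+ suc j} (+≤+ ℕ.z≤n) (ℤ.i≤j⇒0≤j-i mT≤))
    (trans (finish c m T s S) (cong (λ t → (c - s) * (m * T) - c * t) (sym (∑-H-del j p p))))
    where
    c = ∑Fin χ
    m = ∑Fin p
    T = H (suc j) p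
    s = + suc j
    S = ∑Fin (λ a → p a * V j p a)
    finish : ∀ c m T s S → s * (c * S - m * T) ≡ (c - s) * (m * T) - c * (m * T - s * S)
    finish = solve-∀
    χV≡V : ∀ a → χ a * V j p a ≡ V j p a
    χV≡V a = trans (sym (ℤ.*-assoc (χ a) (p a) _)) (cong (_* H j (del a p)) (χp≡p a))
    square : ∀ d g → d * (d * g) ≡ d * d * g
    square = solve-∀
    pairs≥0 : 0ℤ ≤ ∑∑ (allFin _) (λ i l → (χ i * χ l) * ((p i - p l) * (V j p i - V j p l)))
    pairs≥0 = 0≤∑∑ (allFin _) (λ i l → 0≤* (0≤* (0≤χ i) (0≤χ l))
      (subst (0ℤ ≤_) (sym (trans (cong ((p i - p l) *_) (V-difference j p i l)) (square (p i - p l) _)))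
        (0≤* (0≤x*x (p i - p l)) (0≤H j (0≤del l (0≤del i 0≤p))))))
    cancel₂ : ∀ x y → + 2 * (x - y) ≡ + 2 * x - + 2 * y
    cancel₂ = solve-∀
    mT≤ : m * T ≤ c * S
    mT≤ = ℤ.*-cancelˡ-≤-pos (m * T) (c * S) (+ 2) (≤-by-difference pairs≥0
      (trans (∑∑-differences (allFin _) χ p (V j p))
      (trans (cong (+ 2 *_) (cong₂ _-_
        (cong (c *_) (∑-cong (allFin _) (λ a → trans (sym (ℤ.*-assoc (χ a) (p a) _)) (cong (_* V j p a) (χp≡p a)))))
        (cong₂ _*_ (∑-cong (allFin _) χp≡p) (∑-cong (allFin _) χV≡V))))
      (cancel₂ (c * S) (m * T)))))

  D² : (Fin b → ℤ) → Fin b → Fin b → ℤ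
  D² p i l = (p i - p l) * (p i - p l)

  -- The same argument on all symbols, with the Chebyshev gap kept exactly: it is the deficit that
  -- later pays for the covariance.
  H-step : ∀ j (p : Fin b → ℤ) →
           + 2 * (+ b * H (suc (suc j)) p) + + suc j * ∑∑ (allFin b) (λ i l → D² p i l * g j p i l) ≡
           + 2 * ((+ b - + suc j) * (∑Fin p * H (suc j) p))
  H-step {b} j p = begin
    + 2 * (+ b * H (suc (suc j)) p) + s * ∑∑ (allFin b) (λ i l → D² p i l * g j p i l)
      ≡⟨ cong₂ (λ t u → + 2 * (+ b * t) + s * u) (∑-H-del j p p)
          (trans (∑∑-cong (allFin b) (λ i l → trans (ℤ.*-assoc (p i - p l) (p i - p l) (g j p i l))
                                                (cong ((p i - p l) *_) (sym (V-difference j p i l)))))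
          (trans (∑∑-differences₁ (allFin b) p (V j p))
                 (cong (λ n → + 2 * (+ n * S - m * T)) (length-allFin b)))) ⟩
    + 2 * (+ b * (m * T - s * S)) + s * (+ 2 * (+ b * S - m * T))
      ≡⟨ finish (+ b) m T s S ⟩
    + 2 * ((+ b - s) * (m * T)) ∎
    where
    open ≡-Reasoning
    m = ∑Fin p
    T = H (suc j) p
    s = + suc j
    S = ∑Fin (λ a → p a * V j p a)
    finish : ∀ b m T s S → + 2 * (b * (m * T - s * S)) + s * (+ 2 * (b * S - m * T)) ≡ + 2 * ((b - s) * (m * T))
    finish = solve-∀

  fallingℤ : ℤ → ℕ → ℤ
  fallingℤ b zero    = 1ℤ
  fallingℤ b (suc j) = fallingℤ b j * (b - + j)

  -- α b j = b (b-2)(b-3)⋯(b-j-2); α and γ are the coefficients in Λ-lower.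
  α γ : ℤ → ℕ → ℤ
  α b zero    = b * (b - + 2)
  α b (suc j) = (b - + suc (suc (suc j))) * α b j
  γ b zero    = 0ℤ
  γ b (suc j) = (b - + 2) * (γ b j + + suc (suc j) * b ^ suc (suc j))

  ∑-off : ∀ {n} (i : Fin n) → ∑Fin (off i) ≡ + n - 1ℤ
  ∑-off {n} i = begin
    ∑Fin (off i)                      ≡⟨ cancel (∑Fin (off i)) ⟩
    ∑Fin (off i) + 1ℤ - 1ℤ            ≡⟨ cong (λ t → t + 1ℤ - 1ℤ) (∑-cong (allFin n) (λ a → sym (ℤ.*-identityʳ (off i a)))) ⟩
    ∑Fin (λ a → off i a * 1ℤ) + 1ℤ - 1ℤ ≡⟨ cong (λ t → t - 1ℤ) (trans (∑Fin-off i (λ _ → 1ℤ)) (trans (∑-1 (allFin n)) (cong +_ (length-allFin n)))) ⟩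
    + n - 1ℤ                          ∎
    where
    open ≡-Reasoning
    cancel : ∀ x → x ≡ x + 1ℤ - 1ℤ
    cancel = solve-∀

  ∑-off₂ : ∀ {n} {i l : Fin n} → i ≢ l → ∑Fin (λ a → off l a * off i a) ≡ + n - + 2
  ∑-off₂ {n} {i} {l} i≢l = begin
    S                            ≡⟨ cancel S (off i l) ⟩
    S + off i l - off i l        ≡⟨ cong₂ _-_ (∑Fin-off l (off i)) (off-≢ i≢l) ⟩
    ∑Fin (off i) - 1ℤ            ≡⟨ cong (_- 1ℤ) (∑-off i) ⟩
    + n - 1ℤ - 1ℤ                ≡⟨ finish (+ n) ⟩
    + n - + 2                    ∎
    where
    open ≡-Reasoning
    S = ∑Fin (λ a → off l a * off i a)
    cancel : ∀ x y → x ≡ x + y - y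
    cancel = solve-∀
    finish : ∀ x → x - 1ℤ - 1ℤ ≡ x - + 2
    finish = solve-∀

  off≤1 : ∀ {n} (l a : Fin n) → 0ℤ ≤ 1ℤ - off l a
  off≤1 zero    zero    = +≤+ ℕ.z≤n
  off≤1 zero    (suc _) = +≤+ ℕ.z≤n
  off≤1 (suc _) zero    = +≤+ ℕ.z≤n
  off≤1 (suc l) (suc a) = off≤1 l a

  del-≤ : ∀ {n} (l : Fin n) {p : Fin n → ℤ} → (∀ a → 0ℤ ≤ p a) → ∀ a → del l p a ≤ p a
  del-≤ l {p} 0≤p a = ≤-by-difference (0≤* (off≤1 l a) (0≤p a)) (arrange (off l a) (p a))
    where
    arrange : ∀ o x → (1ℤ - o) * x ≡ x - o * x
    arrange = solve-∀

  module Spread (b : ℕ) (p : Fin b → ℤ) (m : ℤ) (0≤p : ∀ a → 0ℤ ≤ p a) (∑p≡m : ∑Fin p ≡ m) where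

    0≤m : 0ℤ ≤ m
    0≤m = subst (0ℤ ≤_) ∑p≡m (0≤∑ (allFin b) 0≤p)

    0≤g : ∀ j i l → 0ℤ ≤ g j p i l
    0≤g j i l = 0≤H j (0≤del l (0≤del i 0≤p))

    -- `H-step-≤` on the b - 2 symbols that remain without `i` and `l`, whose total is at most `m`.
    g-step : ∀ j {i l} → i ≢ l → 0ℤ ≤ + b - + suc (suc j) →
             (+ b - + 2) * g (suc j) p i l ≤ (+ b - + suc (suc j)) * (m * g j p i l)
    g-step j {i} {l} i≢l 0≤b-j-2 = ≤-trans
      (subst (λ t → t * g (suc j) p i l ≤ (t - + j) * (∑Fin p′ * g j p i l)) (∑-off₂ i≢l)
        (H-step-≤ j (λ a → off l a * off i a) p′ (λ a → 0≤* (0≤off l a) (0≤off i a)) 0≤p′ support))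
      (≤-by-difference (0≤* 0≤b-j-2 (0≤* (ℤ.i≤j⇒0≤j-i ∑p′≤m) (0≤g j i l)))
        (arrange (+ b) (+ j) m (∑Fin p′) (g j p i l)))
      where
      p′ = del l (del i p)
      0≤p′ : ∀ a → 0ℤ ≤ p′ a
      0≤p′ = 0≤del l (0≤del i 0≤p)
      ∑p′≤m : ∑Fin p′ ≤ m
      ∑p′≤m = subst (∑Fin p′ ≤_) ∑p≡m
        (∑-mono (allFin b) (λ a → ≤-trans (del-≤ l (0≤del i 0≤p) a) (del-≤ i 0≤p a)))
      support : ∀ a → off l a * off i a * p′ a ≡ p′ a
      support a = trans (regroup (off l a) (off i a) (p a))
        (cong₂ (λ t u → t * (u * p a)) (off-idem l a) (off-idem i a))
        where
        regroup : ∀ o o′ x → o * o′ * (o * (o′ * x)) ≡ o * o * (o′ * o′ * x)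
        regroup = solve-∀
      arrange : ∀ b j m s g → (b - (+ 2 + j)) * ((m - s) * g) ≡ (b - (+ 2 + j)) * (m * g) - (b - + 2 - j) * (s * g)
      arrange = solve-∀

    -- Coefficients obtained by iterating `H-step`: each step multiplies the earlier ones by its
    -- factor and adds one term in the current g. The start is 0 because `H 1 p` is `m` for every
    -- `p`.
    Λ : ℕ → Fin b → Fin b → ℤ
    Λ zero    i l = 0ℤ
    Λ (suc j) i l = (+ b - + suc j) * m * Λ j i l + + suc j * (+ b) ^ suc j * g j p i l

    H-deficit : ∀ j → + 2 * ((+ b) ^ suc j * H (suc j) p) + ∑∑ (allFin b) (λ i l → D² p i l * Λ j i l) ≡
                      + 2 * (fallingℤ (+ b) (suc j) * m ^ suc j)
    H-deficit zero = begin
      + 2 * (+ b * 1ℤ * ∑Fin (λ a → p a * 1ℤ)) + ∑∑ (allFin b) (λ i l → D² p i l * 0ℤ)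
        ≡⟨ cong₂ (λ t u → + 2 * (+ b * 1ℤ * t) + u) (trans (∑-*ʳ (allFin b) 1ℤ p) (cong (_* 1ℤ) ∑p≡m))
            (∑-0 (allFin b) (λ i → ∑-0 (allFin b) (λ l → ℤ.*-zeroʳ (D² p i l)))) ⟩
      + 2 * (+ b * 1ℤ * (m * 1ℤ)) + 0ℤ
        ≡⟨ finish (+ b) m ⟩
      + 2 * (1ℤ * (+ b - 0ℤ) * (m * 1ℤ)) ∎
      where
      open ≡-Reasoning
      finish : ∀ b m → + 2 * (b * 1ℤ * (m * 1ℤ)) + 0ℤ ≡ + 2 * (1ℤ * (b - 0ℤ) * (m * 1ℤ))
      finish = solve-∀
    H-deficit (suc j) = begin
      + 2 * (+ b * B * H₂) + ∑∑ (allFin b) (λ i l → D² p i l * Λ (suc j) i l)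
        ≡⟨ cong (λ t → + 2 * (+ b * B * H₂) + t)
             (trans (∑∑-cong (allFin b) (λ i l → distribute (D² p i l) e m (Λ j i l) s B (g j p i l)))
             (trans (∑∑-+ (allFin b) (λ i l → (e * m) * (D² p i l * Λ j i l)) (λ i l → (s * B) * (D² p i l * g j p i l)))
                    (cong₂ _+_ (∑∑-*ˡ (allFin b) (e * m) (λ i l → D² p i l * Λ j i l))
                               (∑∑-*ˡ (allFin b) (s * B) (λ i l → D² p i l * g j p i l))))) ⟩
      + 2 * (+ b * B * H₂) + (e * m * S + s * B * S′)
        ≡⟨ regroup (+ b) B H₂ e m S s S′ ⟩
      B * (+ 2 * (+ b * H₂) + s * S′) + e * m * S
        ≡⟨ cong (λ t → B * t + e * m * S) (trans (H-step j p) (cong (λ t → + 2 * (e * (t * H₁))) ∑p≡m)) ⟩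
      B * (+ 2 * (e * (m * H₁))) + e * m * S
        ≡⟨ factor B e m H₁ S ⟩
      e * m * (+ 2 * (B * H₁) + S)
        ≡⟨ cong (e * m *_) (H-deficit j) ⟩
      e * m * (+ 2 * (F * M))
        ≡⟨ finish e m F M ⟩
      + 2 * (F * e * (m * M)) ∎
      where
      open ≡-Reasoning
      B = (+ b) ^ suc j
      H₂ = H (suc (suc j)) p
      H₁ = H (suc j) p
      s = + suc j
      e = + b - + suc j
      S = ∑∑ (allFin b) (λ i l → D² p i l * Λ j i l)
      S′ = ∑∑ (allFin b) (λ i l → D² p i l * g j p i l)
      F = fallingℤ (+ b) (suc j)
      M = m ^ suc j
      distribute : ∀ d e m L s B g → d * (e * m * L + s * B * g) ≡ (e * m) * (d * L) + (s * B) * (d * g)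
      distribute = solve-∀
      regroup : ∀ b B h e m S s S′ → + 2 * (b * B * h) + (e * m * S + s * B * S′) ≡ B * (+ 2 * (b * h) + s * S′) + e * m * S
      regroup = solve-∀
      factor : ∀ B e m h S → B * (+ 2 * (e * (m * h))) + e * m * S ≡ e * m * (+ 2 * (B * h) + S)
      factor = solve-∀
      finish : ∀ e m F M → e * m * (+ 2 * (F * M)) ≡ + 2 * (F * e * (m * M))
      finish = solve-∀

    0≤b-[_+2] : ∀ j → 0ℤ ≤ + b - + suc (suc (suc j)) → 0ℤ ≤ + b - + suc (suc j)
    0≤b-[ j +2] h = ≤-trans h (≤-by-difference {e = 1ℤ} (+≤+ ℕ.z≤n) (arrange (+ b) (+ j)))
      where
      arrange : ∀ b j → 1ℤ ≡ (b - (+ 2 + j)) - (b - (+ 3 + j))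
      arrange = solve-∀

    0≤b-2 : ∀ j → 0ℤ ≤ + b - + suc (suc j) → 0ℤ ≤ + b - + 2
    0≤b-2 zero    h = h
    0≤b-2 (suc j) h = 0≤b-2 j (0≤b-[ j +2] h)

    -- Unfolded, `Λ (suc j)` is a combination of g of orders 0 to `j` with nonnegative coefficients.
    -- The term of order 0, where g = 1, is kept and gives `α`; all others are lowered to multiples
    -- of g of order `suc j` by `g-step`, and these add up to `γ`.
    Λ-lower : ∀ j {i l} → i ≢ l → 0ℤ ≤ + b - + suc (suc j) →
              α (+ b) j * m ^ suc j + γ (+ b) j * g (suc j) p i l ≤ (+ b - + suc (suc j)) * m * Λ (suc j) i l
    Λ-lower zero {i} {l} i≢l 0≤b-2 = ≤-reflexive (arrange (+ b) m (g 1 p i l))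
      where
      arrange : ∀ b m g → b * (b - + 2) * (m * 1ℤ) + 0ℤ * g ≡
                (b - + 2) * m * ((b - 1ℤ) * m * 0ℤ + 1ℤ * (b * 1ℤ) * 1ℤ)
      arrange = solve-∀
    Λ-lower (suc j) {i} {l} i≢l 0≤e′ = ≤-by-difference
      (0≤+ (0≤* (0≤* 0≤e′ 0≤m) (ℤ.i≤j⇒0≤j-i (Λ-lower j i≢l 0≤e)))
           (0≤* (0≤+ (0≤γ j 0≤e) (0≤* {+ suc (suc j)} (+≤+ ℕ.z≤n) (0≤^ (suc (suc j)) (+≤+ ℕ.z≤n))))
                (ℤ.i≤j⇒0≤j-i (g-step (suc j) i≢l 0≤e′))))
      (finish e′ m e L A M Γ g₁ (+ b) s B g₂)
      where
      e′ = + b - + suc (suc (suc j))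
      e = + b - + suc (suc j)
      0≤e = 0≤b-[ j +2] 0≤e′
      L = Λ (suc j) i l
      A = α (+ b) j
      M = m ^ suc j
      Γ = γ (+ b) j
      g₁ = g (suc j) p i l
      g₂ = g (suc (suc j)) p i l
      s = + suc (suc j)
      B = (+ b) ^ suc (suc j)
      0≤γ : ∀ j → 0ℤ ≤ + b - + suc (suc j) → 0ℤ ≤ γ (+ b) j
      0≤γ zero    h = +≤+ ℕ.z≤n
      0≤γ (suc j) h = 0≤* (0≤b-2 (suc j) h)
        (0≤+ (0≤γ j (0≤b-[ j +2] h)) (0≤* {+ suc (suc j)} (+≤+ ℕ.z≤n) (0≤^ (suc (suc j)) (+≤+ ℕ.z≤n))))
      finish : ∀ e′ m e L A M Γ g₁ b s B g₂ →
        e′ * m * (e * m * L - (A * M + Γ * g₁)) + (Γ + s * B) * (e′ * (m * g₁) - (b - + 2) * g₂) ≡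
        e′ * m * (e * m * L + s * B * g₁) - (e′ * A * (m * M) + (b - + 2) * (Γ + s * B) * g₂)
      finish = solve-∀

    -- Iterate `g-step` from g of order 0, which is 1. This is the range of g on which the quadratic
    -- estimate in `Admissible` has to hold.
    g-upper : ∀ j {i l} → i ≢ l → 0ℤ ≤ + b - + suc (suc j) →
              + b * (+ b - + 2) ^ suc j * g (suc j) p i l ≤ α (+ b) j * m ^ suc j
    g-upper zero {i} {l} i≢l 0≤b-2 = ≤-by-difference
      (0≤* {+ b} (+≤+ ℕ.z≤n) (ℤ.i≤j⇒0≤j-i (g-step 0 i≢l 0≤b-2))) (arrange (+ b) m (g 1 p i l))
      where
      arrange : ∀ b m g → b * ((b - + 2) * (m * 1ℤ) - (b - + 2) * g) ≡ b * (b - + 2) * (m * 1ℤ) - b * ((b - + 2) * 1ℤ) * g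
      arrange = solve-∀
    g-upper (suc j) {i} {l} i≢l 0≤e′ = ≤-by-difference
      (0≤+ (0≤* (0≤* 0≤e′ 0≤m) (ℤ.i≤j⇒0≤j-i (g-upper j i≢l 0≤e)))
           (0≤* (0≤* {+ b} (+≤+ ℕ.z≤n) (0≤^ (suc j) (0≤b-2 j 0≤e)))
                (ℤ.i≤j⇒0≤j-i (g-step (suc j) i≢l 0≤e′))))
      (finish e′ m (α (+ b) j) (m ^ suc j) (+ b) (+ b - + 2) ((+ b - + 2) ^ suc j) (g (suc j) p i l) (g (suc (suc j)) p i l))
      where
      e′ = + b - + suc (suc (suc j))
      0≤e = 0≤b-[ j +2] 0≤e′
      finish : ∀ e′ m A M b c C g₁ g₂ →
        e′ * m * (A * M - b * C * g₁) + b * C * (e′ * (m * g₁) - c * g₂) ≡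
        e′ * A * (m * M) - b * (c * C) * g₂
      finish = solve-∀

  -- Covariance against deficit, summed over a family of groups

  0<* : ∀ {x y} → 0ℤ < x → 0ℤ < y → 0ℤ < x * y
  0<* {x} {y} 0<x 0<y = subst (_< x * y) (ℤ.*-zeroʳ x) (ℤ.*-monoˡ-<-pos x {{positive 0<x}} 0<y)

  cancel-0≤ : ∀ {x y} → 0ℤ < x → 0ℤ ≤ x * y → 0ℤ ≤ y
  cancel-0≤ {x} {y} 0<x 0≤xy =
    ℤ.*-cancelˡ-≤-pos 0ℤ y x {{positive 0<x}} (subst (_≤ x * y) (sym (ℤ.*-zeroʳ x)) 0≤xy)

  ∑-- : ∀ {a} {A : Set a} (xs : List A) (f g : A → ℤ) → ∑ xs (λ x → f x - g x) ≡ ∑ xs f - ∑ xs g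
  ∑-- []       f g = refl
  ∑-- (x ∷ xs) f g = trans (cong (λ t → f x - g x + t) (∑-- xs f g)) (arrange (f x) (g x) (∑ xs f) (∑ xs g))
    where
    arrange : ∀ x y u v → x - y + (u - v) ≡ x + u - (y + v)
    arrange = solve-∀

  ∑-const : ∀ {a} {A : Set a} (xs : List A) (c : ℤ) → ∑ xs (λ _ → c) ≡ + length xs * c
  ∑-const xs c = trans (∑-cong xs (λ _ → sym (ℤ.*-identityˡ c))) (trans (∑-*ʳ xs c (λ _ → 1ℤ)) (cong (_* c) (∑-1 xs)))

  π κ : ℤ → ℕ → ℤ
  π b j = + suc (suc j) * b ^ suc (suc j)
  κ b j = b * (b - + 2) ^ suc j

  -- π²≤ makes (3αw - πg)² + 3α²w² ≤ 12αw(αw + γg) for 0 ≤ g ≤ αw/κ. Here c = 3αw/π is the constant of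
  -- the covariance bound, and the term 3α²w² becomes the gain for non-uniform distributions.
  record Admissible (b j : ℕ) : Set where
    field
      N≤b   : 0ℤ ≤ + b - + suc (suc j)
      0<α   : 0ℤ < α (+ b) j
      0<κ   : 0ℤ < κ (+ b) j
      π²≤   : π (+ b) j * π (+ b) j ≤ + 6 * (+ 2 * γ (+ b) j + π (+ b) j) * κ (+ b) j

  module Averaging (b j : ℕ) (admissible : Admissible b j) where

    open Admissible admissible

    β N A Γ P K : ℤ
    β = + b
    N = + suc (suc j)
    A = α β j
    Γ = γ β j
    P = π β j
    K = κ β j

    module One (p : Fin b → ℤ) (m : ℤ) (0≤p : ∀ a → 0ℤ ≤ p a) (∑p≡m : ∑Fin p ≡ m) where

      open Spread b p m 0≤p ∑p≡m

      w : ℤ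
      w = m ^ suc j

      0≤w : 0ℤ ≤ w
      0≤w = 0≤^ (suc j) 0≤m

      G : Fin b → Fin b → ℤ
      G = g (suc j) p

      -- What the estimate of a pair leaves after its square is expanded and a factor `G` is taken
      -- out. Inserting `g-upper` reduces it to `π²≤`.
      gap : ∀ {i l} → i ≢ l → 0ℤ ≤ + 6 * A * (+ 2 * Γ + P) * w - P * P * G i l
      gap {i} {l} i≢l = cancel-0≤ 0<κ (subst (0ℤ ≤_) (arrange A (+ 2 * Γ + P) w P (G i l) K)
        (0≤+ (0≤* (0≤x*x P) (ℤ.i≤j⇒0≤j-i (g-upper j i≢l N≤b)))
             (0≤* (0≤* (ℤ.<⇒≤ 0<α) 0≤w) (ℤ.i≤j⇒0≤j-i π²≤))))
        where
        arrange : ∀ A Q w P g κ → P * P * (A * w - κ * g) + A * w * (+ 6 * Q * κ - P * P) ≡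
                                  κ * (+ 6 * A * Q * w - P * P * g)
        arrange = solve-∀

      -- By `Λ-lower` the right side is at least 12αw(αw + γG) times `D²`, which exceeds the left
      -- side by `D²` times `G` times the expression in `gap`. The diagonal is separate because
      -- `Λ-lower` needs distinct symbols; there `D²` is 0.
      pair-bound : ∀ i l →
        D² p i l * ((+ 3 * A * w - P * G i l) * (+ 3 * A * w - P * G i l)) + + 3 * A * A * w * w * D² p i l ≤
        + 12 * A * w * ((β - N) * m) * (D² p i l * Λ (suc j) i l)
      pair-bound i l with i ≟ l
      ... | yes refl = ≤-reflexive (trivial (p i) A w (P * G i i) (β - N) m (Λ (suc j) i i))
        where
        trivial : ∀ x A w z e m L → (x - x) * (x - x) * ((+ 3 * A * w - z) * (+ 3 * A * w - z)) + + 3 * A * A * w * w * ((x - x) * (x - x)) ≡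
                  + 12 * A * w * (e * m) * ((x - x) * (x - x) * L)
        trivial = solve-∀
      ... | no i≢l = ≤-by-difference
        (0≤* (0≤x*x (p i - p l))
          (0≤+ (0≤* (0≤g (suc j) i l) (gap i≢l))
               (0≤* (0≤* (0≤* {+ 12} (+≤+ ℕ.z≤n) (ℤ.<⇒≤ 0<α)) 0≤w) (ℤ.i≤j⇒0≤j-i (Λ-lower j i≢l N≤b)))))
        (finish (D² p i l) A w P (G i l) Γ (β - N) m (Λ (suc j) i l))
        where
        finish : ∀ d A w P g Γ e m L →
          d * (g * (+ 6 * A * (+ 2 * Γ + P) * w - P * P * g) + + 12 * A * w * (e * m * L - (A * w + Γ * g))) ≡
          + 12 * A * w * (e * m) * (d * L) - (d * ((+ 3 * A * w - P * g) * (+ 3 * A * w - P * g)) + + 3 * A * A * w * w * d)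
        finish = solve-∀

      deficit-bound :
        ∑∑ (allFin b) (λ i l → D² p i l * ((+ 3 * A * w - P * G i l) * (+ 3 * A * w - P * G i l))) +
        + 3 * A * A * w * w * ∑∑ (allFin b) (D² p) ≤
        + 24 * A * w * ((β - N) * m) * (fallingℤ β (suc (suc j)) * (m * w) - β ^ suc (suc j) * H (suc (suc j)) p)
      deficit-bound = subst₂ _≤_ lhs rhs (∑∑-mono (allFin b) pair-bound)
        where
        c = + 12 * A * w * ((β - N) * m)
        L = ∑∑ (allFin b) (λ i l → D² p i l * Λ (suc j) i l)
        B = β ^ suc (suc j) * H (suc (suc j)) p
        F = fallingℤ β (suc (suc j)) * (m * w)
        E : Fin b → Fin b → ℤ
        E i l = D² p i l * ((+ 3 * A * w - P * G i l) * (+ 3 * A * w - P * G i l))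
        lhs = trans (∑∑-+ (allFin b) E (λ i l → + 3 * A * A * w * w * D² p i l))
                    (cong (λ t → ∑∑ (allFin b) E + t) (∑∑-*ˡ (allFin b) (+ 3 * A * A * w * w) (D² p)))
        solved : L ≡ + 2 * (F - B)
        solved = begin
          L                            ≡⟨ cancel L (+ 2 * B) ⟩
          + 2 * B + L - + 2 * B        ≡⟨ cong (_- + 2 * B) (H-deficit (suc j)) ⟩
          + 2 * F - + 2 * B            ≡⟨ factor F B ⟩
          + 2 * (F - B)                ∎
          where
          open ≡-Reasoning
          cancel : ∀ x y → x ≡ y + x - y
          cancel = solve-∀
          factor : ∀ x y → + 2 * x - + 2 * y ≡ + 2 * (x - y)
          factor = solve-∀
        collect : ∀ A w e D → + 12 * A * w * e * (+ 2 * D) ≡ + 24 * A * w * e * D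
        collect = solve-∀
        rhs = trans (∑∑-*ˡ (allFin b) c (λ i l → D² p i l * Λ (suc j) i l))
          (trans (cong (c *_) solved) (collect A w ((β - N) * m) (F - B)))

    module Family {a} {X : Set a} (xs : List X) (p : X → Fin b → ℤ) (m : ℤ)
      (0≤p : ∀ x c → 0ℤ ≤ p x c) (∑p≡m : ∀ x → ∑Fin (p x) ≡ m) (0<m : 0ℤ < m) where

      n w T : ℤ
      n = + length xs
      w = m ^ suc j
      T = ∑ xs (λ x → H (suc (suc j)) (p x))

      q W : Fin b → ℤ
      q c = ∑ xs (λ x → p x c)
      W c = ∑ xs (λ x → V (suc j) (p x) c)

      -- When `p` consists of symbol counts, this is the number of triples of a group, a word of the
      -- union and an N-tuple from the group whose symbols at the coordinate are pairwise distinct.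
      Z : ℤ
      Z = ∑ xs (λ x → ∑Fin (λ c → q c * H (suc (suc j)) (del c (p x))))

      ∑q : ∑Fin q ≡ n * m
      ∑q = trans (sym (∑-swap xs (allFin b) p)) (trans (∑-cong xs ∑p≡m) (∑-const xs m))

      ∑W : ∑Fin W ≡ T
      ∑W = sym (∑-swap xs (allFin b) (λ x → V (suc j) (p x)))

      Z-eq : Z ≡ n * m * T - N * ∑Fin (λ c → q c * W c)
      Z-eq = begin
        ∑ xs (λ x → ∑Fin (λ c → q c * H (suc (suc j)) (del c (p x))))
          ≡⟨ ∑-cong xs (λ x → ∑-H-del (suc j) (p x) q) ⟩
        ∑ xs (λ x → ∑Fin q * H (suc (suc j)) (p x) - N * ∑Fin (λ c → q c * V (suc j) (p x) c))
          ≡⟨ ∑-- xs _ _ ⟩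
        ∑ xs (λ x → ∑Fin q * H (suc (suc j)) (p x)) - ∑ xs (λ x → N * ∑Fin (λ c → q c * V (suc j) (p x) c))
          ≡⟨ cong₂ _-_ (trans (∑-*ˡ xs (∑Fin q) (λ x → H (suc (suc j)) (p x))) (cong (_* T) ∑q))
               (trans (∑-*ˡ xs N (λ x → ∑Fin (λ c → q c * V (suc j) (p x) c)))
                 (cong (N *_) (trans (∑-swap xs (allFin b) (λ x c → q c * V (suc j) (p x) c))
                   (∑-cong (allFin b) (λ c → ∑-*ˡ xs (q c) (λ x → V (suc j) (p x) c)))))) ⟩
        n * m * T - N * ∑Fin (λ c → q c * W c) ∎
        where open ≡-Reasoning

      d G : X → Fin b → Fin b → ℤ
      d x i l = p x i - p x l
      G x = g (suc j) (p x)

      u : X → Fin b → Fin b → ℤ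
      u x i l = + 3 * A * w - P * G x i l

      ∑d : ∀ i l → ∑ xs (λ x → d x i l) ≡ q i - q l
      ∑d i l = ∑-- xs (λ x → p x i) (λ x → p x l)

      ∑dG : ∀ i l → ∑ xs (λ x → d x i l * G x i l) ≡ W i - W l
      ∑dG i l = trans (∑-cong xs (λ x → sym (V-difference (suc j) (p x) i l)))
                      (∑-- xs (λ x → V (suc j) (p x) i) (λ x → V (suc j) (p x) l))

      -- (x + y)² ≥ 0 with x = 3Aw∑d and y = P∑dG bounds 4xy below by -(x - y)², and x - y = ∑du.
      correlation : ∀ i l →
        0ℤ ≤ + 12 * A * w * P * ((q i - q l) * (W i - W l)) + n * ∑ xs (λ x → D² (p x) i l * (u x i l * u x i l))
      correlation i l = subst (0ℤ ≤_) eq (0≤+ (0≤x*x (+ 3 * A * w * Q + P * R)) (ℤ.i≤j⇒0≤j-i (cauchy-schwarz xs (λ x → d x i l * u x i l))))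
        where
        Q = q i - q l
        R = W i - W l
        S = ∑ xs (λ x → d x i l * u x i l * (d x i l * u x i l))
        ∑du : ∑ xs (λ x → d x i l * u x i l) ≡ + 3 * A * w * Q - P * R
        ∑du = begin
          ∑ xs (λ x → d x i l * u x i l)
            ≡⟨ ∑-cong xs (λ x → distribute (d x i l) (+ 3 * A * w) P (G x i l)) ⟩
          ∑ xs (λ x → + 3 * A * w * d x i l - P * (d x i l * G x i l))
            ≡⟨ ∑-- xs _ _ ⟩
          ∑ xs (λ x → + 3 * A * w * d x i l) - ∑ xs (λ x → P * (d x i l * G x i l))
            ≡⟨ cong₂ _-_ (trans (∑-*ˡ xs (+ 3 * A * w) (λ x → d x i l)) (cong (+ 3 * A * w *_) (∑d i l)))
                         (trans (∑-*ˡ xs P (λ x → d x i l * G x i l)) (cong (P *_) (∑dG i l))) ⟩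
          + 3 * A * w * Q - P * R ∎
          where
          open ≡-Reasoning
          distribute : ∀ d c P g → d * (c - P * g) ≡ c * d - P * (d * g)
          distribute = solve-∀
        arrange : ∀ A w P Q R n S → (+ 3 * A * w * Q + P * R) * (+ 3 * A * w * Q + P * R) +
          (n * S - (+ 3 * A * w * Q - P * R) * (+ 3 * A * w * Q - P * R)) ≡ + 12 * A * w * P * (Q * R) + n * S
        arrange = solve-∀
        regroup : ∀ d u → d * u * (d * u) ≡ d * d * (u * u)
        regroup = solve-∀
        eq = trans (cong (λ t → (+ 3 * A * w * Q + P * R) * (+ 3 * A * w * Q + P * R) + (n * S - t * t)) ∑du)
          (trans (arrange A w P Q R n S)
            (cong (λ t → + 12 * A * w * P * (Q * R) + n * t) (∑-cong xs (λ x → regroup (d x i l) (u x i l)))))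

      S₁ S₂ S₃ S₄ : ℤ
      S₁ = ∑∑ (allFin b) (λ i l → (q i - q l) * (W i - W l))
      S₂ = ∑ xs (λ x → ∑∑ (allFin b) (λ i l → D² (p x) i l * (u x i l * u x i l)))
      S₃ = ∑ xs (λ x → ∑∑ (allFin b) (D² (p x)))
      S₄ = ∑∑ (allFin b) (D² q)

      ∑-∑∑-swap : (f : X → Fin b → Fin b → ℤ) →
                  ∑∑ (allFin b) (λ i l → n * ∑ xs (λ x → f x i l)) ≡ n * ∑ xs (λ x → ∑∑ (allFin b) (f x))
      ∑-∑∑-swap f = trans (∑∑-*ˡ (allFin b) n (λ i l → ∑ xs (λ x → f x i l))) (cong (n *_) (sym
        (trans (∑-swap xs (allFin b) (λ x i → ∑Fin (f x i)))
               (∑-cong (allFin b) (λ i → ∑-swap xs (allFin b) (λ x → f x i))))))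

      correlations : 0ℤ ≤ + 12 * A * w * P * S₁ + n * S₂
      correlations = subst (0ℤ ≤_)
        (trans (∑∑-+ (allFin b) _ _) (cong₂ _+_ (∑∑-*ˡ (allFin b) (+ 12 * A * w * P) _) (∑-∑∑-swap _)))
        (0≤∑∑ (allFin b) correlation)

      -- The variance of a mean is at most the mean of the variances. This turns the spare term
      -- 3α²w² of the deficits into a gain in terms of `q` alone.
      S₄≤nS₃ : S₄ ≤ n * S₃
      S₄≤nS₃ = subst (S₄ ≤_) (∑-∑∑-swap (λ x → D² (p x)))
        (∑∑-mono (allFin b) (λ i l → subst (_≤ n * ∑ xs (λ x → D² (p x) i l))
          (cong (λ t → t * t) (∑d i l)) (cauchy-schwarz xs (λ x → d x i l))))

      F M B : ℤ
      F = fallingℤ β (suc (suc j))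
      M = m * w
      B = β ^ suc (suc j)

      deficits : S₂ + + 3 * A * A * w * w * S₃ ≤ + 24 * A * w * ((β - N) * m) * (n * (F * M) - B * T)
      deficits = subst₂ _≤_
        (trans (∑-+ xs _ _) (cong (λ t → S₂ + t) (∑-*ˡ xs (+ 3 * A * A * w * w) (λ x → ∑∑ (allFin b) (D² (p x))))))
        (trans (∑-*ˡ xs (+ 24 * A * w * ((β - N) * m)) (λ x → F * M - B * H (suc (suc j)) (p x)))
          (cong (+ 24 * A * w * ((β - N) * m) *_) (trans (∑-- xs _ _)
            (cong₂ _-_ (∑-const xs (F * M)) (∑-*ˡ xs B (λ x → H (suc (suc j)) (p x)))))))
        (∑-mono xs (λ x → One.deficit-bound (p x) m (0≤p x) (∑p≡m x)))

      -- In n times `deficits` plus `correlations` the sum `S₂` cancels; that is what the square in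
      -- `pair-bound` was prepared for. The remaining multiple of `S₃` is traded for `S₄`, and the
      -- common factor 3N(Aw), positive since m > 0, is divided out.
      separation-bound : + 8 * (β * B * Z) + A * w * S₄ ≤ + 8 * (n * n * (fallingℤ β (suc (suc (suc j))) * (m * M)))
      separation-bound = ℤ.0≤i-j⇒j≤i (cancel-0≤ 0<c (subst (0ℤ ≤_) eq
        (0≤* {N} (+≤+ ℕ.z≤n) (0≤+ (0≤+ (0≤* {n} (+≤+ ℕ.z≤n) (ℤ.i≤j⇒0≤j-i deficits)) correlations)
          (0≤* (0≤* (0≤* (0≤* (0≤* {+ 3} (+≤+ ℕ.z≤n) 0≤A) 0≤A) 0≤w) 0≤w) (ℤ.i≤j⇒0≤j-i S₄≤nS₃))))))
        where
        0≤A = ℤ.<⇒≤ 0<α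
        0<^ : ∀ i → 0ℤ < m ^ i
        0<^ zero    = +<+ (ℕ.s≤s ℕ.z≤n)
        0<^ (suc i) = 0<* 0<m (0<^ i)
        0≤w = ℤ.<⇒≤ (0<^ (suc j))
        c = + 3 * N * (A * w)
        0<c : 0ℤ < c
        0<c = 0<* {+ 3 * N} (0<* {+ 3} {N} (+<+ (ℕ.s≤s ℕ.z≤n)) (+<+ (ℕ.s≤s ℕ.z≤n))) (0<* 0<α (0<^ (suc j)))
        Y = ∑Fin (λ c → q c * W c)
        S₁-eq : S₁ ≡ + 2 * (β * Y - n * m * T)
        S₁-eq = trans (∑∑-differences₁ (allFin b) q W)
          (cong₂ (λ t u → + 2 * (+ t * Y - u)) (length-allFin b) (cong₂ _*_ ∑q ∑W))
        finish : ∀ N A w β m n F M B T Y S₂ S₃ S₄ →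
          N * ((n * (+ 24 * A * w * ((β - N) * m) * (n * (F * M) - B * T) - (S₂ + + 3 * A * A * w * w * S₃)) +
                (+ 12 * A * w * (N * B) * (+ 2 * (β * Y - n * m * T)) + n * S₂)) +
               + 3 * A * A * w * w * (n * S₃ - S₄)) ≡
          + 3 * N * (A * w) * (+ 8 * (n * n * (F * (β - N) * (m * M))) - (+ 8 * (β * B * (n * m * T - N * Y)) + A * w * S₄))
        finish = solve-∀
        eq = trans (cong (λ t → N * ((n * (+ 24 * A * w * ((β - N) * m) * (n * (F * M) - B * T) - (S₂ + + 3 * A * A * w * w * S₃)) +
                  (+ 12 * A * w * P * t + n * S₂)) + + 3 * A * A * w * w * (n * S₃ - S₄))) S₁-eq)
            (trans (finish N A w β m n F M B T Y S₂ S₃ S₄)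
                   (cong (λ t → c * (+ 8 * (n * n * (F * (β - N) * (m * M))) - (+ 8 * (β * B * t) + A * w * S₄))) (sym Z-eq)))

  -- Bounds for one coordinate: arbitrary, skewed and boxed

  term≤∑ : ∀ {n} (f : Fin n → ℤ) → (∀ a → 0ℤ ≤ f a) → ∀ a → f a ≤ ∑Fin f
  term≤∑ f 0≤f a = subst (f a ≤_) (∑Fin-off a f)
    (≤-by-difference (0≤∑ (allFin _) (λ c → 0≤* (0≤off a c) (0≤f c))) (arrange (∑Fin (λ c → off a c * f c)) (f a)))
    where
    arrange : ∀ x y → x ≡ x + y - y
    arrange = solve-∀

  -- Maclaurin's inequality on ∑χ symbols, by iterating `H-step-≤`. The hypothesis still admits ∑χ =
  -- j - 1, where the falling factorial is 0: that is the case of boxes too small to separate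
  -- anything.
  H-support-≤ : ∀ {b} j (χ p : Fin b → ℤ) → (∀ a → 0ℤ ≤ χ a) → (∀ a → 0ℤ ≤ p a) → (∀ a → χ a * p a ≡ p a) →
                0ℤ ≤ ∑Fin χ → (∀ i → i ℕ.< j → 0ℤ ≤ ∑Fin χ - + i) →
                ∑Fin χ ^ j * H j p ≤ fallingℤ (∑Fin χ) j * ∑Fin p ^ j
  H-support-≤ zero    χ p 0≤χ 0≤p support 0≤c large = ≤-refl
  H-support-≤ (suc j) χ p 0≤χ 0≤p support 0≤c large = ≤-by-difference
    (0≤+ (0≤* (0≤^ j 0≤c) (ℤ.i≤j⇒0≤j-i (H-step-≤ j χ p 0≤χ 0≤p support)))
         (0≤* (0≤* (large j ℕ.≤-refl) (0≤∑ (allFin _) 0≤p))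
              (ℤ.i≤j⇒0≤j-i (H-support-≤ j χ p 0≤χ 0≤p support 0≤c (λ i i<j → large i (ℕ.m≤n⇒m≤1+n i<j))))))
    (arrange (∑Fin χ) (∑Fin χ ^ j) (+ j) (∑Fin p) (H j p) (H (suc j) p) (fallingℤ (∑Fin χ) j) (∑Fin p ^ j))
    where
    arrange : ∀ c C j m h h′ F M →
      C * ((c - j) * (m * h) - c * h′) + (c - j) * m * (F * M - C * h) ≡ F * (c - j) * (m * M) - c * C * h′
    arrange = solve-∀

  module Coordinate (b j : ℕ) (admissible : Admissible b j)
    {X : Set} (xs : List X) (p : X → Fin b → ℤ) (m : ℤ)
    (0≤p : ∀ x c → 0ℤ ≤ p x c) (∑p≡m : ∀ x → ∑Fin (p x) ≡ m) (0<m : 0ℤ < m) where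

    open Averaging b j admissible
    open Family xs p m 0≤p ∑p≡m 0<m

    open Admissible admissible

    -- All triples, separated or not: `n` groups, nm words of the union and m^N tuples with
    -- repetition. So `Z` over `E` plays the part of the expected separation; that tuples of
    -- distinct words are fewer is corrected in `size-bound`.
    E : ℤ
    E = n * n * (m * M)

    0≤E : 0ℤ ≤ E
    0≤E = 0≤* (0≤* {n} {n} (+≤+ ℕ.z≤n) (+≤+ ℕ.z≤n)) (0≤* 0≤m (0≤* 0≤m (0≤^ (suc j) 0≤m)))
      where
      0≤m = ℤ.<⇒≤ 0<m

    0≤w : 0ℤ ≤ w
    0≤w = 0≤^ (suc j) (ℤ.<⇒≤ 0<m)

    F′ : ℤ
    F′ = fallingℤ β (suc (suc (suc j)))

    -- Brings the bounds for different kinds of coordinates to one denominator `d`, so that they can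
    -- be added.
    rescale : ∀ {y x d c} → 0ℤ < y → 0ℤ ≤ d → y * Z ≤ x * E → d * x ≤ c * y → d * Z ≤ c * E
    rescale {y} {x} {d} {c} 0<y 0≤d yZ≤xE dx≤cy = ℤ.0≤i-j⇒j≤i (cancel-0≤ 0<y (subst (0ℤ ≤_) (arrange y x d c Z E)
      (0≤+ (0≤* 0≤d (ℤ.i≤j⇒0≤j-i yZ≤xE)) (0≤* 0≤E (ℤ.i≤j⇒0≤j-i dx≤cy)))))
      where
      arrange : ∀ y x d c Z E → d * (x * E - y * Z) + E * (c * y - d * x) ≡ y * (c * E - d * Z)
      arrange = solve-∀

    0<B′ : 0ℤ < β * B
    0<B′ = 0<* 0<β (0<* 0<β (0<β^ (suc j)))
      where
      0<β : 0ℤ < β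
      0<β = ℤ.<-≤-trans {0ℤ} {N} (+<+ (ℕ.s≤s ℕ.z≤n)) (ℤ.0≤i-j⇒j≤i N≤b)
      0<β^ : ∀ i → 0ℤ < β ^ i
      0<β^ zero    = +<+ (ℕ.s≤s ℕ.z≤n)
      0<β^ (suc i) = 0<* 0<β (0<β^ i)

    0≤S₄ : 0ℤ ≤ S₄
    0≤S₄ = 0≤∑∑ (allFin b) (λ i l → 0≤x*x (q i - q l))

    any-coordinate : β * B * Z ≤ F′ * E
    any-coordinate = ℤ.*-cancelˡ-≤-pos _ _ (+ 8) (≤-by-difference
      (0≤+ (ℤ.i≤j⇒0≤j-i separation-bound) (0≤* (0≤* (ℤ.<⇒≤ 0<α) 0≤w) 0≤S₄))
      (arrange n F′ (m * M) (β * B * Z) (A * w * S₄)))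
      where
      arrange : ∀ n F mM x y → + 8 * (n * n * (F * mM)) - (+ 8 * x + y) + y ≡ + 8 * (F * (n * n * mM)) - + 8 * x
      arrange = solve-∀

    -- Cauchy-Schwarz for the differences q a - q l with `a` fixed, which form a single row of the
    -- double sum `S₄`.
    row-bound : ∀ a → (β * q a - n * m) * (β * q a - n * m) ≤ β * S₄
    row-bound a = ≤-trans (subst₂ (λ t k → t * t ≤ + k * ∑Fin (D² q a)) ∑-row (length-allFin b)
        (cauchy-schwarz (allFin b) (λ l → q a - q l)))
      (ℤ.*-monoˡ-≤-nonNeg β (term≤∑ (λ i → ∑Fin (D² q i)) (λ i → 0≤∑ (allFin b) (λ l → 0≤x*x (q i - q l))) a))
      where
      ∑-row : ∑Fin (λ l → q a - q l) ≡ β * q a - n * m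
      ∑-row = trans (∑-- (allFin b) (λ _ → q a) q)
        (cong₂ _-_ (trans (∑-const (allFin b) (q a)) (cong (λ k → + k * q a) (length-allFin b))) ∑q)

    -- The hypothesis gives the symbol `a` a share of at least (1 + t/u)/b in the union. By
    -- `row-bound` this forces `S₄`, and with it the gain in `separation-bound`, to be large.
    skewed-coordinate : ∀ u t → 0ℤ ≤ u → 0ℤ ≤ t → ∀ a → t * (n * m) ≤ u * (β * q a - n * m) →
                        + 8 * β * (u * u) * (β * B) * Z ≤ (+ 8 * β * (u * u) * F′ - A * (t * t)) * E
    skewed-coordinate u t 0≤u 0≤t a skew = ≤-by-difference
      (0≤+ (0≤+ (0≤* (0≤* {β} (+≤+ ℕ.z≤n) (0≤x*x u)) (ℤ.i≤j⇒0≤j-i separation-bound))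
                (0≤* (0≤* 0≤Aw (0≤x*x u)) (ℤ.i≤j⇒0≤j-i (row-bound a))))
           (0≤* 0≤Aw (0≤* (ℤ.i≤j⇒0≤j-i skew) (0≤+ (0≤* 0≤t 0≤nm) (≤-trans (0≤* 0≤t 0≤nm) skew)))))
      (arrange u t β B Z A w S₄ n m F′ (q a))
      where
      0≤Aw = 0≤* (ℤ.<⇒≤ 0<α) 0≤w
      0≤nm = 0≤* {n} (+≤+ ℕ.z≤n) (ℤ.<⇒≤ 0<m)
      arrange : ∀ u t β B Z A w S n m F q →
        β * (u * u) * (+ 8 * (n * n * (F * (m * (m * w)))) - (+ 8 * (β * B * Z) + A * w * S)) +
        A * w * (u * u) * (β * S - (β * q - n * m) * (β * q - n * m)) +
        A * w * ((u * (β * q - n * m) - t * (n * m)) * (t * (n * m) + u * (β * q - n * m))) ≡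
        (+ 8 * β * (u * u) * F - A * (t * t)) * (n * n * (m * (m * w))) - + 8 * β * (u * u) * (β * B) * Z
      arrange = solve-∀

    -- No covariance enters: every symbol has a share of at most v/u, so a random word avoids N
    -- given symbols and meets one of the other b - N with probability at most (b - N)v/u.
    -- Maclaurin's inequality on the `s` symbols of the box bounds the tuples.
    boxed-coordinate : ∀ s u v → 0ℤ ≤ u → 0ℤ ≤ v → 0ℤ ≤ s → (∀ i → i ℕ.< suc (suc j) → 0ℤ ≤ s - + i) →
      (χ : X → Fin b → ℤ) → (∀ x a → 0ℤ ≤ χ x a) → (∀ x → ∑Fin (χ x) ≡ s) → (∀ x a → χ x a * p x a ≡ p x a) →
      (∀ a → u * q a ≤ v * (n * m)) →
      u * s ^ suc (suc j) * Z ≤ v * fallingℤ s (suc (suc j)) * (β - N) * E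
    boxed-coordinate s u v 0≤u 0≤v 0≤s large χ 0≤χ ∑χ≡s support q≤ = ≤-by-difference
      (0≤+ (0≤* 0≤sN (ℤ.i≤j⇒0≤j-i uZ≤)) (0≤* (0≤* (0≤* 0≤v 0≤nm) N≤b) (ℤ.i≤j⇒0≤j-i T≤)))
      (arrange (s ^ suc (suc j)) v n m (β - N) T u Z (fallingℤ s (suc (suc j))) M)
      where
      0≤sN = 0≤^ (suc (suc j)) 0≤s
      0≤nm = 0≤* {n} (+≤+ ℕ.z≤n) (ℤ.<⇒≤ 0<m)
      arrange : ∀ S v n m e T u Z F M →
        S * (v * (n * m) * (e * T) - u * Z) + v * (n * m) * e * (n * (F * M) - S * T) ≡ v * F * e * (n * n * (m * M)) - u * S * Z
      arrange = solve-∀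
      T≤ : s ^ suc (suc j) * T ≤ n * (fallingℤ s (suc (suc j)) * M)
      T≤ = subst₂ _≤_ (∑-*ˡ xs (s ^ suc (suc j)) (λ x → H (suc (suc j)) (p x))) (∑-const xs _)
        (∑-mono xs (λ x → subst₂ (λ c k → c ^ suc (suc j) * H (suc (suc j)) (p x) ≤ fallingℤ c (suc (suc j)) * k ^ suc (suc j)) (∑χ≡s x) (∑p≡m x)
          (H-support-≤ (suc (suc j)) (χ x) (p x) (0≤χ x) (0≤p x) (support x) (subst (0ℤ ≤_) (sym (∑χ≡s x)) 0≤s)
            (λ i i< → subst (λ c → 0ℤ ≤ c - + i) (sym (∑χ≡s x)) (large i i<)))))
      h : X → Fin b → ℤ
      h x a = H (suc (suc j)) (del a (p x))
      0≤h : ∀ x a → 0ℤ ≤ h x a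
      0≤h x a = 0≤H (suc (suc j)) (0≤del a (0≤p x))
      -- Each tuple of N distinct symbols avoids exactly b - N symbols.
      ∑h : ∀ x → ∑Fin (h x) ≡ (β - N) * H (suc (suc j)) (p x)
      ∑h x = begin
        ∑Fin (h x)                     ≡⟨ ∑-cong (allFin b) (λ a → ℤ.*-identityˡ (h x a)) ⟨
        ∑Fin (λ a → 1ℤ * h x a)        ≡⟨ ∑-H-del (suc j) (p x) (λ _ → 1ℤ) ⟩
        ∑ (allFin b) (λ _ → 1ℤ) * Hx - N * ∑Fin (λ a → 1ℤ * V (suc j) (p x) a)
          ≡⟨ cong₂ (λ c d → c * Hx - N * d) (trans (∑-1 (allFin b)) (cong +_ (length-allFin b)))
               (∑-cong (allFin b) (λ a → ℤ.*-identityˡ (V (suc j) (p x) a))) ⟩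
        β * Hx - N * Hx                ≡⟨ factor β N Hx ⟩
        (β - N) * Hx                   ∎
        where
        open ≡-Reasoning
        Hx = H (suc (suc j)) (p x)
        factor : ∀ x y z → x * z - y * z ≡ (x - y) * z
        factor = solve-∀
      uZ≤ : u * Z ≤ v * (n * m) * ((β - N) * T)
      uZ≤ = begin
        u * Z
          ≡⟨ ∑-*ˡ xs u (λ x → ∑Fin (λ a → q a * h x a)) ⟨
        ∑ xs (λ x → u * ∑Fin (λ a → q a * h x a))
          ≡⟨ ∑-cong xs (λ x → trans (sym (∑-*ˡ (allFin b) u (λ a → q a * h x a)))
               (∑-cong (allFin b) (λ a → sym (ℤ.*-assoc u (q a) (h x a))))) ⟩
        ∑ xs (λ x → ∑Fin (λ a → u * q a * h x a))
          ≤⟨ ∑-mono xs (λ x → ∑-mono (allFin b) (λ a → ℤ.*-monoʳ-≤-nonNeg (h x a) {{nonNegative (0≤h x a)}} (q≤ a))) ⟩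
        ∑ xs (λ x → ∑Fin (λ a → v * (n * m) * h x a))
          ≡⟨ ∑-cong xs (λ x → trans (∑-*ˡ (allFin b) (v * (n * m)) (h x)) (cong (v * (n * m) *_) (∑h x))) ⟩
        ∑ xs (λ x → v * (n * m) * ((β - N) * H (suc (suc j)) (p x)))
          ≡⟨ trans (∑-*ˡ xs (v * (n * m)) (λ x → (β - N) * H (suc (suc j)) (p x)))
               (cong (v * (n * m) *_) (∑-*ˡ xs (β - N) (λ x → H (suc (suc j)) (p x)))) ⟩
        v * (n * m) * ((β - N) * T) ∎
        where open ℤ.≤-Reasoning

module Codes where

  open import Data.Nat.Base using (_+_; _*_; _∸_; _^_; _≤_; _<_)
  open import Data.Nat.Properties using (≤-refl; ≤-trans; ≤-reflexive; module ≤-Reasoning)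
  open ℕ-Solver using (solve-∀)
  open Sum ℕ.+-*-isCommutativeSemiring

  private
    variable
      ℓ : Level
      A : Set ℓ

  ∑-mono : (xs : List A) {f g : A → ℕ} → (∀ x → f x ≤ g x) → ∑ xs f ≤ ∑ xs g
  ∑-mono []       f≤g = ≤-refl
  ∑-mono (x ∷ xs) f≤g = ℕ.+-mono-≤ (f≤g x) (∑-mono xs f≤g)

  ⟦_⟧ : {P : Set} → Dec P → ℕ
  ⟦ yes _ ⟧ = 1
  ⟦ no  _ ⟧ = 0

  ∑-filter : {P : A → Set} (P? : ∀ x → Dec (P x)) (xs : List A) (f : A → ℕ) →
             ∑ (filter P? xs) f ≡ ∑ xs (λ x → ⟦ P? x ⟧ * f x)
  ∑-filter P? []       f = refl
  ∑-filter P? (x ∷ xs) f with P? x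
  ... | yes _ = cong₂ _+_ (sym (ℕ.+-identityʳ (f x))) (∑-filter P? xs f)
  ... | no  _ = ∑-filter P? xs f

  filter-AllPairs : {P : A → Set} (P? : ∀ x → Dec (P x)) {R S : A → A → Set} →
                    (∀ {x y} → P x → P y → R x y → S x y) →
                    {xs : List A} → AllPairs R xs → AllPairs S (filter P? xs)
  filter-AllPairs P? imp {[]}     []           = []
  filter-AllPairs {P = P} P? {R} {S} imp {x ∷ xs} (rs ∷ rss) with P? x
  ... | yes px = related rs ∷ filter-AllPairs P? imp rss
    where
    related : ∀ {ys} → All (R x) ys → All (S x) (filter P? ys)
    related {[]}     []       = []
    related {y ∷ ys} (r ∷ rs) with P? y
    ... | yes py = imp px py r ∷ related rs
    ... | no  _  = related rs
  ... | no  _  = filter-AllPairs P? imp rss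

  -- Hansel's lemma for complete multipartite graphs

  module Hansel (b r : ℕ) where

    Activity : ℕ → Set
    Activity n = Fin n → Fin b → ℕ

    -- Coordinate i is the complete r-partite graph on its active symbols, or empty.
    Proper : ∀ {n} → Activity n → Set
    Proper act = ∀ i → (∀ c → act i c ≡ 0 ⊎ act i c ≡ 1) × (∑Fin (act i) ≡ 0 ⊎ ∑Fin (act i) ≡ r)

    Separated : ∀ {n} → Activity n → (v v′ : Fin n → Fin b) → Set
    Separated act v v′ = ∃[ i ] (act i (v i) ≡ 1 × act i (v′ i) ≡ 1 × v i ≢ v′ i)

    -- The number of classes whose choice lets a word survive: all `r` if its symbol is inactive,
    -- only its own otherwise.
    cost : ℕ → ℕ
    cost zero    = r
    cost (suc _) = 1

    weight : ∀ {n} → Activity n → (Fin n → Fin b) → ℕ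
    weight {zero}  act v = 1
    weight {suc n} act v = cost (act zero (v zero)) * weight (act ∘ suc) (v ∘ suc)

    degree : ∀ {n} → Activity n → (Fin n → Fin b) → ℕ
    degree act v = ∑Fin (λ i → act i (v i))

    weight-degree : ∀ {n} (act : Activity n) → Proper act → ∀ v → weight act v * r ^ degree act v ≡ r ^ n
    weight-degree {zero}  act proper v = refl
    weight-degree {suc n} act proper v =
      trans (cong (λ d → cost (act zero (v zero)) * W * r ^ d) (∑Fin-suc (λ i → act i (v i))))
            (head-cost (act zero (v zero)) (proj₁ (proper zero) (v zero)))
      where
      W = weight (act ∘ suc) (v ∘ suc)
      D = degree (act ∘ suc) (v ∘ suc)
      rest : W * r ^ D ≡ r ^ n
      rest = weight-degree (act ∘ suc) (proper ∘ suc) (v ∘ suc)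
      head-cost : ∀ x → x ≡ 0 ⊎ x ≡ 1 → cost x * W * r ^ (x + D) ≡ r * r ^ n
      head-cost .0 (inj₁ refl) = trans (ℕ.*-assoc r W (r ^ D)) (cong (r *_) rest)
      head-cost .1 (inj₂ refl) = trans (arrange W r (r ^ D)) (cong (r *_) rest)
        where
        arrange : ∀ w r d → 1 * w * (r * d) ≡ r * (w * d)
        arrange = solve-∀

    ∑≡0⇒≡0 : ∀ {n} (f : Fin n → ℕ) → ∑Fin f ≡ 0 → ∀ c → f c ≡ 0
    ∑≡0⇒≡0 f ∑≡0 c = ℕ.n≤0⇒n≡0 (subst (f c ≤_) ∑≡0
      (subst (f c ≤_) (∑Fin-off c f) (ℕ.m≤n+m (f c) (∑Fin (λ a → off c a * f a)))))

    -- Induction on the coordinates. For each of the `r` active symbols c of the first one, keep the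
    -- words that are inactive there or carry c. Two kept words must be separated later on, and a
    -- word is kept by as many c as its `cost`. If no symbol is active, every word costs `r` and
    -- nothing has to be dropped.
    hansel : ∀ {n} (act : Activity n) → Proper act → (V : List A) (v : A → Fin n → Fin b) →
             AllPairs (λ x y → Separated act (v x) (v y)) V → ∑ V (λ x → weight act (v x)) ≤ r ^ n
    hansel {n = zero} act proper []          v sep                       = z≤n
    hansel {n = zero} act proper (x ∷ [])    v sep                       = ≤-refl
    hansel {n = zero} act proper (x ∷ y ∷ V) v (((() , _) ∷ _) ∷ _)
    hansel {n = suc n} act proper V v sep with proj₂ (proper zero)
    ... | inj₁ ∑≡0 = begin
      ∑ V (λ x → cost (act zero (v x zero)) * W x)  ≡⟨ ∑-cong V (λ x → cong (λ t → cost t * W x) (inactive (v x zero))) ⟩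
      ∑ V (λ x → r * W x)                           ≡⟨ ∑-*ˡ V r W ⟩
      r * ∑ V W                                     ≤⟨ ℕ.*-monoʳ-≤ r (hansel (act ∘ suc) (proper ∘ suc) V (λ x → v x ∘ suc) (AllPairs.map tail-separated sep)) ⟩
      r * r ^ n                                     ∎
      where
      open ≤-Reasoning
      W : _ → ℕ
      W x = weight (act ∘ suc) (v x ∘ suc)
      inactive : ∀ c → act zero c ≡ 0
      inactive = ∑≡0⇒≡0 (act zero) ∑≡0
      tail-separated : ∀ {x y} → Separated act (v x) (v y) → Separated (act ∘ suc) (v x ∘ suc) (v y ∘ suc)
      tail-separated (zero  , act≡1 , _) with () ← trans (sym (inactive _)) act≡1
      tail-separated (suc i , s) = i , s
    ... | inj₂ ∑≡r = begin
      ∑ V (λ x → cost (act zero (v x zero)) * W x)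
        ≡⟨ ∑-cong V (λ x → cong (_* W x) (cost-eq x)) ⟩
      ∑ V (λ x → ∑Fin (λ c → act zero c * ⟦ keep? c x ⟧) * W x)
        ≡⟨ ∑-cong V (λ x → ∑-*ʳ (allFin b) (W x) (λ c → act zero c * ⟦ keep? c x ⟧)) ⟨
      ∑ V (λ x → ∑Fin (λ c → act zero c * ⟦ keep? c x ⟧ * W x))
        ≡⟨ ∑-swap V (allFin b) (λ x c → act zero c * ⟦ keep? c x ⟧ * W x) ⟩
      ∑Fin (λ c → ∑ V (λ x → act zero c * ⟦ keep? c x ⟧ * W x))
        ≡⟨ ∑-cong (allFin b) (λ c → trans (∑-cong V (λ x → ℕ.*-assoc (act zero c) ⟦ keep? c x ⟧ (W x)))
             (trans (∑-*ˡ V (act zero c) (λ x → ⟦ keep? c x ⟧ * W x)) (cong (act zero c *_) (sym (∑-filter (keep? c) V W))))) ⟩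
      ∑Fin (λ c → act zero c * ∑ (filter (keep? c) V) W)
        ≤⟨ ∑-mono (allFin b) (λ c → ℕ.*-monoʳ-≤ (act zero c)
             (hansel (act ∘ suc) (proper ∘ suc) (filter (keep? c) V) (λ x → v x ∘ suc)
               (filter-AllPairs (keep? c) (tail-separated c) sep))) ⟩
      ∑Fin (λ c → act zero c * r ^ n)
        ≡⟨ ∑-*ʳ (allFin b) (r ^ n) (act zero) ⟩
      ∑Fin (act zero) * r ^ n
        ≡⟨ cong (_* r ^ n) ∑≡r ⟩
      r * r ^ n ∎
      where
      open ≤-Reasoning
      W : _ → ℕ
      W x = weight (act ∘ suc) (v x ∘ suc)
      Keep : Fin b → _ → Set
      Keep c x = act zero (v x zero) ≡ 0 ⊎ v x zero ≡ c
      keep? : ∀ c x → Dec (Keep c x)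
      keep? c x = (act zero (v x zero) ℕ.≟ 0) ⊎-dec (v x zero ≟ c)
      tail-separated : ∀ c {x y} → Keep c x → Keep c y → Separated act (v x) (v y) →
                       Separated (act ∘ suc) (v x ∘ suc) (v y ∘ suc)
      tail-separated c (inj₁ act≡0) _            (zero , act≡1 , _) with () ← trans (sym act≡0) act≡1
      tail-separated c (inj₂ _)     (inj₁ act≡0) (zero , _ , act≡1 , _) with () ← trans (sym act≡0) act≡1
      tail-separated c (inj₂ x≡c)   (inj₂ y≡c)   (zero , _ , _ , x≢y) = ⊥-elim (x≢y (trans x≡c (sym y≡c)))
      tail-separated c _            _            (suc i , s) = i , s
      keep-inactive : ∀ {x} c → act zero (v x zero) ≡ 0 → ⟦ keep? c x ⟧ ≡ 1
      keep-inactive {x} c act≡0 with keep? c x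
      ... | yes _   = refl
      ... | no drop = ⊥-elim (drop (inj₁ act≡0))
      keep-active : ∀ {x} c → act zero (v x zero) ≡ 1 → ⟦ keep? c x ⟧ ≡ on (v x zero) c
      keep-active {x} c act≡1 with keep? c x
      ... | yes (inj₁ act≡0) with () ← trans (sym act≡0) act≡1
      ... | yes (inj₂ refl)  = sym (on-refl (v x zero))
      ... | no drop          = sym (on-≢ (drop ∘ inj₂))
      cost-eq : ∀ x → cost (act zero (v x zero)) ≡ ∑Fin (λ c → act zero c * ⟦ keep? c x ⟧)
      cost-eq x with proj₁ (proper zero) (v x zero)
      ... | inj₁ act≡0 = trans (cong cost act≡0) (sym (trans
        (∑-cong (allFin b) (λ c → trans (cong (act zero c *_) (keep-inactive {x} c act≡0)) (ℕ.*-identityʳ _))) ∑≡r))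
      ... | inj₂ act≡1 = trans (cong cost act≡1) (sym (trans
        (∑-cong (allFin b) (λ c → trans (cong (act zero c *_) (keep-active {x} c act≡1)) (ℕ.*-comm (act zero c) _)))
        (trans (∑Fin-on (v x zero) (act zero)) act≡1)))

  -- Arithmetic and geometric means in natural numbers

  ^-distribʳ-* : ∀ n x y → (x * y) ^ n ≡ x ^ n * y ^ n
  ^-distribʳ-* zero    x y = refl
  ^-distribʳ-* (suc n) x y = trans (cong (x * y *_) (^-distribʳ-* n x y)) (arrange x y (x ^ n) (y ^ n))
    where
    arrange : ∀ x y a b → x * y * (a * b) ≡ x * a * (y * b)
    arrange = solve-∀

  ^-^-comm : ∀ x k l → (x ^ k) ^ l ≡ (x ^ l) ^ k
  ^-^-comm x k l = trans (ℕ.^-*-assoc x k l) (trans (cong (x ^_) (ℕ.*-comm k l)) (sym (ℕ.^-*-assoc x l k)))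

  ^-cancelˡ-≤ : ∀ k {x y} → 0 < k → x ^ k ≤ y ^ k → x ≤ y
  ^-cancelˡ-≤ k 0<k x^k≤y^k = ℕ.≮⇒≥ (λ y<x → ℕ.<⇒≱ (ℕ.^-monoˡ-< k {{>-nonZero 0<k}} y<x) x^k≤y^k)

  2xy≤x²+y² : ∀ x y → 2 * (x * y) ≤ x * x + y * y
  2xy≤x²+y² x y with ℕ.≤-total x y
  ... | inj₁ x≤y = subst (λ y → 2 * (x * y) ≤ x * x + y * y) (ℕ.m+[n∸m]≡n x≤y)
        (≤-trans (ℕ.m≤m+n _ _) (≤-reflexive (expand x (y ∸ x))))
    where
    expand : ∀ x d → 2 * (x * (x + d)) + d * d ≡ x * x + (x + d) * (x + d)
    expand = solve-∀
  ... | inj₂ y≤x = subst (λ x → 2 * (x * y) ≤ x * x + y * y) (ℕ.m+[n∸m]≡n y≤x)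
        (≤-trans (ℕ.m≤m+n _ _) (≤-reflexive (expand y (x ∸ y))))
    where
    expand : ∀ y d → 2 * ((y + d) * y) + d * d ≡ (y + d) * (y + d) + y * y
    expand = solve-∀

  -- Bernoulli's inequality made homogeneous. The induction multiplies the previous case by `x` and
  -- uses 2xy ≤ x² + y²; a common summand is carried on both sides to avoid subtraction.
  bernoulli : ∀ n x y → suc n * (x * y ^ n) ≤ x ^ suc n + n * y ^ suc n
  bernoulli zero    x y = ≤-reflexive (arrange x)
    where
    arrange : ∀ x → 1 * (x * 1) ≡ x * 1 + 0
    arrange = solve-∀
  bernoulli (suc n) x y = ℕ.+-cancelʳ-≤ (x * (n * (y * Y)) + suc n * (2 * (x * y)) * Y) _ _ (begin
    (2 + n) * (x * (y * Y)) + (x * (n * (y * Y)) + suc n * (2 * (x * y)) * Y)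
      ≤⟨ ℕ.+-monoʳ-≤ ((2 + n) * (x * (y * Y))) (ℕ.+-monoʳ-≤ (x * (n * (y * Y))) (ℕ.*-monoˡ-≤ Y (ℕ.*-monoʳ-≤ (suc n) (2xy≤x²+y² x y)))) ⟩
    (2 + n) * (x * (y * Y)) + (x * (n * (y * Y)) + suc n * (x * x + y * y) * Y)
      ≡⟨ arrange n x y Y ⟩
    x * (suc n * (x * Y)) + (suc n * (y * (y * Y)) + suc n * (2 * (x * y)) * Y)
      ≤⟨ ℕ.+-monoˡ-≤ (suc n * (y * (y * Y)) + suc n * (2 * (x * y)) * Y) (ℕ.*-monoʳ-≤ x (bernoulli n x y)) ⟩
    x * (X + n * (y * Y)) + (suc n * (y * (y * Y)) + suc n * (2 * (x * y)) * Y)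
      ≡⟨ finish n x y X Y ⟩
    x * X + suc n * (y * (y * Y)) + (x * (n * (y * Y)) + suc n * (2 * (x * y)) * Y) ∎)
    where
    open ≤-Reasoning
    X = x ^ suc n
    Y = y ^ n
    arrange : ∀ n x y Y → (2 + n) * (x * (y * Y)) + (x * (n * (y * Y)) + suc n * (x * x + y * y) * Y) ≡
              x * (suc n * (x * Y)) + (suc n * (y * (y * Y)) + suc n * (2 * (x * y)) * Y)
    arrange = solve-∀
    finish : ∀ n x y X Y → x * (X + n * (y * Y)) + (suc n * (y * (y * Y)) + suc n * (2 * (x * y)) * Y) ≡
             x * X + suc n * (y * (y * Y)) + (x * (n * (y * Y)) + suc n * (2 * (x * y)) * Y)
    finish = solve-∀

  -- Bernoulli at x = n(S + a), y = (n + 1)S, divided by n.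
  amgm-step : ∀ n S a → suc n ^ suc n * (S ^ n * a) ≤ n ^ n * (S + a) ^ suc n
  amgm-step zero      S a = ≤-trans (≤-reflexive (arrange a)) (≤-trans (ℕ.m≤n+m a S) (≤-reflexive (sym (arrange′ (S + a)))))
    where
    arrange : ∀ a → 1 * 1 * (1 * a) ≡ a
    arrange = solve-∀
    arrange′ : ∀ x → 1 * (x * 1) ≡ x
    arrange′ = solve-∀
  amgm-step n@(suc _) S a = ℕ.*-cancelˡ-≤ n (ℕ.+-cancelʳ-≤ (n * ((suc n * S) * (suc n * S) ^ n)) _ _ (begin
    n * (suc n * C * (S ^ n * a)) + n * ((suc n * S) * (suc n * S) ^ n)
      ≡⟨ cong (λ t → n * (suc n * C * (S ^ n * a)) + n * ((suc n * S) * t)) (^-distribʳ-* n (suc n) S) ⟩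
    n * (suc n * C * (S ^ n * a)) + n * ((suc n * S) * (C * S ^ n))
      ≡⟨ arrange n C (S ^ n) a S ⟩
    suc n * ((n * (S + a)) * (C * S ^ n))
      ≡⟨ cong (λ t → suc n * ((n * (S + a)) * t)) (^-distribʳ-* n (suc n) S) ⟨
    suc n * ((n * (S + a)) * (suc n * S) ^ n)
      ≤⟨ bernoulli n (n * (S + a)) (suc n * S) ⟩
    (n * (S + a)) ^ suc n + n * (suc n * S) ^ suc n
      ≡⟨ cong (_+ n * (suc n * S) ^ suc n) (trans (^-distribʳ-* (suc n) n (S + a)) (ℕ.*-assoc n (n ^ n) _)) ⟩
    n * (n ^ n * (S + a) ^ suc n) + n * ((suc n * S) * (suc n * S) ^ n) ∎))
    where
    open ≤-Reasoning
    C = suc n ^ n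
    arrange : ∀ n C P a S → n * (suc n * C * (P * a)) + n * ((suc n * S) * (C * P)) ≡ suc n * ((n * (S + a)) * (C * P))
    arrange = solve-∀

  ∏ : List A → (A → ℕ) → ℕ
  ∏ []       f = 1
  ∏ (x ∷ xs) f = f x * ∏ xs f

  amgm : (xs : List A) (f : A → ℕ) → length xs ^ length xs * ∏ xs f ≤ ∑ xs f ^ length xs
  amgm []       f = ≤-refl
  amgm (x ∷ xs) f with length xs in eq
  ... | zero  = go xs eq
    where
    go : ∀ xs → length xs ≡ 0 → 1 * 1 * (f x * ∏ xs f) ≤ (f x + ∑ xs f) ^ 1
    go [] refl = ≤-reflexive (arrange (f x))
      where
      arrange : ∀ y → 1 * 1 * (y * 1) ≡ (y + 0) * 1
      arrange = solve-∀
  ... | n@(suc _) = ℕ.*-cancelˡ-≤ (n ^ n) {{ℕ.m^n≢0 n n}} (begin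
    n ^ n * (suc n ^ suc n * (f x * P))  ≡⟨ arrange (n ^ n) (suc n ^ suc n) (f x) P ⟩
    suc n ^ suc n * (n ^ n * P * f x)    ≤⟨ ℕ.*-monoʳ-≤ (suc n ^ suc n) (ℕ.*-monoˡ-≤ (f x) ih) ⟩
    suc n ^ suc n * (S ^ n * f x)        ≤⟨ amgm-step n S (f x) ⟩
    n ^ n * (S + f x) ^ suc n            ≡⟨ cong (λ t → n ^ n * t ^ suc n) (ℕ.+-comm S (f x)) ⟩
    n ^ n * (f x + S) ^ suc n            ∎)
    where
    open ≤-Reasoning
    S = ∑ xs f
    P = ∏ xs f
    ih : n ^ n * P ≤ S ^ n
    ih = subst (λ k → k ^ k * P ≤ S ^ k) eq (amgm xs f)
    arrange : ∀ c d y P → c * (d * (y * P)) ≡ d * (c * P * y)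
    arrange = solve-∀

  ∏-pow : (r : ℕ) (xs : List A) (f g : A → ℕ) (c : ℕ) → (∀ x → f x * r ^ g x ≡ c) →
          ∏ xs f * r ^ ∑ xs g ≡ c ^ length xs
  ∏-pow r []       f g c eq = refl
  ∏-pow r (x ∷ xs) f g c eq = begin
    f x * ∏ xs f * r ^ (g x + ∑ xs g)        ≡⟨ cong (f x * ∏ xs f *_) (ℕ.^-distribˡ-+-* r (g x) (∑ xs g)) ⟩
    f x * ∏ xs f * (r ^ g x * r ^ ∑ xs g)    ≡⟨ arrange (f x) (∏ xs f) (r ^ g x) (r ^ ∑ xs g) ⟩
    f x * r ^ g x * (∏ xs f * r ^ ∑ xs g)    ≡⟨ cong₂ _*_ (eq x) (∏-pow r xs f g c eq) ⟩
    c * c ^ length xs                        ∎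
    where
    open ≡-Reasoning
    arrange : ∀ a b c d → a * b * (c * d) ≡ a * c * (b * d)
    arrange = solve-∀

  -- As `f x` is r^(n - g x), the product of `f` is determined by the sum of `g`, and the mean
  -- inequality compares it with the sum of `f`. In logarithms: log (|xs|/K) is at most log r times
  -- the mean of `g`.
  jensen : (r : ℕ) .{{_ : NonZero r}} (xs : List A) (f g : A → ℕ) (n K : ℕ) → (∀ x → f x * r ^ g x ≡ r ^ n) →
           ∑ xs f ≤ K * r ^ n → length xs ^ length xs ≤ K ^ length xs * r ^ ∑ xs g
  jensen r xs f g n K eq ∑≤ = ℕ.*-cancelʳ-≤ (M ^ M) (K ^ M * r ^ ∑ xs g) (∏ xs f) {{∏≢0 xs}} (begin
    M ^ M * ∏ xs f                     ≤⟨ amgm xs f ⟩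
    ∑ xs f ^ M                         ≤⟨ ℕ.^-monoˡ-≤ M ∑≤ ⟩
    (K * r ^ n) ^ M                    ≡⟨ ^-distribʳ-* M K (r ^ n) ⟩
    K ^ M * (r ^ n) ^ M                ≡⟨ cong (K ^ M *_) (∏-pow r xs f g (r ^ n) eq) ⟨
    K ^ M * (∏ xs f * r ^ ∑ xs g)      ≡⟨ arrange (K ^ M) (∏ xs f) (r ^ ∑ xs g) ⟩
    K ^ M * r ^ ∑ xs g * ∏ xs f        ∎)
    where
    open ≤-Reasoning
    M = length xs
    arrange : ∀ a b c → a * (b * c) ≡ a * c * b
    arrange = solve-∀
    ∏≢0 : ∀ ys → NonZero (∏ ys f)
    ∏≢0 []       = _
    ∏≢0 (y ∷ ys) = ℕ.m*n≢0 (f y) (∏ ys f) {{ℕ.m*n≢0⇒m≢0 (f y) {{subst NonZero (sym (eq y)) (ℕ.m^n≢0 r n)}}}} {{∏≢0 ys}}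

  ^-product-≤ : (r X Y : ℕ) (ts : List A) (f : A → ℕ) → All (λ t → X ≤ Y * r ^ f t) ts →
                X ^ length ts ≤ Y ^ length ts * r ^ ∑ ts f
  ^-product-≤ r X Y []       f []       = ≤-refl
  ^-product-≤ r X Y (t ∷ ts) f (h ∷ hs) = begin
    X * X ^ length ts                                     ≤⟨ ℕ.*-mono-≤ h (^-product-≤ r X Y ts f hs) ⟩
    Y * r ^ f t * (Y ^ length ts * r ^ ∑ ts f)            ≡⟨ arrange Y (r ^ f t) (Y ^ length ts) (r ^ ∑ ts f) ⟩
    Y * Y ^ length ts * (r ^ f t * r ^ ∑ ts f)            ≡⟨ cong (Y * Y ^ length ts *_) (ℕ.^-distribˡ-+-* r (f t) (∑ ts f)) ⟨
    Y * Y ^ length ts * r ^ (f t + ∑ ts f)                ∎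
    where
    open ≤-Reasoning
    arrange : ∀ a b c d → a * b * (c * d) ≡ a * c * (b * d)
    arrange = solve-∀

  ∑-1 : (xs : List A) → ∑ xs (λ _ → 1) ≡ length xs
  ∑-1 []       = refl
  ∑-1 (x ∷ xs) = cong suc (∑-1 xs)

  -- Partition of a code into boxed groups

  record Popular {b : ℕ} (s : ℕ) (f : Fin b → ℕ) : Set where
    constructor popular
    field
      χ      : Fin b → ℕ
      binary : ∀ a → χ a ≡ 0 ⊎ χ a ≡ 1
      total  : ∑Fin χ ≡ s
      heavy  : s * ∑Fin f ≤ b * ∑Fin (λ a → χ a * f a)

  -- A greedy scan replaces sorting: a symbol at least as heavy as the average of the later ones is
  -- taken, any other is left out, and in both cases the recursive choice keeps its share.
  choose : ∀ b s (f : Fin b → ℕ) → s ≤ b → Popular s f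
  choose zero    .zero   f z≤n = popular (λ ()) (λ ()) refl z≤n
  choose (suc b) zero    f _   = popular (λ _ → 0) (λ _ → inj₁ refl) (∑-0 (allFin (suc b)) (λ _ → refl)) z≤n
  -- The factor `b ∸ s` makes the test succeed when s = b, where every remaining symbol has to be
  -- taken.
  choose (suc b) (suc s) f (s≤s s≤b) with (b ∸ s) * ∑Fin (f ∘ suc) ℕ.≤? (b ∸ s) * (b * f zero)
  ... | yes light = popular (1 ◂ χ) binary′ (trans (∑Fin-suc (1 ◂ χ)) (cong suc total))
      (subst₂ (λ u v → suc s * u ≤ suc b * v) (sym (∑Fin-suc f))
        (sym (trans (∑Fin-suc (λ a → (1 ◂ χ) a * f a)) (cong (_+ y) (ℕ.*-identityˡ (f zero)))))
        (include b s s≤b (f zero) (∑Fin (f ∘ suc)) y heavy light (λ { refl → refl })))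
    where
    open Popular (choose b s (f ∘ suc) s≤b)
    y = ∑Fin (λ a → χ a * f (suc a))
    binary′ : ∀ a → (1 ◂ χ) a ≡ 0 ⊎ (1 ◂ χ) a ≡ 1
    binary′ zero    = inj₂ refl
    binary′ (suc a) = binary a
    include : ∀ b s → s ≤ b → ∀ x F y → s * F ≤ b * y → (b ∸ s) * F ≤ (b ∸ s) * (b * x) → (b ≡ 0 → F ≡ 0) →
              suc s * (x + F) ≤ suc b * (x + y)
    include zero    zero _   x F y h₁ h₂ F≡0 = ≤-trans (≤-reflexive (cong (λ t → 1 * (x + t)) (F≡0 refl))) (ℕ.*-monoʳ-≤ 1 (ℕ.+-monoʳ-≤ x z≤n))
    include (suc b) s    s≤b x F y h₁ h₂ _   = ℕ.*-cancelˡ-≤ (suc b) (begin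
      suc b * (suc s * (x + F))                              ≡⟨ cong (λ t → t * (suc s * (x + F))) b≡ ⟨
      (s + e) * (suc s * (x + F))                            ≡⟨ expand s e x F ⟩
      (s + e) * (suc s * x) + suc (s + e) * (s * F) + e * F  ≤⟨ ℕ.+-monoʳ-≤ ((s + e) * (suc s * x) + suc (s + e) * (s * F)) h₂ ⟩
      (s + e) * (suc s * x) + suc (s + e) * (s * F) + e * (suc b * x)
        ≡⟨ cong (λ t → (s + e) * (suc s * x) + suc (s + e) * (s * F) + e * (t * x)) b≡ ⟨
      (s + e) * (suc s * x) + suc (s + e) * (s * F) + e * ((s + e) * x)
        ≤⟨ ℕ.+-monoˡ-≤ (e * ((s + e) * x)) (ℕ.+-monoʳ-≤ ((s + e) * (suc s * x)) (ℕ.*-monoʳ-≤ (suc (s + e)) h₁)) ⟩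
      (s + e) * (suc s * x) + suc (s + e) * (suc b * y) + e * ((s + e) * x)
        ≡⟨ cong (λ t → (s + e) * (suc s * x) + suc (s + e) * (t * y) + e * ((s + e) * x)) b≡ ⟨
      (s + e) * (suc s * x) + suc (s + e) * ((s + e) * y) + e * ((s + e) * x)
        ≡⟨ collect s e x y ⟩
      (s + e) * (suc (s + e) * (x + y))                      ≡⟨ cong (λ t → t * (suc t * (x + y))) b≡ ⟩
      suc b * (suc (suc b) * (x + y))                        ∎)
      where
      open ≤-Reasoning
      e = suc b ∸ s
      b≡ : s + e ≡ suc b
      b≡ = ℕ.m+[n∸m]≡n s≤b
      expand : ∀ s e x F → (s + e) * (suc s * (x + F)) ≡ (s + e) * (suc s * x) + suc (s + e) * (s * F) + e * F
      expand = solve-∀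
      collect : ∀ s e x y → (s + e) * (suc s * x) + suc (s + e) * ((s + e) * y) + e * ((s + e) * x) ≡ (s + e) * (suc (s + e) * (x + y))
      collect = solve-∀
  ... | no ¬light = popular (0 ◂ χ) binary′ (trans (∑Fin-suc (0 ◂ χ)) total)
      (subst₂ (λ u v → suc s * u ≤ suc b * v) (sym (∑Fin-suc f)) (sym (∑Fin-suc (λ a → (0 ◂ χ) a * f a)))
        (exclude b s (f zero) (∑Fin (f ∘ suc)) y s<b heavy light))
    where
    s<b : s < b
    s<b with ℕ.m≤n⇒m<n∨m≡n s≤b
    ... | inj₁ s<b  = s<b
    ... | inj₂ refl = ⊥-elim (¬light (subst (λ t → t * ∑Fin (f ∘ suc) ≤ t * (b * f zero)) (sym (ℕ.n∸n≡0 s)) z≤n))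
    light : b * f zero ≤ ∑Fin (f ∘ suc)
    light = ℕ.<⇒≤ (ℕ.*-cancelˡ-< (b ∸ s) (b * f zero) (∑Fin (f ∘ suc)) (ℕ.≰⇒> ¬light))
    open Popular (choose b (suc s) (f ∘ suc) s<b)
    y = ∑Fin (λ a → χ a * f (suc a))
    binary′ : ∀ a → (0 ◂ χ) a ≡ 0 ⊎ (0 ◂ χ) a ≡ 1
    binary′ zero    = inj₁ refl
    binary′ (suc a) = binary a
    exclude : ∀ b s x F y → s < b → suc s * F ≤ b * y → b * x ≤ F → suc s * (x + F) ≤ suc b * y
    exclude (suc b) s x F y _ h₁ h₂ = ℕ.*-cancelˡ-≤ (suc b) (begin
      suc b * (suc s * (x + F))                  ≡⟨ expand (suc b) (suc s) x F ⟩
      suc s * (suc b * x) + suc s * (suc b * F)  ≤⟨ ℕ.+-monoˡ-≤ _ (ℕ.*-monoʳ-≤ (suc s) h₂) ⟩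
      suc s * F + suc s * (suc b * F)            ≡⟨ collect (suc s) (suc b) F ⟩
      suc (suc b) * (suc s * F)                  ≤⟨ ℕ.*-monoʳ-≤ (suc (suc b)) h₁ ⟩
      suc (suc b) * (suc b * y)                  ≡⟨ arrange (suc (suc b)) (suc b) y ⟩
      suc b * (suc (suc b) * y)                  ∎)
      where
      open ≤-Reasoning
      expand : ∀ b s x F → b * (s * (x + F)) ≡ s * (b * x) + s * (b * F)
      expand = solve-∀
      collect : ∀ s b F → s * F + s * (b * F) ≡ (1 + b) * (s * F)
      collect = solve-∀
      arrange : ∀ a b y → a * (b * y) ≡ b * (a * y)
      arrange = solve-∀

  filter-split : {P : A → Set} (P? : ∀ x → Dec (P x)) (xs : List A) → xs ↭ filter P? xs ++ filter (¬? ∘ P?) xs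
  filter-split P? []       = ↭-refl
  filter-split P? (x ∷ xs) with P? x
  ... | yes _ = prep x (filter-split P? xs)
  ... | no  _ = ↭-trans (prep x (filter-split P? xs)) (↭-sym (shift x (filter P? xs) _))

  module Words (b n : ℕ) where

    Word : Set
    Word = Vec (Fin b) n

    count : List Word → Fin n → Fin b → ℕ
    count D i a = ∑ D (λ x → on (lookup x i) a)

    ∑-count : ∀ D i (f : Fin b → ℕ) → ∑ D (λ x → f (lookup x i)) ≡ ∑Fin (λ a → count D i a * f a)
    ∑-count D i f = begin
      ∑ D (λ x → f (lookup x i))                             ≡⟨ ∑-cong D (λ x → ∑Fin-on (lookup x i) f) ⟨
      ∑ D (λ x → ∑Fin (λ a → on (lookup x i) a * f a))       ≡⟨ ∑-swap D (allFin b) (λ x a → on (lookup x i) a * f a) ⟩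
      ∑Fin (λ a → ∑ D (λ x → on (lookup x i) a * f a))       ≡⟨ ∑-cong (allFin b) (λ a → ∑-*ʳ D (f a) (λ x → on (lookup x i) a)) ⟩
      ∑Fin (λ a → count D i a * f a)                         ∎
      where open ≡-Reasoning

    ∑-count-1 : ∀ D i → ∑Fin (count D i) ≡ length D
    ∑-count-1 D i = trans (∑-cong (allFin b) (λ a → sym (ℕ.*-identityʳ (count D i a))))
      (trans (sym (∑-count D i (λ _ → 1))) (∑-1 D))

    Box : ℕ → List Word → Fin n → Set
    Box s D i = Σ[ χ ∈ (Fin b → ℕ) ] (∑Fin χ ≡ s × All (λ x → χ (lookup x i) ≡ 1) D)

    length-filter-χ : (χ : Fin b → ℕ) → (∀ a → χ a ≡ 0 ⊎ χ a ≡ 1) → (C : List Word) (i : Fin n) →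
                      length (filter (λ x → χ (lookup x i) ℕ.≟ 1) C) ≡ ∑ C (λ x → χ (lookup x i))
    length-filter-χ χ binary C i = trans (sym (∑-1 (filter (λ x → χ (lookup x i) ℕ.≟ 1) C)))
      (trans (∑-filter (λ x → χ (lookup x i) ℕ.≟ 1) C (λ _ → 1))
             (∑-cong C (λ x → trans (ℕ.*-identityʳ _) (indicator (binary (lookup x i))))))
      where
      indicator : ∀ {k} → k ≡ 0 ⊎ k ≡ 1 → ⟦ k ℕ.≟ 1 ⟧ ≡ k
      indicator (inj₁ refl) = refl
      indicator (inj₂ refl) = refl

    module Grouping (m s : ℕ) (0<m : 0 < m) (s≤b : s ≤ b) .{{_ : NonZero b}} where

      -- Restricting one coordinate to `s` popular symbols keeps a share of at least s/b of the
      -- words, so at least `m` of them survive all of `L`.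
      extract : (L : List (Fin n)) (C : List Word) → m * b ^ length L ≤ length C * s ^ length L →
                ∃[ D ] ∃[ R ] (C ↭ D ++ R × length D ≡ m × All (Box s D) L)
      extract [] C large =
        take m C , drop m C , ↭-reflexive (sym (take++drop≡id m C)) ,
        trans (length-take m C) (ℕ.m≤n⇒m⊓n≡m (subst₂ _≤_ (ℕ.*-identityʳ m) (ℕ.*-identityʳ (length C)) large)) , []
      extract (i ∷ L) C large = D , R ++ N , C↭ , ∣D∣≡m , (χ , total , onD) ∷ boxes
        where
        open Popular (choose b s (count C i) s≤b)
        P? : ∀ x → Dec (χ (lookup x i) ≡ 1)
        P? x = χ (lookup x i) ℕ.≟ 1
        Y = filter P? C
        N = filter (¬? ∘ P?) C
        ∣Y∣ : length Y ≡ ∑Fin (λ a → χ a * count C i a)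
        ∣Y∣ = trans (length-filter-χ χ binary C i) (trans (∑-count C i χ) (∑-cong (allFin b) (λ a → ℕ.*-comm (count C i a) (χ a))))
        Y-large : s * length C ≤ b * length Y
        Y-large = subst₂ (λ u v → s * u ≤ b * v) (∑-count-1 C i) (sym ∣Y∣) heavy
        large′ : m * b ^ length L ≤ length Y * s ^ length L
        large′ = ℕ.*-cancelˡ-≤ b (begin
          b * (m * b ^ length L)           ≡⟨ swap₁ b m (b ^ length L) ⟩
          m * (b * b ^ length L)           ≤⟨ large ⟩
          length C * (s * s ^ length L)    ≡⟨ swap₂ (length C) s (s ^ length L) ⟩
          s * length C * s ^ length L      ≤⟨ ℕ.*-monoˡ-≤ (s ^ length L) Y-large ⟩
          b * length Y * s ^ length L      ≡⟨ ℕ.*-assoc b (length Y) _ ⟩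
          b * (length Y * s ^ length L)    ∎)
          where
          open ≤-Reasoning
          swap₁ : ∀ a b c → a * (b * c) ≡ b * (a * c)
          swap₁ = solve-∀
          swap₂ : ∀ a b c → a * (b * c) ≡ b * a * c
          swap₂ = solve-∀
        rec = extract L Y large′
        D = proj₁ rec
        R = proj₁ (proj₂ rec)
        Y↭ = proj₁ (proj₂ (proj₂ rec))
        ∣D∣≡m = proj₁ (proj₂ (proj₂ (proj₂ rec)))
        boxes = proj₂ (proj₂ (proj₂ (proj₂ rec)))
        C↭ : C ↭ D ++ (R ++ N)
        C↭ = ↭-trans (filter-split P? C) (↭-trans (++⁺ʳ N Y↭) (↭-reflexive (++-assoc D R N)))
        onD : All (λ x → χ (lookup x i) ≡ 1) D
        onD = ++⁻ˡ D (All-resp-↭ Y↭ (all-filter P? C))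

      record Group (L : List (Fin n)) : Set where
        field
          words : List Word
          size  : length words ≡ m
          boxes : All (Box s words) L
      open Group public

      union : ∀ {L} → List (Group L) → List Word
      union Ω = concat (map words Ω)

      -- Groups are split off as long as the pigeonhole argument applies. Each has `m` > 0 words, so
      -- the size of the code bounds the number of rounds.
      partition : (L : List (Fin n)) (fuel : ℕ) (C : List Word) → length C ≤ fuel →
                  ∃[ Ω ] ∃[ W ] (C ↭ union {L} Ω ++ W × length W * s ^ length L < m * b ^ length L)
      partition L fuel C C≤ with m * b ^ length L ℕ.≤? length C * s ^ length L
      ... | no  small = [] , C , ↭-refl , ℕ.≰⇒> small
      partition L fuel C C≤ | yes large with extract L C large
      ... | D , R , C↭ , ∣D∣≡m , boxesD = continue fuel C≤
        where
        ∣C∣≡ : length C ≡ m + length R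
        ∣C∣≡ = trans (↭-length C↭) (trans (length-++ D) (cong (_+ length R) ∣D∣≡m))
        continue : ∀ fuel → length C ≤ fuel →
                   ∃[ Ω ] ∃[ W ] (C ↭ union {L} Ω ++ W × length W * s ^ length L < m * b ^ length L)
        continue zero       C≤0   = ⊥-elim (ℕ.<⇒≱ 0<m (≤-trans (ℕ.m≤m+n m (length R)) (subst (_≤ 0) ∣C∣≡ C≤0)))
        continue (suc fuel) C≤1+f with partition L fuel R
          (ℕ.≤-pred (≤-trans (ℕ.+-monoˡ-≤ (length R) 0<m) (subst (_≤ suc fuel) ∣C∣≡ C≤1+f)))
        ... | Ω , W , R↭ , W<  = record { words = D ; size = ∣D∣≡m ; boxes = boxesD } ∷ Ω , W ,
              ↭-trans C↭ (↭-trans (++⁺ˡ D R↭) (↭-reflexive (sym (++-assoc D (union Ω) W)))) , W<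

  -- Tuples of words and their columns

  ∑-mono-All : {xs : List A} {f g : A → ℕ} → All (λ x → f x ≤ g x) xs → ∑ xs f ≤ ∑ xs g
  ∑-mono-All []       = ≤-refl
  ∑-mono-All (h ∷ hs) = ℕ.+-mono-≤ h (∑-mono-All hs)

  ∑-cong-All : {xs : List A} {f g : A → ℕ} → All (λ x → f x ≡ g x) xs → ∑ xs f ≡ ∑ xs g
  ∑-cong-All []       = refl
  ∑-cong-All (h ∷ hs) = cong₂ _+_ h (∑-cong-All hs)

  ∑-const : (xs : List A) (c : ℕ) → ∑ xs (λ _ → c) ≡ length xs * c
  ∑-const []       c = refl
  ∑-const (x ∷ xs) c = cong (c +_) (∑-const xs c)

  Unique-resp-↭ : {xs ys : List A} → xs ↭ ys → Unique xs → Unique ys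
  Unique-resp-↭ p = Setoid↭.Unique-resp-↭ (setoid _) (↭⇒↭ₛ p)

  picks : List A → List (A × List A)
  picks []       = []
  picks (x ∷ xs) = (x , xs) ∷ map (λ (y , ys) → y , x ∷ ys) (picks xs)

  ∑-picks : (xs : List A) (f : A → ℕ) → ∑ (picks xs) (f ∘ proj₁) ≡ ∑ xs f
  ∑-picks []       f = refl
  ∑-picks (x ∷ xs) f = cong (f x +_) (trans (∑-map _ (picks xs) (f ∘ proj₁)) (∑-picks xs f))

  picks-↭ : (xs : List A) → All (λ (y , ys) → xs ↭ y ∷ ys) (picks xs)
  picks-↭ []       = []
  picks-↭ (x ∷ xs) = ↭-refl ∷ map⁺ (All.map (λ p → ↭-trans (prep x p) (swap x _ ↭-refl)) (picks-↭ xs))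

  -- Tuples of distinct positions; in a list without repetitions these are the tuples of distinct
  -- words.
  tuples : ∀ j → List A → List (Vec A j)
  tuples zero    xs = [] ∷ []
  tuples (suc j) xs = concat (map (λ (y , ys) → map (y ∷_) (tuples j ys)) (picks xs))

  ∑-tuples : ∀ j (xs : List A) (f : Vec A (suc j) → ℕ) →
             ∑ (tuples (suc j) xs) f ≡ ∑ (picks xs) (λ (y , ys) → ∑ (tuples j ys) (f ∘ (y ∷_)))
  ∑-tuples j xs f = trans (∑-concat (map _ (picks xs)) f) (trans (∑-map _ (picks xs) (λ ts → ∑ ts f))
    (∑-cong (picks xs) (λ (y , ys) → ∑-map (y ∷_) (tuples j ys) f)))

  length-tuples : ∀ j (xs : List A) → length (tuples j xs) ≡ falling (length xs) j
  length-tuples zero    xs = refl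
  length-tuples (suc j) xs = begin
    length (tuples (suc j) xs)                                     ≡⟨ ∑-1 (tuples (suc j) xs) ⟨
    ∑ (tuples (suc j) xs) (λ _ → 1)                                ≡⟨ ∑-tuples j xs (λ _ → 1) ⟩
    ∑ (picks xs) (λ (y , ys) → ∑ (tuples j ys) (λ _ → 1))          ≡⟨ ∑-cong (picks xs) (λ (y , ys) → trans (∑-1 (tuples j ys)) (length-tuples j ys)) ⟩
    ∑ (picks xs) (λ (y , ys) → falling (length ys) j)              ≡⟨ ∑-cong-All (All.map (λ p → cong (λ k → falling (k ∸ 1) j) (sym (↭-length p))) (picks-↭ xs)) ⟩
    ∑ (picks xs) (λ _ → falling (length xs ∸ 1) j)                 ≡⟨ ∑-picks xs (λ _ → falling (length xs ∸ 1) j) ⟩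
    ∑ xs (λ _ → falling (length xs ∸ 1) j)                         ≡⟨ ∑-const xs _ ⟩
    length xs * falling (length xs ∸ 1) j                          ∎
    where open ≡-Reasoning

  tuples-↭ : ∀ j (xs : List A) → All (λ t → ∃[ R ] xs ↭ R ++ toList t) (tuples j xs)
  tuples-↭ zero    xs = (xs , ↭-reflexive (sym (++-identityʳ xs))) ∷ []
  tuples-↭ (suc j) xs = concat⁺ (map⁺ (All.map (λ {(y , ys)} p → map⁺ (All.map
    (λ (R , q) → R , ↭-trans p (↭-trans (prep y q) (↭-sym (shift y R _)))) (tuples-↭ j ys))) (picks-↭ xs)))

  module Indicator (b : ℕ) where

    -- ind χ ss is 1 if the symbols ss are pairwise distinct and lie in χ, and 0 otherwise.
    ind : ∀ {j} → (Fin b → ℕ) → Vec (Fin b) j → ℕ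
    ind χ []       = 1
    ind χ (s ∷ ss) = χ s * ind (del s χ) ss

    Binary : (Fin b → ℕ) → Set
    Binary χ = ∀ a → χ a ≡ 0 ⊎ χ a ≡ 1

    ind-cong : ∀ {j} {χ χ′ : Fin b → ℕ} → (∀ a → χ a ≡ χ′ a) → (ss : Vec (Fin b) j) → ind χ ss ≡ ind χ′ ss
    ind-cong eq []       = refl
    ind-cong eq (s ∷ ss) = cong₂ _*_ (eq s) (ind-cong (λ a → cong (off s a *_) (eq a)) ss)

    binary-* : ∀ {x y} → x ≡ 0 ⊎ x ≡ 1 → y ≡ 0 ⊎ y ≡ 1 → x * y ≡ 0 ⊎ x * y ≡ 1
    binary-* (inj₁ refl) _           = inj₁ refl
    binary-* (inj₂ refl) (inj₁ refl) = inj₁ refl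
    binary-* (inj₂ refl) (inj₂ refl) = inj₂ refl

    binary-off : ∀ {n} (s a : Fin n) → off s a ≡ 0 ⊎ off s a ≡ 1
    binary-off zero    zero    = inj₁ refl
    binary-off zero    (suc _) = inj₂ refl
    binary-off (suc _) zero    = inj₂ refl
    binary-off (suc s) (suc a) = binary-off s a

    binary-del : ∀ {χ} → Binary χ → ∀ s → Binary (del s χ)
    binary-del binary s a = binary-* (binary-off s a) (binary a)

    binary-ind : ∀ {j χ} → Binary χ → (ss : Vec (Fin b) j) → ind χ ss ≡ 0 ⊎ ind χ ss ≡ 1
    binary-ind binary []       = inj₂ refl
    binary-ind binary (s ∷ ss) = binary-* (binary s) (binary-ind (binary-del binary s) ss)

    -- If the `j` symbols are distinct and lie in `χ`, exactly ∑χ - j symbols extend them; otherwise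
    -- none does.
    ∑-ind : ∀ {j χ} → Binary χ → (ss : Vec (Fin b) j) →
            ∑Fin (λ c → χ c * ind (del c χ) ss) + j * ind χ ss ≡ ∑Fin χ * ind χ ss
    ∑-ind {χ = χ} binary [] = trans (ℕ.+-identityʳ _) (∑-*ʳ (allFin b) 1 χ)
    ∑-ind {suc j} {χ} binary (s ∷ ss) = begin
      ∑Fin (λ c → χ c * (off c s * χ s * ind (del s (del c χ)) ss)) + suc j * (χ s * I)
        ≡⟨ cong (_+ suc j * (χ s * I)) (trans (∑-cong (allFin b) term) (∑-*ˡ (allFin b) (χ s) (λ c → del s χ c * ind (del c (del s χ)) ss))) ⟩
      χ s * S + suc j * (χ s * I)                  ≡⟨ arrange (χ s) S j I ⟩
      χ s * (S + j * I) + χ s * I                  ≡⟨ cong (λ t → χ s * t + χ s * I) (∑-ind (binary-del binary s) ss) ⟩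
      χ s * (X * I) + χ s * I                      ≡⟨ cong (λ t → χ s * (X * I) + t * I) (idempotent (binary s)) ⟨
      χ s * (X * I) + χ s * χ s * I                ≡⟨ collect (χ s) X I ⟩
      (X + χ s) * (χ s * I)                        ≡⟨ cong (_* (χ s * I)) (∑Fin-off s χ) ⟩
      ∑Fin χ * (χ s * I)                           ∎
      where
      open ≡-Reasoning
      I = ind (del s χ) ss
      S = ∑Fin (λ c → del s χ c * ind (del c (del s χ)) ss)
      X = ∑Fin (del s χ)
      arrange : ∀ x S j I → x * S + (1 + j) * (x * I) ≡ x * (S + j * I) + x * I
      arrange = solve-∀
      collect : ∀ x X I → x * (X * I) + x * x * I ≡ (X + x) * (x * I)
      collect = solve-∀
      idempotent : ∀ {x} → x ≡ 0 ⊎ x ≡ 1 → x * x ≡ x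
      idempotent (inj₁ refl) = refl
      idempotent (inj₂ refl) = refl
      regroup : ∀ x o y i → x * (o * y * i) ≡ y * (o * x * i)
      regroup = solve-∀
      term : ∀ c → χ c * (off c s * χ s * ind (del s (del c χ)) ss) ≡ χ s * (del s χ c * ind (del c (del s χ)) ss)
      term c = trans (cong₂ (λ o i → χ c * (o * χ s * i)) (off-sym c s) (ind-cong (del-comm s c χ) ss))
                     (regroup (χ c) (off s c) (χ s) _)

    ind-injective : ∀ {j χ} (ss : Vec (Fin b) j) → Injective _≡_ _≡_ (lookup ss) → (∀ k → χ (lookup ss k) ≡ 1) → ind χ ss ≡ 1
    ind-injective []       inj χ≡1 = refl
    ind-injective {χ = χ} (s ∷ ss) inj χ≡1 = cong₂ _*_ (χ≡1 zero) (ind-injective ss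
      (λ eq → Fin.suc-injective (inj eq))
      (λ k → cong₂ _*_ (off-≢ {i = s} (λ s≡ → Fin.0≢1+n (inj s≡))) (χ≡1 (suc k))))

    H-mono : ∀ {n} j {p q : Fin n → ℕ} → (∀ a → p a ≤ q a) → H j p ≤ H j q
    H-mono zero    p≤q = ≤-refl
    H-mono (suc j) p≤q = ∑-mono (allFin _) (λ a → ℕ.*-mono-≤ (p≤q a) (H-mono j (λ c → ℕ.*-monoʳ-≤ (off a c) (p≤q c))))

    module _ (n : ℕ) where

      open Words b n

      column : ∀ {j} → Fin n → Vec Word j → Vec (Fin b) j
      column i = Vec.map (λ x → lookup x i)

      -- The first word `y` is no longer available to the later positions, but bounding their counts
      -- by those of the full list `D` is harmless, since the symbol of `y` is deleted from `χ` in
      -- any case.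
      ∑-ind-tuples : ∀ j (i : Fin n) (χ : Fin b → ℕ) (D : List Word) →
                     ∑ (tuples j D) (λ t → ind χ (column i t)) ≤ H j (λ a → χ a * count D i a)
      ∑-ind-tuples zero    i χ D = ≤-refl
      ∑-ind-tuples (suc j) i χ D = begin
        ∑ (tuples (suc j) D) (λ t → ind χ (column i t))
          ≡⟨ ∑-tuples j D (λ t → ind χ (column i t)) ⟩
        ∑ (picks D) (λ (y , ys) → ∑ (tuples j ys) (λ t → χ (lookup y i) * ind (del (lookup y i) χ) (column i t)))
          ≡⟨ ∑-cong (picks D) (λ (y , ys) → ∑-*ˡ (tuples j ys) (χ (lookup y i)) (λ t → ind (del (lookup y i) χ) (column i t))) ⟩
        ∑ (picks D) (λ (y , ys) → χ (lookup y i) * ∑ (tuples j ys) (λ t → ind (del (lookup y i) χ) (column i t)))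
          ≤⟨ ∑-mono-All (All.map (λ {(y , ys)} p → ℕ.*-monoʳ-≤ (χ (lookup y i))
               (≤-trans (∑-ind-tuples j i (del (lookup y i) χ) ys) (H-mono j (λ a → bound y ys p a)))) (picks-↭ D)) ⟩
        ∑ (picks D) (λ (y , ys) → F (lookup y i))
          ≡⟨ ∑-picks D (λ y → F (lookup y i)) ⟩
        ∑ D (λ y → F (lookup y i))
          ≡⟨ ∑-count D i F ⟩
        ∑Fin (λ a → count D i a * (χ a * H j (del a p)))
          ≡⟨ ∑-cong (allFin b) (λ a → regroup (count D i a) (χ a) (H j (del a p))) ⟩
        ∑Fin (λ a → p a * H j (del a p)) ∎
        where
        open ≤-Reasoning
        p : Fin b → ℕ
        p a = χ a * count D i a
        F : Fin b → ℕ
        F a = χ a * H j (del a p)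
        regroup : ∀ c x h → c * (x * h) ≡ x * c * h
        regroup = solve-∀
        bound : ∀ y ys → D ↭ y ∷ ys → ∀ a → del (lookup y i) χ a * count ys i a ≤ del (lookup y i) p a
        bound y ys D↭ a = ≤-trans (ℕ.*-monoʳ-≤ (off (lookup y i) a * χ a)
            (≤-trans (ℕ.m≤n+m (count ys i a) (on (lookup y i) a)) (≤-reflexive (sym (∑-↭ D↭ (λ x → on (lookup x i) a))))))
          (≤-reflexive (ℕ.*-assoc (off (lookup y i) a) (χ a) (count D i a)))

  Unique⇒lookup-injective : ∀ {j} (t : Vec A j) → Unique (toList t) → Injective _≡_ _≡_ (lookup t)
  Unique⇒lookup-injective (x ∷ t) (x≢ ∷ u) {zero}  {zero}  eq = refl
  Unique⇒lookup-injective (x ∷ t) (x≢ ∷ u) {zero}  {suc k} eq = ⊥-elim (All.lookup x≢ (∈-toList⁺ (∈-lookup k t)) eq)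
  Unique⇒lookup-injective (x ∷ t) (x≢ ∷ u) {suc i} {zero}  eq = ⊥-elim (All.lookup x≢ (∈-toList⁺ (∈-lookup i t)) (sym eq))
  Unique⇒lookup-injective (x ∷ t) (x≢ ∷ u) {suc i} {suc k} eq = cong suc (Unique⇒lookup-injective t u eq)

  Unique-++⁻ʳ : (U ts : List A) → Unique (U ++ ts) → Unique ts
  Unique-++⁻ʳ []      ts u       = u
  Unique-++⁻ʳ (x ∷ U) ts (_ ∷ u) = Unique-++⁻ʳ U ts u

  Unique-∷ : (U ts : List A) → Unique (U ++ ts) → All (λ v → Unique (v ∷ ts)) U
  Unique-∷ []      ts u        = []
  Unique-∷ (v ∷ U) ts (v≢ ∷ u) = (++⁻ʳ U v≢ ∷ Unique-++⁻ʳ U ts u) ∷ Unique-∷ U ts u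

  Unique-∷∷ : (U ts : List A) → Unique (U ++ ts) → AllPairs (λ v v′ → Unique (v ∷ v′ ∷ ts)) U
  Unique-∷∷ []      ts u        = []
  Unique-∷∷ (v ∷ U) ts (v≢ ∷ u) =
    All.zipWith (λ (v≢v′ , u′) → (v≢v′ ∷ ++⁻ʳ U v≢) ∷ u′) (++⁻ˡ U v≢ , Unique-∷ U ts u) ∷ Unique-∷∷ U ts u

  -- Hansel's bound for one tuple, and its average over all tuples

  module Code (b N n : ℕ) (N<b : N < b) (C : List (Vec (Fin b) n)) (hash : IsHashCode b (suc (suc N)) n C) where

    r : ℕ
    r = b ∸ N

    instance
      r≢0 : NonZero r
      r≢0 = >-nonZero (ℕ.m<n⇒0<n∸m N<b)

    open Words b n
    open Hansel b r
    open Indicator b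

    activity : Vec Word N → Activity n
    activity t i c = ind (λ _ → 1) (c ∷ column n i t)

    -- If the column of `t` consists of distinct symbols, the other b - N symbols are active; if
    -- not, none is.
    proper : ∀ t → Proper (activity t)
    proper t i = (λ c → binary-ind all (c ∷ column n i t)) , sum (binary-ind all (column n i t))
      where
      all : Binary (λ _ → 1)
      all _ = inj₂ refl
      ss = column n i t
      identity : ∑Fin (activity t i) + N * ind (λ _ → 1) ss ≡ b * ind (λ _ → 1) ss
      identity = trans (∑-ind all ss) (cong (_* ind (λ _ → 1) ss) (trans (∑-1 (allFin b)) (length-allFin b)))
      sum : ind (λ _ → 1) ss ≡ 0 ⊎ ind (λ _ → 1) ss ≡ 1 → ∑Fin (activity t i) ≡ 0 ⊎ ∑Fin (activity t i) ≡ r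
      sum (inj₁ eq) = inj₁ (ℕ.m+n≡0⇒m≡0 (∑Fin (activity t i)) (trans identity (trans (cong (b *_) eq) (ℕ.*-zeroʳ b))))
      sum (inj₂ eq) = inj₂ (trans (sym (ℕ.m+n∸n≡m (∑Fin (activity t i)) N)) (cong (_∸ N)
        (trans (cong (λ k → ∑Fin (activity t i) + k) (sym (ℕ.*-identityʳ N)))
          (trans (subst (λ e → ∑Fin (activity t i) + N * e ≡ b * e) eq identity) (ℕ.*-identityʳ b)))))

    separated : (t : Vec Word N) → (∀ k → lookup t k ∈ C) → ∀ {v v′} → v ∈ C → v′ ∈ C →
                Unique (v ∷ v′ ∷ toList t) → Separated (activity t) (lookup v) (lookup v′)
    separated t t∈C {v} {v′} v∈C v′∈C u = i , active (Fin.punchIn (suc zero)) (Fin.punchIn-injective (suc zero) _ _) (λ _ → refl) ,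
        active suc Fin.suc-injective (λ _ → refl) ,
        (λ eq → Fin.0≢1+n (inj {zero} {suc zero} eq))
      where
      w = v ∷ v′ ∷ t
      w∈C : ∀ k → lookup w k ∈ C
      w∈C zero          = v∈C
      w∈C (suc zero)    = v′∈C
      w∈C (suc (suc k)) = t∈C k
      witness = proj₂ hash (lookup w) (Unique⇒lookup-injective w u) w∈C
      i = proj₁ witness
      inj : Injective _≡_ _≡_ (λ k → lookup (lookup w k) i)
      inj = proj₂ witness
      -- `e` selects positions in `w`: skipping `v′` leaves `v` followed by `t`, and skipping `v`
      -- leaves `v′` followed by `t`.
      active : ∀ (e : Fin (suc N) → Fin (suc (suc N))) → Injective _≡_ _≡_ e → (∀ k → e (suc k) ≡ suc (suc k)) →
               activity t i (lookup (lookup w (e zero)) i) ≡ 1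
      active e e-injective e-suc = ind-injective (lookup (lookup w (e zero)) i ∷ column n i t) injective (λ _ → refl)
        where
        value : ∀ k → lookup (lookup (lookup w (e zero)) i ∷ column n i t) k ≡ lookup (lookup w (e k)) i
        value zero    = refl
        value (suc k) = trans (lookup-map k (λ y → lookup y i) t) (cong (λ y → lookup (lookup w y) i) (sym (e-suc k)))
        injective : Injective _≡_ _≡_ (lookup (lookup (lookup w (e zero)) i ∷ column n i t))
        injective {k} {l} eq = e-injective (inj (trans (sym (value k)) (trans eq (value l))))

    -- Hansel's lemma covers the words outside `t`. Each of the `N` words of `t` weighs at most r^n,
    -- so the total is at most (N + 1) r^n; the constant factor does not affect the rate.
    tuple-bound : (C′ : List Word) → Unique C′ → (∀ {v} → v ∈ C′ → v ∈ C) → (t : Vec Word N) →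
                  ∃[ V ] C′ ↭ V ++ toList t →
                  length C′ ^ length C′ ≤ suc N ^ length C′ * r ^ ∑ C′ (λ v → degree (activity t) (lookup v))
    tuple-bound C′ unique C′⊆C t (V , C′↭) =
      jensen r C′ w (λ v → degree (activity t) (lookup v)) n (suc N) (λ v → weight-degree (activity t) (proper t) (lookup v)) (begin
        ∑ C′ w                        ≡⟨ ∑-↭ C′↭ w ⟩
        ∑ (V ++ toList t) w           ≡⟨ ∑-++ V (toList t) w ⟩
        ∑ V w + ∑ (toList t) w        ≤⟨ ℕ.+-mono-≤ (hansel (activity t) (proper t) V lookup separations)
                                                    (∑-mono (toList t) w≤) ⟩
        r ^ n + ∑ (toList t) (λ _ → r ^ n) ≡⟨ cong (r ^ n +_) (trans (∑-const (toList t) (r ^ n)) (cong (_* r ^ n) (length-toList t))) ⟩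
        r ^ n + N * r ^ n             ∎)
      where
      open ≤-Reasoning
      w : Word → ℕ
      w v = weight (activity t) (lookup v)
      w≤ : ∀ v → w v ≤ r ^ n
      w≤ v = subst (w v ≤_) (weight-degree (activity t) (proper t) (lookup v))
        (ℕ.m≤m*n (w v) (r ^ degree (activity t) (lookup v)) {{ℕ.m^n≢0 r (degree (activity t) (lookup v))}})
      unique′ : Unique (V ++ toList t)
      unique′ = Unique-resp-↭ C′↭ unique
      ∈C : All (_∈ C) (V ++ toList t)
      ∈C = All.tabulate (λ v∈ → C′⊆C (∈-resp-↭ (↭-sym C′↭) v∈))
      t∈C : ∀ k → lookup t k ∈ C
      t∈C k = All.lookup (++⁻ʳ V ∈C) (∈-toList⁺ (∈-lookup k t))
      combine : ∀ {U} → All (_∈ C) U → AllPairs (λ v v′ → Unique (v ∷ v′ ∷ toList t)) U →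
                AllPairs (λ v v′ → Separated (activity t) (lookup v) (lookup v′)) U
      combine []         []       = []
      combine (v∈ ∷ U∈) (us ∷ uss) = All.zipWith (λ (v′∈ , u) → separated t t∈C v∈ v′∈ u) (U∈ , us) ∷ combine U∈ uss
      separations : AllPairs (λ v v′ → Separated (activity t) (lookup v) (lookup v′)) V
      separations = combine (++⁻ˡ V ∈C) (Unique-∷∷ V (toList t) unique′)

    module Averaged (m s : ℕ) (0<m : 0 < m) (s≤b : s ≤ b) .{{b≢0 : NonZero b}} where

      open Grouping m s 0<m s≤b

      union-↭ : ∀ {L} (Ω : List (Group L)) → All (λ D → ∃[ R ] union Ω ↭ R ++ words D) Ω
      union-↭ []      = []
      union-↭ (D ∷ Ω) = (union Ω , ++-comm (words D) (union Ω)) ∷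
        All.map (λ (R , p) → words D ++ R , ↭-trans (++⁺ˡ (words D) p) (↭-reflexive (sym (++-assoc (words D) R _)))) (union-↭ Ω)

      length-union : ∀ {L} (Ω : List (Group L)) → length (union Ω) ≡ length Ω * m
      length-union []      = refl
      length-union (D ∷ Ω) = trans (length-++ (words D)) (cong₂ _+_ (size D) (length-union Ω))

      allTuples : ∀ {L} → List (Group L) → List (Vec Word N)
      allTuples Ω = concat (map (λ D → tuples N (words D)) Ω)

      length-allTuples : ∀ {L} (Ω : List (Group L)) → length (allTuples Ω) ≡ length Ω * falling m N
      length-allTuples []      = refl
      length-allTuples (D ∷ Ω) = trans (length-++ (tuples N (words D)))
        (cong₂ _+_ (trans (length-tuples N (words D)) (cong (λ k → falling k N) (size D))) (length-allTuples Ω))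

      -- The number of (group, word, N-tuple in the group) separated in coordinate i is at most this.
      separations : ∀ {L} → List (Group L) → Fin n → ℕ
      separations Ω i = ∑ Ω (λ D → ∑Fin (λ a → count (union Ω) i a * H N (del a (count (words D) i))))

      ∑-degrees : ∀ {L} (Ω : List (Group L)) →
                  ∑ (allTuples Ω) (λ t → ∑ (union Ω) (λ v → degree (activity t) (lookup v))) ≤ ∑Fin (separations Ω)
      ∑-degrees Ω = begin
        ∑ (allTuples Ω) (λ t → ∑ C′ (λ v → ∑Fin (λ i → activity t i (lookup v i))))
          ≡⟨ ∑-cong (allTuples Ω) (λ t → ∑-swap C′ (allFin n) (λ v i → activity t i (lookup v i))) ⟩
        ∑ (allTuples Ω) (λ t → ∑Fin (λ i → ∑ C′ (λ v → activity t i (lookup v i))))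
          ≡⟨ ∑-swap (allTuples Ω) (allFin n) (λ t i → ∑ C′ (λ v → activity t i (lookup v i))) ⟩
        ∑Fin (λ i → ∑ (allTuples Ω) (λ t → ∑ C′ (λ v → activity t i (lookup v i))))
          ≤⟨ ∑-mono (allFin n) coordinate ⟩
        ∑Fin (separations Ω) ∎
        where
        open ≤-Reasoning
        C′ = union Ω
        tuple-count : ∀ i a (D : Group _) → ∑ (tuples N (words D)) (λ t → activity t i a) ≤ H N (del a (count (words D) i))
        tuple-count i a D = begin
          ∑ (tuples N (words D)) (λ t → 1 * ind (del a (λ _ → 1)) (column n i t))
            ≡⟨ ∑-cong (tuples N (words D)) (λ t → ℕ.*-identityˡ (ind (del a (λ _ → 1)) (column n i t))) ⟩
          ∑ (tuples N (words D)) (λ t → ind (del a (λ _ → 1)) (column n i t))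
            ≤⟨ ∑-ind-tuples n N i (del a (λ _ → 1)) (words D) ⟩
          H N (λ c → off a c * 1 * count (words D) i c)
            ≡⟨ H-cong N (λ c → cong (_* count (words D) i c) (ℕ.*-identityʳ (off a c))) ⟩
          H N (del a (count (words D) i)) ∎
        coordinate : ∀ i → ∑ (allTuples Ω) (λ t → ∑ C′ (λ v → activity t i (lookup v i))) ≤ separations Ω i
        coordinate i = begin
          ∑ (allTuples Ω) (λ t → ∑ C′ (λ v → activity t i (lookup v i)))
            ≡⟨ trans (∑-concat (map (λ D → tuples N (words D)) Ω) f) (∑-map (λ D → tuples N (words D)) Ω (λ ts → ∑ ts f)) ⟩
          ∑ Ω (λ D → ∑ (tuples N (words D)) (λ t → ∑ C′ (λ v → activity t i (lookup v i))))
            ≡⟨ ∑-cong Ω (λ D → ∑-swap (tuples N (words D)) C′ (λ t v → activity t i (lookup v i))) ⟩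
          ∑ Ω (λ D → ∑ C′ (λ v → ∑ (tuples N (words D)) (λ t → activity t i (lookup v i))))
            ≤⟨ ∑-mono Ω (λ D → ∑-mono C′ (λ v → tuple-count i (lookup v i) D)) ⟩
          ∑ Ω (λ D → ∑ C′ (λ v → H N (del (lookup v i) (count (words D) i))))
            ≡⟨ ∑-cong Ω (λ D → ∑-count C′ i (λ a → H N (del a (count (words D) i)))) ⟩
          separations Ω i ∎
          where
          f : Vec Word N → ℕ
          f t = ∑ C′ (λ v → activity t i (lookup v i))

      -- The product of `tuple-bound` over all tuples of all groups, which is the average of its
      -- logarithm cleared of the denominator.
      averaged-bound : ∀ {L} (Ω : List (Group L)) (W : List Word) → C ↭ union Ω ++ W →
        length (union Ω) ^ (length (union Ω) * (length Ω * falling m N)) ≤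
        suc N ^ (length (union Ω) * (length Ω * falling m N)) * r ^ ∑Fin (separations Ω)
      averaged-bound Ω W C↭ = begin
        M ^ (M * (length Ω * falling m N))        ≡⟨ cong (λ k → M ^ (M * k)) (length-allTuples Ω) ⟨
        M ^ (M * K)                               ≡⟨ ℕ.^-*-assoc M M K ⟨
        (M ^ M) ^ K                               ≤⟨ ^-product-≤ r (M ^ M) (suc N ^ M) (allTuples Ω) (λ t → ∑ C′ (λ v → degree (activity t) (lookup v)))
                                                       (All.map (λ {t} → tuple-bound C′ unique C′⊆C t) tuples-of-C′) ⟩
        (suc N ^ M) ^ K * r ^ ∑ (allTuples Ω) (λ t → ∑ C′ (λ v → degree (activity t) (lookup v)))
                                                  ≤⟨ ℕ.*-monoʳ-≤ ((suc N ^ M) ^ K) (ℕ.^-monoʳ-≤ r (∑-degrees Ω)) ⟩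
        (suc N ^ M) ^ K * r ^ ∑Fin (separations Ω) ≡⟨ cong (_* r ^ ∑Fin (separations Ω)) (ℕ.^-*-assoc (suc N) M K) ⟩
        suc N ^ (M * K) * r ^ ∑Fin (separations Ω) ≡⟨ cong (λ k → suc N ^ (M * k) * r ^ ∑Fin (separations Ω)) (length-allTuples Ω) ⟩
        suc N ^ (M * (length Ω * falling m N)) * r ^ ∑Fin (separations Ω) ∎
        where
        open ≤-Reasoning
        C′ = union Ω
        M = length C′
        K = length (allTuples Ω)
        unique : Unique C′
        unique = Unique-++⁻ʳ W C′ (Unique-resp-↭ (↭-trans C↭ (++-comm C′ W)) (proj₁ hash))
        C′⊆C : ∀ {v} → v ∈ C′ → v ∈ C
        C′⊆C v∈ = ∈-resp-↭ (↭-sym C↭) (∈-++⁺ˡ v∈)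
        tuples-of-C′ : All (λ t → ∃[ V ] C′ ↭ V ++ toList t) (allTuples Ω)
        tuples-of-C′ = concat⁺ (map⁺ (All.map (λ {D} (R , p) → All.map
          (λ (R′ , p′) → R ++ R′ , ↭-trans p (↭-trans (++⁺ˡ R p′) (↭-reflexive (sym (++-assoc R R′ _)))))
          (tuples-↭ N (words D))) (union-↭ Ω)))

-- From bounds for coordinates to bounds for the size of a code

module Rates where

  open import Data.Nat.Base using (_+_; _*_; _∸_; _^_; _≤_; _<_)
  open import Data.Nat.Properties using (≤-refl; ≤-trans; ≤-reflexive; module ≤-Reasoning)
  open ℕ-Solver using (solve-∀)
  open Sum ℕ.+-*-isCommutativeSemiring
  open import Data.Integer.Base using (ℤ; +_; 0ℤ; +≤+; +<+)
  open DistinctTuples using (fallingℤ; α; γ; π; κ; Admissible)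
  open Codes

  module Int = Sum ℤ.+-*-isCommutativeSemiring

  private
    variable
      A : Set

  +-∑ : (xs : List A) (f : A → ℕ) → + ∑ xs f ≡ Int.∑ xs (λ x → + f x)
  +-∑ []       f = refl
  +-∑ (x ∷ xs) f = trans (ℤ.pos-+ (f x) (∑ xs f)) (cong (λ t → + f x ℤ.+ t) (+-∑ xs f))

  +-off : ∀ {n} (l a : Fin n) → + off l a ≡ Int.off l a
  +-off zero    zero    = refl
  +-off zero    (suc _) = refl
  +-off (suc _) zero    = refl
  +-off (suc l) (suc a) = +-off l a

  +-H : ∀ {n} j (p : Fin n → ℕ) → + H j p ≡ Int.H j (λ a → + p a)
  +-H zero    p = refl
  +-H (suc j) p = trans (+-∑ (allFin _) (λ a → p a * H j (del a p))) (Int.∑-cong (allFin _) (λ a →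
    trans (ℤ.pos-* (p a) (H j (del a p))) (cong (+ p a ℤ.*_) (trans (+-H j (del a p))
      (Int.H-cong j (λ c → trans (ℤ.pos-* (off a c) (p c)) (cong (ℤ._* + p c) (+-off a c))))))))

  +-^ : ∀ x n → + (x ^ n) ≡ (+ x) ℤ.^ n
  +-^ x zero    = refl
  +-^ x (suc n) = trans (ℤ.pos-* x (x ^ n)) (cong (+ x ℤ.*_) (+-^ x n))

  on-subst : ∀ {n} (f : Fin n → ℕ) (l a : Fin n) → f a * on l a ≡ f l * on l a
  on-subst f zero    zero    = refl
  on-subst f zero    (suc a) = trans (ℕ.*-zeroʳ (f (suc a))) (sym (ℕ.*-zeroʳ (f zero)))
  on-subst f (suc l) zero    = trans (ℕ.*-zeroʳ (f zero)) (sym (ℕ.*-zeroʳ (f (suc l))))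
  on-subst f (suc l) (suc a) = on-subst (λ i → f (suc i)) l a

  module Bounds (b j n : ℕ) (admissible : Admissible b j) (N<b : suc (suc j) < b)
    (C : List (Vec (Fin b) n)) (hash : IsHashCode b (suc (suc (suc (suc j)))) n C)
    (m s : ℕ) (0<m : 0 < m) (s≤b : s ≤ b) where

    N : ℕ
    N = suc (suc j)

    instance
      b≢0 : NonZero b
      b≢0 = >-nonZero (ℕ.≤-<-trans z≤n N<b)

    open Words b n public
    open Grouping m s 0<m s≤b public
    open Code b N n N<b C hash public
    open Averaged m s 0<m s≤b public

    module At {L : List (Fin n)} (Ω : List (Group L)) (i : Fin n) where

      p : Group L → Fin b → ℤ
      p D a = + count (words D) i a

      ∑p≡m : ∀ D → Int.∑Fin (p D) ≡ + m
      ∑p≡m D = trans (sym (+-∑ (allFin b) (count (words D) i))) (cong +_ (trans (∑-count-1 (words D) i) (size D)))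

      open DistinctTuples.Coordinate b j admissible Ω p (+ m) (λ D a → +≤+ z≤n) ∑p≡m (+<+ 0<m)
      open DistinctTuples.Averaging b j admissible using (β; module Family)
      open Family Ω p (+ m) (λ D a → +≤+ z≤n) ∑p≡m (+<+ 0<m) using (q; Z; B)

      scale : ℕ
      scale = length Ω * length Ω * m ^ suc N

      q≡ : ∀ a → q a ≡ + count (union Ω) i a
      q≡ a = sym (trans (cong +_ (trans (∑-concat (map words Ω) (λ x → on (lookup x i) a))
                                        (∑-map words Ω (λ D → count D i a))))
                        (+-∑ Ω (λ D → count (words D) i a)))

      Z≡ : Z ≡ + separations Ω i
      Z≡ = sym (trans (+-∑ Ω _) (Int.∑-cong Ω (λ D → trans (+-∑ (allFin b) _) (Int.∑-cong (allFin b) (λ a →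
        trans (ℤ.pos-* (count (union Ω) i a) _) (cong₂ ℤ._*_ (sym (q≡ a))
          (trans (+-H N (del a (count (words D) i)))
            (Int.H-cong N (λ c → trans (ℤ.pos-* (off a c) (count (words D) i c)) (cong (ℤ._* p D c) (+-off a c)))))))))))

      E≡ : E ≡ + scale
      E≡ = sym (trans (ℤ.pos-* (length Ω * length Ω) (m ^ suc N)) (cong₂ ℤ._*_ (ℤ.pos-* (length Ω) (length Ω)) (+-^ m (suc N))))

      conclude : ∀ d c {y x} → 0ℤ ℤ.< y → y ℤ.* Z ℤ.≤ x ℤ.* E → + d ℤ.* x ℤ.≤ + c ℤ.* y →
                 d * separations Ω i ≤ c * scale
      conclude d c 0<y yZ≤xE dx≤cy = ℤ.drop‿+≤+ (subst₂ ℤ._≤_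
        (trans (cong (+ d ℤ.*_) Z≡) (sym (ℤ.pos-* d (separations Ω i))))
        (trans (cong (+ c ℤ.*_) E≡) (sym (ℤ.pos-* c scale)))
        (rescale {d = + d} {c = + c} 0<y (+≤+ z≤n) yZ≤xE dx≤cy))

      any-bound : ∀ d c → + d ℤ.* F′ ℤ.≤ + c ℤ.* (β ℤ.* B) → d * separations Ω i ≤ c * scale
      any-bound d c = conclude d c 0<B′ any-coordinate

      skewed-bound : ∀ d c u t a → 0 < u → (u + t) * (length Ω * m) ≤ u * (b * count (union Ω) i a) →
        + d ℤ.* (+ 8 ℤ.* β ℤ.* (+ u ℤ.* + u) ℤ.* F′ ℤ.- DistinctTuples.α β j ℤ.* (+ t ℤ.* + t)) ℤ.≤
        + c ℤ.* (+ 8 ℤ.* β ℤ.* (+ u ℤ.* + u) ℤ.* (β ℤ.* B)) →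
        d * separations Ω i ≤ c * scale
      skewed-bound d c u t a 0<u skew = conclude d c
        (DistinctTuples.0<* {+ 8 ℤ.* β ℤ.* (+ u ℤ.* + u)} (DistinctTuples.0<* {+ 8 ℤ.* β} (DistinctTuples.0<* {+ 8} {β} (+<+ (s≤s z≤n)) (+<+ (>-nonZero⁻¹ b))) (DistinctTuples.0<* (+<+ 0<u) (+<+ 0<u))) 0<B′)
        (skewed-coordinate (+ u) (+ t) (+≤+ z≤n) (+≤+ z≤n) a
          (DistinctTuples.≤-by-difference (ℤ.i≤j⇒0≤j-i skewℤ) (arrange (+ u) (+ t) (+ length Ω ℤ.* + m) (β ℤ.* q a))))
        where
        arrange : ∀ u t x y → u ℤ.* y ℤ.- (u ℤ.+ t) ℤ.* x ≡ u ℤ.* (y ℤ.- x) ℤ.- t ℤ.* x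
        arrange = ℤ-Solver.solve-∀
        skewℤ : (+ u ℤ.+ + t) ℤ.* (+ length Ω ℤ.* + m) ℤ.≤ + u ℤ.* (β ℤ.* q a)
        skewℤ = subst₂ ℤ._≤_
          (trans (ℤ.pos-* (u + t) (length Ω * m)) (cong₂ ℤ._*_ (ℤ.pos-+ u t) (ℤ.pos-* (length Ω) m)))
          (trans (ℤ.pos-* u (b * count (union Ω) i a)) (cong (+ u ℤ.*_)
            (trans (ℤ.pos-* b (count (union Ω) i a)) (cong (β ℤ.*_) (sym (q≡ a))))))
          (+≤+ skew)

      boxed-bound : ∀ d c u v → 0 < u → 0 < s → (∀ k → k < N → k ≤ s) → i ∈ L →
        (∀ a → u * count (union Ω) i a ≤ v * (length Ω * m)) →
        + d ℤ.* (+ v ℤ.* DistinctTuples.fallingℤ (+ s) N ℤ.* (β ℤ.- + N)) ℤ.≤ + c ℤ.* (+ u ℤ.* (+ s) ℤ.^ N) →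
        d * separations Ω i ≤ c * scale
      boxed-bound d c u v 0<u 0<s large i∈L q≤ = conclude d c
        (DistinctTuples.0<* (+<+ 0<u) (0<^ N))
        (boxed-coordinate (+ s) (+ u) (+ v) (+≤+ z≤n) (+≤+ z≤n) (+≤+ z≤n)
          (λ k k<N → ℤ.i≤j⇒0≤j-i (+≤+ (large k k<N)))
          (λ D a → + χ D a) (λ D a → +≤+ z≤n)
          (λ D → trans (sym (+-∑ (allFin b) (χ D))) (cong +_ (proj₁ (proj₂ (box D)))))
          (λ D a → trans (sym (ℤ.pos-* (χ D a) (count (words D) i a))) (cong +_ (support D a)))
          (λ a → subst₂ ℤ._≤_ (trans (ℤ.pos-* u (count (union Ω) i a)) (cong (+ u ℤ.*_) (sym (q≡ a))))
                   (trans (ℤ.pos-* v (length Ω * m)) (cong (+ v ℤ.*_) (ℤ.pos-* (length Ω) m))) (+≤+ (q≤ a))))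
        where
        0<^ : ∀ k → 0ℤ ℤ.< (+ s) ℤ.^ k
        0<^ zero    = +<+ (s≤s z≤n)
        0<^ (suc k) = DistinctTuples.0<* (+<+ 0<s) (0<^ k)
        box : ∀ D → Box s (words D) i
        box D = All.lookup (boxes D) i∈L
        χ : Group L → Fin b → ℕ
        χ D = proj₁ (box D)
        support : ∀ D a → χ D a * count (words D) i a ≡ count (words D) i a
        support D a = trans (sym (∑-*ˡ (words D) (χ D a) (λ x → on (lookup x i) a)))
          (∑-cong-All (All.map (λ {x} eq → trans (on-subst (χ D) (lookup x i) a)
            (trans (cong (_* on (lookup x i) a) eq) (ℕ.*-identityˡ _))) (proj₂ (proj₂ (box D)))))


    -- A root of `averaged-bound`. The factor 2 accounts for the leftover, at most half of the code,
    -- and `u` over `v` for replacing the number of tuples of distinct words by m^N.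
    size-bound : ∀ {L} (Ω : List (Group L)) W → C ↭ union Ω ++ W → ∀ e → 2 ≤ e → e * length W ≤ length C → 0 < length C →
                 ∀ d u v S → 0 < v → v * m ^ N ≤ u * falling m N → d * ∑Fin (separations Ω) ≤ S * (length Ω * length Ω * m ^ suc N) →
                 length C ^ (d * v) ≤ (2 * suc N) ^ (d * v) * r ^ (u * S)
    size-bound Ω W C↭ e 2≤e eW≤M 0<M d u v S 0<v tuples≥ separations≤ = begin
      M ^ (d * v)                                     ≤⟨ ℕ.^-monoˡ-≤ (d * v) M≤2M′ ⟩
      (2 * M′) ^ (d * v)                              ≡⟨ ^-distribʳ-* (d * v) 2 M′ ⟩
      2 ^ (d * v) * M′ ^ (d * v)                      ≤⟨ ℕ.*-monoʳ-≤ (2 ^ (d * v)) (^-cancelˡ-≤ K 0<K root) ⟩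
      2 ^ (d * v) * (suc N ^ (d * v) * r ^ (u * S))   ≡⟨ ℕ.*-assoc (2 ^ (d * v)) (suc N ^ (d * v)) (r ^ (u * S)) ⟨
      2 ^ (d * v) * suc N ^ (d * v) * r ^ (u * S)     ≡⟨ cong (_* r ^ (u * S)) (^-distribʳ-* (d * v) 2 (suc N)) ⟨
      (2 * suc N) ^ (d * v) * r ^ (u * S)             ∎
      where
      open ≤-Reasoning
      M = length C
      M′ = length (union Ω)
      G = length Ω
      T = falling m N
      K = M′ * (G * T)
      M≡ : M ≡ M′ + length W
      M≡ = trans (↭-length C↭) (length-++ (union Ω))
      M≤2M′ : M ≤ 2 * M′
      M≤2M′ = ℕ.+-cancelʳ-≤ M M (2 * M′) (begin
        M + M                      ≡⟨ cong (λ t → t + t) M≡ ⟩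
        M′ + length W + (M′ + length W) ≡⟨ arrange M′ (length W) ⟩
        2 * M′ + 2 * length W      ≤⟨ ℕ.+-monoʳ-≤ (2 * M′) (≤-trans (ℕ.*-monoˡ-≤ (length W) 2≤e) eW≤M) ⟩
        2 * M′ + M                 ∎)
        where
        arrange : ∀ x y → x + y + (x + y) ≡ 2 * x + 2 * y
        arrange = solve-∀
      0<M′ : 0 < M′
      0<M′ = ℕ.*-cancelˡ-< 2 0 M′ (ℕ.<-≤-trans 0<M M≤2M′)
      0<G : 0 < G
      0<G = ℕ.n≢0⇒n>0 (λ G≡0 → ℕ.<⇒≢ 0<M′ (sym (trans (length-union Ω) (cong (_* m) G≡0))))
      0<T : 0 < T
      0<T = ℕ.n≢0⇒n>0 (λ T≡0 → ℕ.<⇒≱ (ℕ.*-mono-< 0<v (ℕ.m^n>0 m {{>-nonZero 0<m}} N))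
        (subst (v * m ^ N ≤_) (trans (cong (u *_) T≡0) (ℕ.*-zeroʳ u)) tuples≥))
      0<K : 0 < K
      0<K = ℕ.*-mono-< 0<M′ (ℕ.*-mono-< 0<G 0<T)
      exponent : ∑Fin (separations Ω) * (d * v) ≤ u * S * K
      exponent = begin
        X * (d * v)                     ≡⟨ arrange₁ X d v ⟩
        d * X * v                       ≤⟨ ℕ.*-monoˡ-≤ v separations≤ ⟩
        S * (G * G * (m * m ^ N)) * v   ≡⟨ arrange₂ S G m (m ^ N) v ⟩
        S * (G * m) * G * (v * m ^ N)   ≡⟨ cong (λ t → S * t * G * (v * m ^ N)) (length-union Ω) ⟨
        S * M′ * G * (v * m ^ N)        ≤⟨ ℕ.*-monoʳ-≤ (S * M′ * G) tuples≥ ⟩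
        S * M′ * G * (u * T)            ≡⟨ arrange₃ S M′ G u T ⟩
        u * S * (M′ * (G * T))          ∎
        where
        X = ∑Fin (separations Ω)
        arrange₁ : ∀ x d v → x * (d * v) ≡ d * x * v
        arrange₁ = solve-∀
        arrange₂ : ∀ S G m P v → S * (G * G * (m * P)) * v ≡ S * (G * m) * G * (v * P)
        arrange₂ = solve-∀
        arrange₃ : ∀ S M G u T → S * M * G * (u * T) ≡ u * S * (M * (G * T))
        arrange₃ = solve-∀
      root : (M′ ^ (d * v)) ^ K ≤ (suc N ^ (d * v) * r ^ (u * S)) ^ K
      root = begin
        (M′ ^ (d * v)) ^ K                                       ≡⟨ ^-^-comm M′ (d * v) K ⟩
        (M′ ^ K) ^ (d * v)                                       ≤⟨ ℕ.^-monoˡ-≤ (d * v) (averaged-bound Ω W C↭) ⟩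
        (suc N ^ K * r ^ ∑Fin (separations Ω)) ^ (d * v)         ≡⟨ ^-distribʳ-* (d * v) (suc N ^ K) _ ⟩
        (suc N ^ K) ^ (d * v) * (r ^ ∑Fin (separations Ω)) ^ (d * v)
          ≡⟨ cong₂ _*_ (^-^-comm (suc N) K (d * v)) (ℕ.^-*-assoc r (∑Fin (separations Ω)) (d * v)) ⟩
        (suc N ^ (d * v)) ^ K * r ^ (∑Fin (separations Ω) * (d * v))
          ≤⟨ ℕ.*-monoʳ-≤ ((suc N ^ (d * v)) ^ K) (ℕ.^-monoʳ-≤ r exponent) ⟩
        (suc N ^ (d * v)) ^ K * r ^ (u * S * K)                  ≡⟨ cong ((suc N ^ (d * v)) ^ K *_) (ℕ.^-*-assoc r (u * S) K) ⟨
        (suc N ^ (d * v)) ^ K * (r ^ (u * S)) ^ K                ≡⟨ ^-distribʳ-* K (suc N ^ (d * v)) (r ^ (u * S)) ⟨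
        (suc N ^ (d * v) * r ^ (u * S)) ^ K                      ∎

  on≤1 : ∀ {n} (l a : Fin n) → on l a ≤ 1
  on≤1 zero    zero    = ≤-refl
  on≤1 zero    (suc _) = z≤n
  on≤1 (suc _) zero    = z≤n
  on≤1 (suc l) (suc a) = on≤1 l a

  ∑-weighted : {A : Set} (xs : List A) (d c K : ℕ) {f : A → ℕ} → All (λ x → d * f x ≤ c * K) xs →
               d * ∑ xs f ≤ c * length xs * K
  ∑-weighted xs d c K {f} bounds = begin
    d * ∑ xs f                  ≡⟨ ∑-*ˡ xs d f ⟨
    ∑ xs (λ x → d * f x)        ≤⟨ ∑-mono-All bounds ⟩
    ∑ xs (λ _ → c * K)          ≡⟨ ∑-const xs (c * K) ⟩
    length xs * (c * K)         ≡⟨ arrange (length xs) c K ⟩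
    c * length xs * K           ∎
    where
    open ≤-Reasoning
    arrange : ∀ l c K → l * (c * K) ≡ c * l * K
    arrange = solve-∀

  -- Many or few balanced coordinates

  module Cases (b j n : ℕ) (admissible : Admissible b j) (N<b : suc (suc j) < b)
    (C : List (Vec (Fin b) n)) (hash : IsHashCode b (suc (suc (suc (suc j)))) n C)
    (m e : ℕ) (0<m : 0 < m) (2≤e : 2 ≤ e) where

    open Words b n using (count; ∑-count-1)

    M : ℕ
    M = length C

    N : ℕ
    N = suc (suc j)

    -- The tolerance 1/8 is arbitrary; the pair (6 , 6) needs a value below 0.23.
    Balanced : Fin n → Set
    Balanced i = ∀ a → 8 * b * count C i a ≤ 9 * M

    balanced? : ∀ i → Dec (Balanced i)
    balanced? i = Fin.all? (λ a → 8 * b * count C i a ℕ.≤? 9 * M)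

    balanced : List (Fin n)
    balanced = filter balanced? (allFin n)

    module Partitioned (s : ℕ) (s≤b : s ≤ b) where

      open Bounds b j n admissible N<b C hash m s 0<m s≤b hiding (N; count; ∑-count-1) public

      module Leftover {L : List (Fin n)} (Ω : List (Group L)) (W : List (Vec (Fin b) n))
        (C↭ : C ↭ union Ω ++ W) (eW≤M : e * length W ≤ M) where

        M′ : ℕ
        M′ = length Ω * m

        M≡ : M ≡ M′ + length W
        M≡ = trans (↭-length C↭) (trans (length-++ (union Ω)) (cong (_+ length W) (length-union Ω)))

        count≡ : ∀ i a → count C i a ≡ count (union Ω) i a + count W i a
        count≡ i a = trans (∑-↭ C↭ (λ x → on (lookup x i) a)) (∑-++ (union Ω) W (λ x → on (lookup x i) a))

        -- The union contains at least a share 1 - 1/e of the code, so passing to it raises a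
        -- relative frequency by a factor of at most e/(e - 1).
        balanced-count : ∀ {i} → Balanced i → ∀ a → 8 * b * (e ∸ 1) * count (union Ω) i a ≤ 9 * e * M′
        balanced-count {i} bal a = begin
          8 * b * (e ∸ 1) * count (union Ω) i a   ≤⟨ ℕ.*-monoʳ-≤ (8 * b * (e ∸ 1)) (subst (count (union Ω) i a ≤_) (sym (count≡ i a)) (ℕ.m≤m+n _ _)) ⟩
          8 * b * (e ∸ 1) * count C i a           ≡⟨ arrange (8 * b) (e ∸ 1) (count C i a) ⟩
          (e ∸ 1) * (8 * b * count C i a)         ≤⟨ ℕ.*-monoʳ-≤ (e ∸ 1) (bal a) ⟩
          (e ∸ 1) * (9 * M)                       ≡⟨ arrange′ (e ∸ 1) M ⟩
          9 * ((e ∸ 1) * M)                       ≤⟨ ℕ.*-monoʳ-≤ 9 shrink ⟩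
          9 * (e * M′)                            ≡⟨ ℕ.*-assoc 9 e M′ ⟨
          9 * e * M′                              ∎
          where
          open ≤-Reasoning
          arrange : ∀ x y z → x * y * z ≡ y * (x * z)
          arrange = solve-∀
          arrange′ : ∀ x y → x * (9 * y) ≡ 9 * (x * y)
          arrange′ = solve-∀
          shrink : (e ∸ 1) * M ≤ e * M′
          shrink = ℕ.+-cancelʳ-≤ M ((e ∸ 1) * M) (e * M′) (begin
            (e ∸ 1) * M + M              ≡⟨ ℕ.+-comm ((e ∸ 1) * M) M ⟩
            suc (e ∸ 1) * M              ≡⟨ cong (_* M) (ℕ.m+[n∸m]≡n (≤-trans (s≤s z≤n) 2≤e)) ⟩
            e * M                        ≡⟨ cong (e *_) M≡ ⟩
            e * (M′ + length W)          ≡⟨ ℕ.*-distribˡ-+ e M′ (length W) ⟩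
            e * M′ + e * length W        ≤⟨ ℕ.+-monoʳ-≤ (e * M′) eW≤M ⟩
            e * M′ + M                   ∎)

        count-W≤ : ∀ i a → count W i a ≤ length W
        count-W≤ i a = subst (count W i a ≤_) (∑-1 W) (∑-mono W (λ x → on≤1 (lookup x i) a))

        -- Some symbol exceeds (9/8)M/b occurrences and loses at most M/e of them to the leftover.
        -- What remains is a share of at least (1 + t/(8e))/b with t = e - 8b.
        unbalanced-count : ∀ {i} → ¬ Balanced i → 8 * b ≤ e →
                           ∃[ a ] (8 * e + (e ∸ 8 * b)) * M′ ≤ 8 * e * (b * count (union Ω) i a)
        unbalanced-count {i} ¬bal 8b≤e with Fin.¬∀⟶∃¬ b _ (λ a → 8 * b * count C i a ℕ.≤? 9 * M) ¬bal
        ... | a , ¬≤ = a , ℕ.+-cancelʳ-≤ (8 * b * M) _ _ (begin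
          (8 * e + t) * M′ + 8 * b * M                        ≤⟨ ℕ.+-monoˡ-≤ (8 * b * M) (ℕ.*-monoʳ-≤ (8 * e + t) (subst (M′ ≤_) (sym M≡) (ℕ.m≤m+n M′ _))) ⟩
          (8 * e + t) * M + 8 * b * M                         ≡⟨ arrange e t b M ⟩
          (8 * e + (8 * b + t)) * M                           ≡⟨ cong (λ x → (8 * e + x) * M) (ℕ.m+[n∸m]≡n 8b≤e) ⟩
          (8 * e + e) * M                                     ≡⟨ arrange′ e M ⟩
          e * (9 * M)                                         ≤⟨ ℕ.*-monoʳ-≤ e (ℕ.<⇒≤ (ℕ.≰⇒> ¬≤)) ⟩
          e * (8 * b * count C i a)                           ≡⟨ cong (λ x → e * (8 * b * x)) (count≡ i a) ⟩
          e * (8 * b * (count (union Ω) i a + count W i a))   ≡⟨ arrange″ e b (count (union Ω) i a) (count W i a) ⟩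
          8 * e * (b * count (union Ω) i a) + 8 * b * (e * count W i a)
            ≤⟨ ℕ.+-monoʳ-≤ (8 * e * (b * count (union Ω) i a)) (ℕ.*-monoʳ-≤ (8 * b) (≤-trans (ℕ.*-monoʳ-≤ e (count-W≤ i a)) eW≤M)) ⟩
          8 * e * (b * count (union Ω) i a) + 8 * b * M       ∎)
          where
          open ≤-Reasoning
          t = e ∸ 8 * b
          arrange : ∀ e t b M → (8 * e + t) * M + 8 * b * M ≡ (8 * e + (8 * b + t)) * M
          arrange = solve-∀
          arrange′ : ∀ e M → (8 * e + e) * M ≡ e * (9 * M)
          arrange′ = solve-∀
          arrange″ : ∀ e b x y → e * (8 * b * (x + y)) ≡ 8 * e * (b * x) + 8 * b * (e * y)
          arrange″ = solve-∀

    module Many-balanced (d cR cA : ℕ) (l : ℕ) (enough : l ≤ length balanced)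
      (any : + d ℤ.* fallingℤ (+ b) (suc N) ℤ.≤ + cR ℤ.* (+ b) ℤ.^ suc N)
      (boxed : + d ℤ.* (+ (9 * e) ℤ.* fallingℤ (+ N) N ℤ.* (+ b ℤ.- + N)) ℤ.≤ + cA ℤ.* (+ (8 * b * (e ∸ 1)) ℤ.* (+ N) ℤ.^ N)) where

      open Partitioned N (ℕ.<⇒≤ N<b)

      L R : List (Fin n)
      L = take l balanced
      R = drop l balanced ++ filter (¬? ∘ balanced?) (allFin n)

      ∣L∣ : length L ≡ l
      ∣L∣ = trans (length-take l balanced) (ℕ.m≤n⇒m⊓n≡m enough)

      split : (f : Fin n → ℕ) → ∑Fin f ≡ ∑ L f + ∑ R f
      split f = begin
        ∑Fin f                                               ≡⟨ ∑-↭ (filter-split balanced? (allFin n)) f ⟩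
        ∑ (balanced ++ U) f                                  ≡⟨ ∑-++ balanced U f ⟩
        ∑ balanced f + ∑ U f                                 ≡⟨ cong (λ xs → ∑ xs f + ∑ U f) (take++drop≡id l balanced) ⟨
        ∑ (L ++ drop l balanced) f + ∑ U f                   ≡⟨ cong (_+ ∑ U f) (∑-++ L (drop l balanced) f) ⟩
        ∑ L f + ∑ (drop l balanced) f + ∑ U f                ≡⟨ ℕ.+-assoc (∑ L f) _ _ ⟩
        ∑ L f + (∑ (drop l balanced) f + ∑ U f)              ≡⟨ cong (λ t → ∑ L f + t) (∑-++ (drop l balanced) U f) ⟨
        ∑ L f + ∑ R f                                        ∎
        where
        open ≡-Reasoning
        U = filter (¬? ∘ balanced?) (allFin n)

      ∣R∣ : length R ≡ n ∸ l
      ∣R∣ = begin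
        length R              ≡⟨ ℕ.m+n∸m≡n l (length R) ⟨
        l + length R ∸ l      ≡⟨ cong (_∸ l) (trans (cong₂ _+_ (trans (sym ∣L∣) (sym (∑-1 L))) (sym (∑-1 R)))
                                   (trans (sym (split (λ _ → 1))) (trans (∑-1 (allFin n)) (length-allFin n)))) ⟩
        n ∸ l                 ∎
        where open ≡-Reasoning

      -- A boxed balanced coordinate contributes at most `cA` over `d`; every other one is charged
      -- `cR` over `d`, the bound valid everywhere.
      separations-bound : (Ω : List (Group L)) (W : List (Vec (Fin b) n)) → C ↭ union Ω ++ W → e * length W ≤ M →
        d * ∑Fin (separations Ω) ≤ (cA * l + cR * (n ∸ l)) * (length Ω * length Ω * m ^ suc N)
      separations-bound Ω W C↭ eW≤M = begin
        d * ∑Fin (separations Ω)                         ≡⟨ trans (cong (d *_) (split (separations Ω))) (ℕ.*-distribˡ-+ d _ _) ⟩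
        d * ∑ L (separations Ω) + d * ∑ R (separations Ω) ≤⟨ ℕ.+-mono-≤ (∑-weighted L d cA K inL) (∑-weighted R d cR K inR) ⟩
        cA * length L * K + cR * length R * K            ≡⟨ cong₂ (λ x y → cA * x * K + cR * y * K) ∣L∣ ∣R∣ ⟩
        cA * l * K + cR * (n ∸ l) * K                    ≡⟨ ℕ.*-distribʳ-+ K (cA * l) (cR * (n ∸ l)) ⟨
        (cA * l + cR * (n ∸ l)) * K                      ∎
        where
        open ≤-Reasoning
        open Leftover Ω W C↭ eW≤M
        K = length Ω * length Ω * m ^ suc N
        0<8b[e-1] : 0 < 8 * b * (e ∸ 1)
        0<8b[e-1] = ℕ.*-mono-< (ℕ.*-mono-< {0} {8} (s≤s z≤n) (>-nonZero⁻¹ b)) (ℕ.m<n⇒0<n∸m 2≤e)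
        inL : All (λ i → d * separations Ω i ≤ cA * K) L
        inL = All.zipWith (λ {i} (i∈L , bal) → At.boxed-bound Ω i d cA (8 * b * (e ∸ 1)) (9 * e) 0<8b[e-1] (s≤s z≤n)
            (λ k k<N → ℕ.<⇒≤ k<N) i∈L (balanced-count bal) boxed)
          (All.tabulate id , take⁺ l (all-filter balanced? (allFin n)))
        inR : All (λ i → d * separations Ω i ≤ cR * K) R
        inR = All.tabulate (λ {i} _ → At.any-bound Ω i d cR any)

    module Few-balanced (d cR cU : ℕ) (l l′ : ℕ) (l≤n : l ≤ n) (few : length balanced ≤ l′) (cU≤cR : cU ≤ cR) (8b≤e : 8 * b ≤ e)
      (any : + d ℤ.* fallingℤ (+ b) (suc N) ℤ.≤ + cR ℤ.* (+ b) ℤ.^ suc N)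
      (skewed : + d ℤ.* (+ 8 ℤ.* + b ℤ.* (+ (8 * e) ℤ.* + (8 * e)) ℤ.* fallingℤ (+ b) (suc N) ℤ.-
                         α (+ b) j ℤ.* (+ (e ∸ 8 * b) ℤ.* + (e ∸ 8 * b))) ℤ.≤
                + cU ℤ.* (+ 8 ℤ.* + b ℤ.* (+ (8 * e) ℤ.* + (8 * e)) ℤ.* (+ b) ℤ.^ suc N)) where

      open Partitioned (suc j) (≤-trans (ℕ.n≤1+n (suc j)) (ℕ.<⇒≤ N<b))

      L R : List (Fin n)
      L = take l (allFin n)
      R = drop l (allFin n)

      ∣L∣ : length L ≡ l
      ∣L∣ = trans (length-take l (allFin n)) (ℕ.m≤n⇒m⊓n≡m (subst (l ≤_) (sym (length-allFin n)) l≤n))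

      ∣R∣ : length R ≡ n ∸ l
      ∣R∣ = trans (length-drop l (allFin n)) (cong (_∸ l) (length-allFin n))

      split : (f : Fin n → ℕ) → ∑Fin f ≡ ∑ L f + ∑ R f
      split f = trans (cong (λ xs → ∑ xs f) (sym (take++drop≡id l (allFin n)))) (∑-++ L R f)

      -- Coordinates in `L` contribute nothing. Of the others at most l′ are balanced and charged
      -- `cR`, the rest only `cU`; compared with charging `cR` throughout, this saves (cR - cU)(n -
      -- l - l′).
      separations-bound : (Ω : List (Group L)) (W : List (Vec (Fin b) n)) → C ↭ union Ω ++ W → e * length W ≤ M →
        d * ∑Fin (separations Ω) ≤ (cU * (n ∸ l) + (cR ∸ cU) * l′) * (length Ω * length Ω * m ^ suc N)
      separations-bound Ω W C↭ eW≤M = begin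
        d * ∑Fin (separations Ω)
          ≡⟨ trans (cong (d *_) (split (separations Ω))) (ℕ.*-distribˡ-+ d _ _) ⟩
        d * ∑ L (separations Ω) + d * ∑ R (separations Ω)
          ≤⟨ ℕ.+-monoˡ-≤ _ (∑-weighted L d 0 K inL) ⟩
        d * ∑ R (separations Ω)
          ≡⟨ ∑-*ˡ R d (separations Ω) ⟨
        ∑ R (λ i → d * separations Ω i)
          ≤⟨ ∑-mono R inR ⟩
        ∑ R (λ i → (cU + δ * ⟦ balanced? i ⟧) * K)
          ≡⟨ ∑-*ʳ R K (λ i → cU + δ * ⟦ balanced? i ⟧) ⟩
        ∑ R (λ i → cU + δ * ⟦ balanced? i ⟧) * K
          ≡⟨ cong (_* K) (trans (∑-+ R (λ _ → cU) (λ i → δ * ⟦ balanced? i ⟧))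
               (cong₂ _+_ (trans (∑-const R cU) (trans (ℕ.*-comm (length R) cU) (cong (cU *_) ∣R∣)))
                          (∑-*ˡ R δ (λ i → ⟦ balanced? i ⟧)))) ⟩
        (cU * (n ∸ l) + δ * ∑ R (λ i → ⟦ balanced? i ⟧)) * K
          ≤⟨ ℕ.*-monoˡ-≤ K (ℕ.+-monoʳ-≤ (cU * (n ∸ l)) (ℕ.*-monoʳ-≤ δ balanced-in-R)) ⟩
        (cU * (n ∸ l) + δ * l′) * K ∎
        where
        open ≤-Reasoning
        open Leftover Ω W C↭ eW≤M
        K = length Ω * length Ω * m ^ suc N
        δ = cR ∸ cU
        balanced-in-R : ∑ R (λ i → ⟦ balanced? i ⟧) ≤ l′
        balanced-in-R = begin
          ∑ R (λ i → ⟦ balanced? i ⟧)           ≤⟨ ℕ.m≤n+m _ (∑ L (λ i → ⟦ balanced? i ⟧)) ⟩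
          ∑ L (λ i → ⟦ balanced? i ⟧) + ∑ R (λ i → ⟦ balanced? i ⟧) ≡⟨ split (λ i → ⟦ balanced? i ⟧) ⟨
          ∑Fin (λ i → ⟦ balanced? i ⟧)          ≡⟨ ∑-cong (allFin n) (λ i → ℕ.*-identityʳ ⟦ balanced? i ⟧) ⟨
          ∑Fin (λ i → ⟦ balanced? i ⟧ * 1)      ≡⟨ ∑-filter balanced? (allFin n) (λ _ → 1) ⟨
          ∑ balanced (λ _ → 1)                  ≡⟨ ∑-1 balanced ⟩
          length balanced                       ≤⟨ few ⟩
          l′                                    ∎
        -- The trivial frequency bound u = v = 1 suffices here, because N distinct symbols do not
        -- fit into a box of N - 1: the falling factorial contains the factor 0.
        inL : All (λ i → d * separations Ω i ≤ 0 * K) L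
        inL = All.tabulate (λ {i} i∈L → At.boxed-bound Ω i d 0 1 1 (s≤s z≤n) (s≤s z≤n) (λ k k<N → ℕ.≤-pred k<N) i∈L
          (λ a → ℕ.*-monoʳ-≤ 1 (≤-trans (∑-mono (union Ω) (λ x → on≤1 (lookup x i) a))
            (≤-reflexive (trans (∑-1 (union Ω)) (length-union Ω)))))
          (ℤ.≤-reflexive vanish))
          where
          vanish : + d ℤ.* (+ 1 ℤ.* (fallingℤ (+ suc j) (suc j) ℤ.* (+ suc j ℤ.- + suc j)) ℤ.* (+ b ℤ.- + N)) ≡ 0ℤ
          vanish = trans (cong (λ t → + d ℤ.* (+ 1 ℤ.* (fallingℤ (+ suc j) (suc j) ℤ.* t) ℤ.* (+ b ℤ.- + N))) (ℤ.+-inverseʳ (+ suc j)))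
            (trans (cong (λ t → + d ℤ.* (+ 1 ℤ.* t ℤ.* (+ b ℤ.- + N))) (ℤ.*-zeroʳ (fallingℤ (+ suc j) (suc j)))) (ℤ.*-zeroʳ (+ d)))
        inR : ∀ i → d * separations Ω i ≤ (cU + δ * ⟦ balanced? i ⟧) * K
        inR i with balanced? i
        ... | yes _  = ≤-trans (At.any-bound Ω i d cR any) (≤-reflexive (cong (_* K)
                         (trans (sym (ℕ.m+[n∸m]≡n cU≤cR)) (cong (λ t → cU + t) (sym (ℕ.*-identityʳ δ))))))
        ... | no ¬bal = ≤-trans (At.skewed-bound Ω i d cU (8 * e) (e ∸ 8 * b) (proj₁ a) (ℕ.*-mono-< {0} {8} (s≤s z≤n) (≤-trans (s≤s z≤n) 2≤e)) (proj₂ a) skewed)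
                         (ℕ.*-monoˡ-≤ K (ℕ.m≤m+n cU _))
          where
          a = unbalanced-count ¬bal 8b≤e

  -- Comparison of exponents

  n≤2^n : ∀ n → n ≤ 2 ^ n
  n≤2^n zero    = z≤n
  n≤2^n (suc n) = begin
    1 + n          ≤⟨ ℕ.+-mono-≤ (ℕ.m^n>0 2 n) (n≤2^n n) ⟩
    2 ^ n + 2 ^ n  ≡⟨ cong (λ t → 2 ^ n + t) (ℕ.+-identityʳ (2 ^ n)) ⟨
    2 ^ suc n      ∎
    where open ≤-Reasoning

  2^-cancel-≤ : ∀ {x y} → 2 ^ x ≤ 2 ^ y → x ≤ y
  2^-cancel-≤ 2^x≤2^y = ℕ.≮⇒≥ (λ y<x → ℕ.<⇒≱ (ℕ.^-monoʳ-< 2 ≤-refl y<x) 2^x≤2^y)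

  -- If log (b/s) ≤ S/I, then n λ/ℓ coordinates can be boxed as long as (λ/ℓ)(S/I) < p/q.
  room-for-boxes : ∀ b s S I p q λ′ ℓ n l M K → 0 < I → 0 < q → 0 < ℓ →
    b ^ I ≤ 2 ^ S * s ^ I → S * q * λ′ < p * I * ℓ → ℓ * l ≤ λ′ * n → 2 ^ (p * n) ≤ M ^ q →
    ℓ * (K * (I * q)) ≤ n → K * b ^ l ≤ M * s ^ l
  room-for-boxes b s S I p q λ′ ℓ n l M K 0<I 0<q 0<ℓ log≤ rate< ℓl≤ 2^≤ n≥ =
    ^-cancelˡ-≤ (I * q) (ℕ.*-mono-< 0<I 0<q) (begin
      (K * b ^ l) ^ (I * q)                       ≡⟨ ^-distribʳ-* (I * q) K (b ^ l) ⟩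
      K ^ (I * q) * (b ^ l) ^ (I * q)             ≡⟨ cong (K ^ (I * q) *_) (regroup b) ⟩
      K ^ (I * q) * (b ^ I) ^ (l * q)             ≤⟨ ℕ.*-mono-≤ (ℕ.^-monoˡ-≤ (I * q) (n≤2^n K)) (ℕ.^-monoˡ-≤ (l * q) log≤) ⟩
      (2 ^ K) ^ (I * q) * (2 ^ S * s ^ I) ^ (l * q) ≡⟨ cong₂ _*_ (ℕ.^-*-assoc 2 K (I * q)) (^-distribʳ-* (l * q) (2 ^ S) (s ^ I)) ⟩
      2 ^ (K * (I * q)) * ((2 ^ S) ^ (l * q) * (s ^ I) ^ (l * q)) ≡⟨ cong₂ (λ x y → 2 ^ (K * (I * q)) * (x * y)) (ℕ.^-*-assoc 2 S (l * q)) (sym (regroup s)) ⟩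
      2 ^ (K * (I * q)) * (2 ^ (S * (l * q)) * (s ^ l) ^ (I * q)) ≡⟨ ℕ.*-assoc (2 ^ (K * (I * q))) _ _ ⟨
      2 ^ (K * (I * q)) * 2 ^ (S * (l * q)) * (s ^ l) ^ (I * q)   ≡⟨ cong (_* (s ^ l) ^ (I * q)) (ℕ.^-distribˡ-+-* 2 (K * (I * q)) (S * (l * q))) ⟨
      2 ^ (K * (I * q) + S * (l * q)) * (s ^ l) ^ (I * q)         ≤⟨ ℕ.*-monoˡ-≤ ((s ^ l) ^ (I * q)) (ℕ.^-monoʳ-≤ 2 exponent) ⟩
      2 ^ (p * n * I) * (s ^ l) ^ (I * q)         ≡⟨ cong (_* (s ^ l) ^ (I * q)) (ℕ.^-*-assoc 2 (p * n) I) ⟨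
      (2 ^ (p * n)) ^ I * (s ^ l) ^ (I * q)       ≤⟨ ℕ.*-monoˡ-≤ ((s ^ l) ^ (I * q)) (ℕ.^-monoˡ-≤ I 2^≤) ⟩
      (M ^ q) ^ I * (s ^ l) ^ (I * q)             ≡⟨ cong (_* (s ^ l) ^ (I * q)) (trans (ℕ.^-*-assoc M q I) (cong (M ^_) (ℕ.*-comm q I))) ⟩
      M ^ (I * q) * (s ^ l) ^ (I * q)             ≡⟨ ^-distribʳ-* (I * q) M (s ^ l) ⟨
      (M * s ^ l) ^ (I * q)                       ∎)
    where
    open ≤-Reasoning
    regroup : ∀ x → (x ^ l) ^ (I * q) ≡ (x ^ I) ^ (l * q)
    regroup x = trans (ℕ.^-*-assoc x l (I * q)) (trans (cong (x ^_) (arrange l I q)) (sym (ℕ.^-*-assoc x I (l * q))))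
      where
      arrange : ∀ l I q → l * (I * q) ≡ I * (l * q)
      arrange = solve-∀
    exponent : K * (I * q) + S * (l * q) ≤ p * n * I
    exponent = ℕ.*-cancelˡ-≤ ℓ {{>-nonZero 0<ℓ}} (begin
      ℓ * (K * (I * q) + S * (l * q))            ≡⟨ arrange₁ ℓ (K * (I * q)) S l q ⟩
      ℓ * (K * (I * q)) + S * q * (ℓ * l)        ≤⟨ ℕ.+-mono-≤ n≥ (ℕ.*-monoʳ-≤ (S * q) ℓl≤) ⟩
      n + S * q * (λ′ * n)                       ≡⟨ arrange₂ n (S * q) λ′ ⟩
      suc (S * q * λ′) * n                       ≤⟨ ℕ.*-monoˡ-≤ n rate< ⟩
      p * I * ℓ * n                              ≡⟨ arrange₃ p I ℓ n ⟩
      ℓ * (p * n * I)                            ∎)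
      where
      arrange₁ : ∀ ℓ x S l q → ℓ * (x + S * (l * q)) ≡ ℓ * x + S * q * (ℓ * l)
      arrange₁ = solve-∀
      arrange₂ : ∀ n x y → n + x * (y * n) ≡ (1 + x * y) * n
      arrange₂ = solve-∀
      arrange₃ : ∀ p I ℓ n → p * I * ℓ * n ≡ ℓ * (p * n * I)
      arrange₃ = solve-∀

  -- In logarithms: (p/q)n ≤ log M ≤ log c + (uY/X) log r, with Y about (σ/ℓ)n. By `rate<` the right
  -- side grows more slowly in `n`, so `n` cannot be large. The crude c ≤ 2^c stands in for log c.
  too-many-words : ∀ r S I p q X c u σ ρ ℓ n Y M → r ^ I ≤ 2 ^ S →
    q * S * u * σ < p * X * I * ℓ → ℓ * Y ≤ σ * n + ρ → 2 ^ (p * n) ≤ M ^ q →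
    M ^ X ≤ c ^ X * r ^ (u * Y) → q * (c * (X * I * ℓ)) + q * S * u * ρ < n → ⊥
  too-many-words r S I p q X c u σ ρ ℓ n Y M log≤ rate< ℓY≤ 2^≤ M≤ n> = ℕ.<⇒≱ n> (ℕ.+-cancelʳ-≤ (q * S * u * σ * n) n _ (begin
    -- A strict inequality between integers leaves a difference of at least 1 in the slopes, and
    -- this single `n` outweighs the constants.
    n + q * S * u * σ * n                                   ≤⟨ ℕ.*-monoˡ-≤ n rate< ⟩
    p * X * I * ℓ * n                                       ≡⟨ arrange₁ p X I ℓ n ⟩
    p * n * (X * I * ℓ)                                     ≤⟨ 2^-cancel-≤ powers ⟩
    c * (X * I * ℓ) * q + S * (u * (ℓ * Y) * q)             ≤⟨ ℕ.+-monoʳ-≤ (c * (X * I * ℓ) * q) (ℕ.*-monoʳ-≤ S (ℕ.*-monoˡ-≤ q (ℕ.*-monoʳ-≤ u ℓY≤))) ⟩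
    c * (X * I * ℓ) * q + S * (u * (σ * n + ρ) * q)         ≡⟨ arrange₂ c (X * I * ℓ) q S u σ n ρ ⟩
    q * (c * (X * I * ℓ)) + q * S * u * ρ + q * S * u * σ * n ∎))
    where
    open ≤-Reasoning
    arrange₁ : ∀ p X I ℓ n → p * X * I * ℓ * n ≡ p * n * (X * I * ℓ)
    arrange₁ = solve-∀
    arrange₂ : ∀ c x q S u σ n ρ → c * x * q + S * (u * (σ * n + ρ) * q) ≡ q * (c * x) + q * S * u * ρ + q * S * u * σ * n
    arrange₂ = solve-∀
    arrange₃ : ∀ u Y I ℓ q → u * Y * (I * ℓ * q) ≡ I * (u * (ℓ * Y) * q)
    arrange₃ = solve-∀
    arrange₄ : ∀ q X I ℓ → q * (X * I * ℓ) ≡ X * (I * ℓ * q)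
    arrange₄ = solve-∀
    arrange₅ : ∀ c X I ℓ q → c * (X * (I * ℓ * q)) ≡ c * (X * I * ℓ) * q
    arrange₅ = solve-∀
    Q = I * ℓ * q
    powers : 2 ^ (p * n * (X * I * ℓ)) ≤ 2 ^ (c * (X * I * ℓ) * q + S * (u * (ℓ * Y) * q))
    powers = begin
      2 ^ (p * n * (X * I * ℓ))                ≡⟨ ℕ.^-*-assoc 2 (p * n) (X * I * ℓ) ⟨
      (2 ^ (p * n)) ^ (X * I * ℓ)              ≤⟨ ℕ.^-monoˡ-≤ (X * I * ℓ) 2^≤ ⟩
      (M ^ q) ^ (X * I * ℓ)                    ≡⟨ trans (ℕ.^-*-assoc M q (X * I * ℓ)) (cong (M ^_) (arrange₄ q X I ℓ)) ⟩
      M ^ (X * Q)                              ≡⟨ ℕ.^-*-assoc M X Q ⟨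
      (M ^ X) ^ Q                              ≤⟨ ℕ.^-monoˡ-≤ Q M≤ ⟩
      (c ^ X * r ^ (u * Y)) ^ Q                ≡⟨ ^-distribʳ-* Q (c ^ X) (r ^ (u * Y)) ⟩
      (c ^ X) ^ Q * (r ^ (u * Y)) ^ Q          ≡⟨ cong₂ _*_ (ℕ.^-*-assoc c X Q) (trans (ℕ.^-*-assoc r (u * Y) Q)
                                                    (trans (cong (r ^_) (arrange₃ u Y I ℓ q)) (sym (ℕ.^-*-assoc r I (u * (ℓ * Y) * q))))) ⟩
      c ^ (X * Q) * (r ^ I) ^ (u * (ℓ * Y) * q) ≤⟨ ℕ.*-mono-≤ (ℕ.^-monoˡ-≤ (X * Q) (n≤2^n c)) (ℕ.^-monoˡ-≤ (u * (ℓ * Y) * q) log≤) ⟩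
      (2 ^ c) ^ (X * Q) * (2 ^ S) ^ (u * (ℓ * Y) * q) ≡⟨ cong₂ _*_ (trans (ℕ.^-*-assoc 2 c (X * Q)) (cong (2 ^_) (arrange₅ c X I ℓ q))) (ℕ.^-*-assoc 2 S _) ⟩
      2 ^ (c * (X * I * ℓ) * q) * 2 ^ (S * (u * (ℓ * Y) * q)) ≡⟨ ℕ.^-distribˡ-+-* 2 (c * (X * I * ℓ) * q) _ ⟨
      2 ^ (c * (X * I * ℓ) * q + S * (u * (ℓ * Y) * q)) ∎

  -- Numerical certificates and the final contradiction

  module Fraction (ℓ λ′ n : ℕ) .{{_ : NonZero ℓ}} (λ≤ℓ : λ′ ≤ ℓ) where

    part : ℕ
    part = λ′ * n / ℓ

    part-≤ : ℓ * part ≤ λ′ * n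
    part-≤ = subst (_≤ λ′ * n) (ℕ.*-comm part ℓ) (m/n*n≤m (λ′ * n) ℓ)

    part≤n : part ≤ n
    part≤n = ℕ.*-cancelˡ-≤ ℓ (≤-trans part-≤ (ℕ.*-monoˡ-≤ n λ≤ℓ))

    -- Rounding `part` down costs at most one coordinate, hence the summand `ℓ`.
    rest-≤ : ℓ * (n ∸ part) ≤ (ℓ ∸ λ′) * n + ℓ
    rest-≤ = ℕ.+-cancelʳ-≤ (ℓ * part) _ _ (begin
      ℓ * (n ∸ part) + ℓ * part             ≡⟨ ℕ.*-distribˡ-+ ℓ (n ∸ part) part ⟨
      ℓ * (n ∸ part + part)                 ≡⟨ cong (ℓ *_) (ℕ.m∸n+n≡m part≤n) ⟩
      ℓ * n                                 ≡⟨ cong (_* n) (ℕ.m∸n+n≡m λ≤ℓ) ⟨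
      (ℓ ∸ λ′ + λ′) * n                     ≡⟨ ℕ.*-distribʳ-+ n (ℓ ∸ λ′) λ′ ⟩
      (ℓ ∸ λ′) * n + λ′ * n                 ≡⟨ cong (λ t → (ℓ ∸ λ′) * n + t) (m≡m%n+[m/n]*n (λ′ * n) ℓ) ⟩
      (ℓ ∸ λ′) * n + (λ′ * n % ℓ + part * ℓ) ≤⟨ ℕ.+-monoʳ-≤ ((ℓ ∸ λ′) * n) (ℕ.+-mono-≤ (ℕ.<⇒≤ (m%n<n (λ′ * n) ℓ)) (≤-reflexive (ℕ.*-comm part ℓ))) ⟩
      (ℓ ∸ λ′) * n + (ℓ + ℓ * part)         ≡⟨ ℕ.+-assoc ((ℓ ∸ λ′) * n) ℓ (ℓ * part) ⟨
      (ℓ ∸ λ′) * n + ℓ + ℓ * part           ∎)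
      where open ≤-Reasoning

  -- Everything that depends on the pair, reduced to finitely many integer inequalities. The rate to
  -- be proved is `p`/`q`; `cR`/`d`, `cU`/`d` and `cA`/`d` bound the separation at an arbitrary, an
  -- unbalanced and a boxed balanced coordinate. Groups have `m` words, the leftover has a share of
  -- at most 1/`e`, and `u`/`v` bounds the ratio of m^N to the number of distinct tuples. B refers
  -- to boxes of N - 1 symbols and few balanced coordinates, with L of relative size `ν`/`ℓ`; A to
  -- boxes of N symbols, where `ν′`/`ℓ` is both the threshold for many balanced coordinates and the
  -- relative size of L. The quotients S/I bound logarithms from above.
  record Certificate (b j : ℕ) : Set where
    field
      p q d cR cU cA m e u v ℓ ν ν′ Sr Ir SB IB SA IA : ℕ
      admissible : Admissible b j
      N<b        : suc (suc j) < b
      0<q        : 0 < q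
      0<m        : 0 < m
      0<v        : 0 < v
      0<ℓ        : 0 < ℓ
      0<IB       : 0 < IB
      0<IA       : 0 < IA
      2≤e        : 2 ≤ e
      8b≤e       : 8 * b ≤ e
      cU≤cR      : cU ≤ cR
      ν≤ℓ        : ν ≤ ℓ
      ν′≤ℓ       : ν′ ≤ ℓ
      tuples≥    : v * m ^ suc (suc j) ≤ u * falling m (suc (suc j))
      any        : + d ℤ.* fallingℤ (+ b) (suc (suc (suc j))) ℤ.≤ + cR ℤ.* (+ b) ℤ.^ suc (suc (suc j))
      skewed     : + d ℤ.* (+ 8 ℤ.* + b ℤ.* (+ (8 * e) ℤ.* + (8 * e)) ℤ.* fallingℤ (+ b) (suc (suc (suc j))) ℤ.-
                            α (+ b) j ℤ.* (+ (e ∸ 8 * b) ℤ.* + (e ∸ 8 * b))) ℤ.≤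
                   + cU ℤ.* (+ 8 ℤ.* + b ℤ.* (+ (8 * e) ℤ.* + (8 * e)) ℤ.* (+ b) ℤ.^ suc (suc (suc j)))
      boxed      : + d ℤ.* (+ (9 * e) ℤ.* fallingℤ (+ suc (suc j)) (suc (suc j)) ℤ.* (+ b ℤ.- + suc (suc j))) ℤ.≤
                   + cA ℤ.* (+ (8 * b * (e ∸ 1)) ℤ.* (+ suc (suc j)) ℤ.^ suc (suc j))
      log-r      : (b ∸ suc (suc j)) ^ Ir ≤ 2 ^ Sr
      log-B      : b ^ IB ≤ 2 ^ SB * suc j ^ IB
      log-A      : b ^ IA ≤ 2 ^ SA * suc (suc j) ^ IA
      fits-B     : SB * q * ν < p * IB * ℓ
      fits-A     : SA * q * ν′ < p * IA * ℓ
      rate-B     : q * Sr * u * (cU * (ℓ ∸ ν) + (cR ∸ cU) * ν′) < p * (d * v) * Ir * ℓ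
      rate-A     : q * Sr * u * (cA * ν′ + cR * (ℓ ∸ ν′)) < p * (d * v) * Ir * ℓ

  module _ {b j : ℕ} (certificate : Certificate b j) where

    open Certificate certificate

    private
      instance
        ℓ≢0 : NonZero ℓ
        ℓ≢0 = >-nonZero 0<ℓ

      N : ℕ
      N = suc (suc j)

      boxes-A boxes-B excess : ℕ
      boxes-A = ℓ * (e * m * (IA * q))
      boxes-B = ℓ * (e * m * (IB * q))
      excess = q * (2 * suc N * (d * v * Ir * ℓ)) + q * Sr * u * (cR * ℓ)

    eventually : EventuallyRateAtMost b (suc (suc N)) p q
    -- Beyond `boxes-A` and `boxes-B` the boxes fit in either case; beyond `excess` the additive
    -- constants are outweighed.
    eventually = suc (boxes-A + boxes-B + excess) , bound
      where
      bound : (n : ℕ) → suc (boxes-A + boxes-B + excess) ≤ n → (C : List (Vec (Fin b) n)) →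
              IsHashCode b (suc (suc N)) n C → length C ^ q ≤ 2 ^ (p * n)
      bound n n≥ C hash with length C ^ q ℕ.≤? 2 ^ (p * n)
      ... | yes ≤2^ = ≤2^
      ... | no  ≰2^ = ⊥-elim (impossible (part′ ℕ.≤? length balanced))
        where
        open Cases b j n admissible N<b C hash m e 0<m 2≤e hiding (N)
        open Fraction ℓ ν n ν≤ℓ
        open Fraction ℓ ν′ n ν′≤ℓ using () renaming (part to part′; part-≤ to part′-≤; rest-≤ to rest′-≤)
        2^≤ : 2 ^ (p * n) ≤ M ^ q
        2^≤ = ℕ.<⇒≤ (ℕ.≰⇒> ≰2^)
        0<M : 0 < M
        0<M = ℕ.n≢0⇒n>0 (λ M≡0 → ℕ.<⇒≱ (ℕ.m^n>0 2 (p * n)) (subst (2 ^ (p * n) ≤_)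
          (trans (cong (_^ q) M≡0) (0^ 0<q)) 2^≤))
          where
          0^ : ∀ {k} → 0 < k → 0 ^ k ≡ 0
          0^ (s≤s _) = refl
        n≥A : boxes-A ≤ n
        n≥A = ≤-trans (≤-trans (ℕ.m≤m+n boxes-A boxes-B) (ℕ.m≤m+n _ excess)) (ℕ.<⇒≤ n≥)
        n≥B : boxes-B ≤ n
        n≥B = ≤-trans (≤-trans (ℕ.m≤n+m boxes-B boxes-A) (ℕ.m≤m+n _ excess)) (ℕ.<⇒≤ n≥)
        n> : excess < n
        n> = ≤-trans (s≤s (ℕ.m≤n+m excess (boxes-A + boxes-B))) n≥
        -- Room is required for e·m words although a group needs only `m`: the leftover is too small
        -- for one more group, hence at most a share 1/`e` of the code.
        small-leftover : ∀ s (0<s : 0 < s) l w → w * s ^ l < m * b ^ l → e * m * b ^ l ≤ M * s ^ l → e * w ≤ M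
        small-leftover s 0<s l w w< room = ℕ.*-cancelʳ-≤ (e * w) M (s ^ l) {{ℕ.m^n≢0 s l {{>-nonZero 0<s}}}} (begin
          e * w * s ^ l    ≡⟨ ℕ.*-assoc e w (s ^ l) ⟩
          e * (w * s ^ l)  ≤⟨ ℕ.*-monoʳ-≤ e (ℕ.<⇒≤ w<) ⟩
          e * (m * b ^ l)  ≡⟨ ℕ.*-assoc e m (b ^ l) ⟨
          e * m * b ^ l    ≤⟨ room ⟩
          M * s ^ l        ∎)
          where open ≤-Reasoning
        impossible : _ → ⊥
        impossible (yes enough) =
          too-many-words (b ∸ N) Sr Ir p q (d * v) (2 * suc N) u (cA * ν′ + cR * (ℓ ∸ ν′)) (cR * ℓ) ℓ n
            (cA * part′ + cR * (n ∸ part′)) M log-r rate-A total 2^≤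
            (size-bound Ω W C↭ e 2≤e eW≤M 0<M d u v _ 0<v tuples≥ (separations-bound Ω W C↭ eW≤M)) n>
          where
          open Many-balanced d cR cA part′ enough any boxed
          open Partitioned N (ℕ.<⇒≤ N<b)
          groups = partition L M C ≤-refl
          Ω = proj₁ groups
          W = proj₁ (proj₂ groups)
          C↭ = proj₁ (proj₂ (proj₂ groups))
          eW≤M : e * length W ≤ M
          eW≤M = small-leftover N (s≤s z≤n) part′ (length W)
            (subst (λ l → length W * N ^ l < m * b ^ l) ∣L∣ (proj₂ (proj₂ (proj₂ groups))))
            (room-for-boxes b N SA IA p q ν′ ℓ n part′ M (e * m) 0<IA 0<q 0<ℓ log-A fits-A part′-≤ 2^≤ n≥A)
          total : ℓ * (cA * part′ + cR * (n ∸ part′)) ≤ (cA * ν′ + cR * (ℓ ∸ ν′)) * n + cR * ℓ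
          total = begin
            ℓ * (cA * part′ + cR * (n ∸ part′))           ≡⟨ arrange ℓ cA part′ cR (n ∸ part′) ⟩
            cA * (ℓ * part′) + cR * (ℓ * (n ∸ part′))     ≤⟨ ℕ.+-mono-≤ (ℕ.*-monoʳ-≤ cA part′-≤) (ℕ.*-monoʳ-≤ cR rest′-≤) ⟩
            cA * (ν′ * n) + cR * ((ℓ ∸ ν′) * n + ℓ)       ≡⟨ collect cA ν′ n cR (ℓ ∸ ν′) ℓ ⟩
            (cA * ν′ + cR * (ℓ ∸ ν′)) * n + cR * ℓ        ∎
            where
            open ≤-Reasoning
            arrange : ∀ ℓ a x c y → ℓ * (a * x + c * y) ≡ a * (ℓ * x) + c * (ℓ * y)
            arrange = solve-∀
            collect : ∀ a x n c y ℓ → a * (x * n) + c * (y * n + ℓ) ≡ (a * x + c * y) * n + c * ℓ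
            collect = solve-∀
        impossible (no few) =
          too-many-words (b ∸ N) Sr Ir p q (d * v) (2 * suc N) u (cU * (ℓ ∸ ν) + (cR ∸ cU) * ν′) (cR * ℓ) ℓ n
            (cU * (n ∸ part) + (cR ∸ cU) * part′) M log-r rate-B total 2^≤
            (size-bound Ω W C↭ e 2≤e eW≤M 0<M d u v _ 0<v tuples≥ (separations-bound Ω W C↭ eW≤M)) n>
          where
          open Few-balanced d cR cU part part′ part≤n (ℕ.<⇒≤ (ℕ.≰⇒> few)) cU≤cR 8b≤e any skewed
          open Partitioned (suc j) (≤-trans (ℕ.n≤1+n (suc j)) (ℕ.<⇒≤ N<b))
          groups = partition L M C ≤-refl
          Ω = proj₁ groups
          W = proj₁ (proj₂ groups)
          C↭ = proj₁ (proj₂ (proj₂ groups))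
          eW≤M : e * length W ≤ M
          eW≤M = small-leftover (suc j) (s≤s z≤n) part (length W)
            (subst (λ l → length W * suc j ^ l < m * b ^ l) ∣L∣ (proj₂ (proj₂ (proj₂ groups))))
            (room-for-boxes b (suc j) SB IB p q ν ℓ n part M (e * m) 0<IB 0<q 0<ℓ log-B fits-B part-≤ 2^≤ n≥B)
          total : ℓ * (cU * (n ∸ part) + (cR ∸ cU) * part′) ≤ (cU * (ℓ ∸ ν) + (cR ∸ cU) * ν′) * n + cR * ℓ
          total = begin
            ℓ * (cU * (n ∸ part) + (cR ∸ cU) * part′)              ≡⟨ arrange ℓ cU (n ∸ part) (cR ∸ cU) part′ ⟩
            cU * (ℓ * (n ∸ part)) + (cR ∸ cU) * (ℓ * part′)        ≤⟨ ℕ.+-mono-≤ (ℕ.*-monoʳ-≤ cU rest-≤) (ℕ.*-monoʳ-≤ (cR ∸ cU) part′-≤) ⟩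
            cU * ((ℓ ∸ ν) * n + ℓ) + (cR ∸ cU) * (ν′ * n)          ≡⟨ collect cU (ℓ ∸ ν) n ℓ (cR ∸ cU) ν′ ⟩
            (cU * (ℓ ∸ ν) + (cR ∸ cU) * ν′) * n + cU * ℓ           ≤⟨ ℕ.+-monoʳ-≤ ((cU * (ℓ ∸ ν) + (cR ∸ cU) * ν′) * n) (ℕ.*-monoˡ-≤ ℓ cU≤cR) ⟩
            (cU * (ℓ ∸ ν) + (cR ∸ cU) * ν′) * n + cR * ℓ           ∎
            where
            open ≤-Reasoning
            arrange : ∀ ℓ a x c y → ℓ * (a * x + c * y) ≡ a * (ℓ * x) + c * (ℓ * y)
            arrange = solve-∀
            collect : ∀ a x n ℓ c y → a * (x * n + ℓ) + c * (y * n) ≡ (a * x + c * y) * n + a * ℓ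
            collect = solve-∀

  -- Rational logarithms and the choice of parameters

  ^-cancelˡ-< : ∀ k {x y} → x ^ k < y ^ k → x < y
  ^-cancelˡ-< k x^k<y^k = ℕ.≰⇒> (λ y≤x → ℕ.<⇒≱ x^k<y^k (ℕ.^-monoˡ-≤ k y≤x))

  -- The exponents in `BelowBound` are too large for its powers to be evaluated. They are compared
  -- through one rational bound s/i for the logarithm, checked with moderate exponents.
  below-log : ∀ x y s i a₁ a₂ → 0 < y → 2 ^ s * y ^ i ≤ x ^ i → a₂ * i < s * a₁ → 2 ^ a₂ * y ^ a₁ < x ^ a₁
  below-log x y s i a₁ a₂ 0<y log≤ a₂/a₁< = ^-cancelˡ-< i (begin-strict
    (2 ^ a₂ * y ^ a₁) ^ i            ≡⟨ ^-distribʳ-* i (2 ^ a₂) (y ^ a₁) ⟩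
    (2 ^ a₂) ^ i * (y ^ a₁) ^ i      ≡⟨ cong₂ _*_ (ℕ.^-*-assoc 2 a₂ i) (^-^-comm y a₁ i) ⟩
    2 ^ (a₂ * i) * (y ^ i) ^ a₁      <⟨ ℕ.*-monoˡ-< ((y ^ i) ^ a₁) {{ℕ.m^n≢0 (y ^ i) a₁ {{ℕ.m^n≢0 y i {{>-nonZero 0<y}}}}}} (ℕ.^-monoʳ-< 2 ≤-refl a₂/a₁<) ⟩
    2 ^ (s * a₁) * (y ^ i) ^ a₁      ≡⟨ cong (_* (y ^ i) ^ a₁) (ℕ.^-*-assoc 2 s a₁) ⟨
    (2 ^ s) ^ a₁ * (y ^ i) ^ a₁      ≡⟨ ^-distribʳ-* a₁ (2 ^ s) (y ^ i) ⟨
    (2 ^ s * y ^ i) ^ a₁             ≤⟨ ℕ.^-monoˡ-≤ a₁ log≤ ⟩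
    (x ^ i) ^ a₁                     ≡⟨ ^-^-comm x i a₁ ⟩
    (x ^ a₁) ^ i                     ∎)
    where open ≤-Reasoning

  -- Rational bounds s/i, written (s , i), for r = b - k + 2.
  record Logarithms : Set where
    constructor logs
    field
      r↓ r↑         : ℕ × ℕ   -- log r
      b/[k-3]↓ b/[k-3]↑ : ℕ × ℕ   -- log (b/(k-3))
      b/[k-2]↑      : ℕ × ℕ   -- log (b/(k-2))

  infixl 7 _÷_
  -- Ordinary division, except that x ÷ 0 = x.
  _÷_ : ℕ → ℕ → ℕ
  x ÷ y = x / suc (y ∸ 1)

  module Parameters (huge b j : ℕ) (logarithms : Logarithms) where

    open Logarithms logarithms

    N k r : ℕ
    N = suc (suc j)
    k = suc (suc N)
    r = b ∸ N

    -- `a₁`/`a₂` and `e₁`/`e₂` lie just above 1/log (b/(k-3)) and 1/log r, the subtracted 1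
    -- providing strictness, and `d₁`/`d₂` is the second summand of the bound. Over the denominator
    -- `huge`, `p` is the largest numerator strictly below the resulting reciprocal. `ν` and `ν′`
    -- are the largest values that pass `fits-B` and `fits-A`; `cR`, `cU`, `cA` are the next
    -- integers above the quotients demanded by `any`, `skewed` and `boxed`.
    a₁ a₂ e₁ e₂ d₁ d₂ p ν ν′ cR cU cA : ℕ
    a₁ = huge * proj₂ b/[k-3]↓
    a₂ = huge * proj₁ b/[k-3]↓ ∸ 1
    e₁ = huge * proj₂ r↓
    e₂ = huge * proj₁ r↓ ∸ 1
    d₁ = e₁ * b ^ suc N
    d₂ = e₂ * falling b (suc N)
    p  = (huge * a₂ * d₂ ∸ 1) ÷ (a₁ * d₂ + d₁ * a₂)
    ν  = (p * proj₂ b/[k-3]↑ * huge ∸ 1) ÷ (proj₁ b/[k-3]↑ * huge)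
    ν′ = (p * proj₂ b/[k-2]↑ * huge ∸ 1) ÷ (proj₁ b/[k-2]↑ * huge)
    cR = suc (huge * falling b (suc N) ÷ b ^ suc N)
    cU = suc (huge * (8 * b * (8 * huge * (8 * huge)) * falling b (suc N) ∸ b * falling (b ∸ 2) (suc j) * ((huge ∸ 8 * b) * (huge ∸ 8 * b)))
              ÷ (8 * b * (8 * huge * (8 * huge)) * b ^ suc N))
    cA = suc (huge * (9 * huge * falling N N * r) ÷ (8 * b * (huge ∸ 1) * N ^ N))


    -- A conjunction of decidable comparisons of numbers small enough to be computed, so that each
    -- pair is settled by evaluation.
    Numeric : Set
    Numeric =
      (k ≤ b × 0 < falling b (suc N) × 0 < a₁ × 0 < a₂ × 0 < e₁ × 0 < e₂ ×
       2 ^ proj₁ b/[k-3]↓ * suc j ^ proj₂ b/[k-3]↓ ≤ b ^ proj₂ b/[k-3]↓ × a₂ * proj₂ b/[k-3]↓ < proj₁ b/[k-3]↓ * a₁ ×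
       2 ^ proj₁ r↓ * 1 ^ proj₂ r↓ ≤ r ^ proj₂ r↓ × e₂ * proj₂ r↓ < proj₁ r↓ * e₁ ×
       p * (a₁ * d₂ + d₁ * a₂) < huge * a₂ * d₂) ×
      (0ℤ ℤ.≤ + b ℤ.- + N × 0ℤ ℤ.< α (+ b) j × 0ℤ ℤ.< κ (+ b) j ×
       π (+ b) j ℤ.* π (+ b) j ℤ.≤ + 6 ℤ.* (+ 2 ℤ.* γ (+ b) j ℤ.+ π (+ b) j) ℤ.* κ (+ b) j) ×
      (2 ≤ huge × 0 < proj₂ b/[k-3]↑ × 0 < proj₂ b/[k-2]↑ × 8 * b ≤ huge × cU ≤ cR × ν ≤ huge × ν′ ≤ huge ×
       huge * (huge * huge) ^ N ≤ suc huge * falling (huge * huge) N ×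
       + huge ℤ.* fallingℤ (+ b) (suc N) ℤ.≤ + cR ℤ.* (+ b) ℤ.^ suc N ×
       + huge ℤ.* (+ 8 ℤ.* + b ℤ.* (+ (8 * huge) ℤ.* + (8 * huge)) ℤ.* fallingℤ (+ b) (suc N) ℤ.-
                   α (+ b) j ℤ.* (+ (huge ∸ 8 * b) ℤ.* + (huge ∸ 8 * b))) ℤ.≤
         + cU ℤ.* (+ 8 ℤ.* + b ℤ.* (+ (8 * huge) ℤ.* + (8 * huge)) ℤ.* (+ b) ℤ.^ suc N) ×
       + huge ℤ.* (+ (9 * huge) ℤ.* fallingℤ (+ N) N ℤ.* (+ b ℤ.- + N)) ℤ.≤
         + cA ℤ.* (+ (8 * b * (huge ∸ 1)) ℤ.* (+ N) ℤ.^ N)) ×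
      (r ^ proj₂ r↑ ≤ 2 ^ proj₁ r↑ ×
       b ^ proj₂ b/[k-3]↑ ≤ 2 ^ proj₁ b/[k-3]↑ * suc j ^ proj₂ b/[k-3]↑ ×
       b ^ proj₂ b/[k-2]↑ ≤ 2 ^ proj₁ b/[k-2]↑ * N ^ proj₂ b/[k-2]↑ ×
       proj₁ b/[k-3]↑ * huge * ν < p * proj₂ b/[k-3]↑ * huge ×
       proj₁ b/[k-2]↑ * huge * ν′ < p * proj₂ b/[k-2]↑ * huge ×
       huge * proj₁ r↑ * suc huge * (cU * (huge ∸ ν) + (cR ∸ cU) * ν′) < p * (huge * huge) * proj₂ r↑ * huge ×
       huge * proj₁ r↑ * suc huge * (cA * ν′ + cR * (huge ∸ ν′)) < p * (huge * huge) * proj₂ r↑ * huge)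

    numeric? : Dec Numeric
    numeric? =
      (k ℕ.≤? b ×-dec _ ℕ.<? _ ×-dec _ ℕ.<? _ ×-dec _ ℕ.<? _ ×-dec _ ℕ.<? _ ×-dec _ ℕ.<? _ ×-dec
       _ ℕ.≤? _ ×-dec _ ℕ.<? _ ×-dec _ ℕ.≤? _ ×-dec _ ℕ.<? _ ×-dec _ ℕ.<? _) ×-dec
      (_ ℤ.≤? _ ×-dec _ ℤ.<? _ ×-dec _ ℤ.<? _ ×-dec _ ℤ.≤? _) ×-dec
      (2 ℕ.≤? huge ×-dec _ ℕ.<? _ ×-dec _ ℕ.<? _ ×-dec _ ℕ.≤? _ ×-dec _ ℕ.≤? _ ×-dec _ ℕ.≤? _ ×-dec _ ℕ.≤? _ ×-dec
       _ ℕ.≤? _ ×-dec _ ℤ.≤? _ ×-dec _ ℤ.≤? _ ×-dec _ ℤ.≤? _) ×-dec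
      (_ ℕ.≤? _ ×-dec _ ℕ.≤? _ ×-dec _ ℕ.≤? _ ×-dec _ ℕ.<? _ ×-dec _ ℕ.<? _ ×-dec _ ℕ.<? _ ×-dec _ ℕ.<? _)

    below-bound : Numeric → BelowBound b k p huge
    below-bound ((k≤b , 0<F , 0<a₁ , 0<a₂ , 0<e₁ , 0<e₂ , log-B , a₂< , log-r , e₂< , rate) , _) =
      a₁ , a₂ , d₁ , d₂ , 0<a₁ , 0<a₂ , ℕ.*-mono-< 0<e₁ 0<B , ℕ.*-mono-< 0<e₂ 0<F ,
      below-log b (suc j) (proj₁ b/[k-3]↓) (proj₂ b/[k-3]↓) a₁ a₂ (s≤s z≤n) log-B a₂< ,
      subst (λ t → 2 ^ (B * d₂) < t ^ (F * d₁)) (sym r≡) exponential , rate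
      where
      open ≤-Reasoning
      F B : ℕ
      F = falling b (suc N)
      B = b ^ suc N
      0<B : 0 < B
      0<B = ℕ.m^n>0 b {{>-nonZero (≤-trans (s≤s z≤n) k≤b)}} (suc N)
      r≡ : b ∸ k + 2 ≡ r
      r≡ = trans (sym (ℕ.+-∸-comm 2 k≤b)) (cong (_∸ k) (ℕ.+-comm b 2))
      exponential : 2 ^ (B * d₂) < r ^ (F * d₁)
      exponential = begin-strict
        2 ^ (B * (e₂ * F))       ≡⟨ cong (2 ^_) (arrange₁ B e₂ F) ⟩
        2 ^ (e₂ * (B * F))       ≡⟨ ℕ.^-*-assoc 2 e₂ (B * F) ⟨
        (2 ^ e₂) ^ (B * F)       <⟨ ℕ.^-monoˡ-< (B * F) {{>-nonZero (ℕ.*-mono-< 0<B 0<F)}} 2^e₂< ⟩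
        (r ^ e₁) ^ (B * F)       ≡⟨ ℕ.^-*-assoc r e₁ (B * F) ⟩
        r ^ (e₁ * (B * F))       ≡⟨ cong (r ^_) (arrange₂ B e₁ F) ⟩
        r ^ (F * (e₁ * B))       ∎
        where
        arrange₁ : ∀ B e F → B * (e * F) ≡ e * (B * F)
        arrange₁ = solve-∀
        arrange₂ : ∀ B e F → e * (B * F) ≡ F * (e * B)
        arrange₂ = solve-∀
        2^e₂< : 2 ^ e₂ < r ^ e₁
        2^e₂< = subst (_< r ^ e₁) (trans (cong (2 ^ e₂ *_) (ℕ.^-zeroˡ e₁)) (ℕ.*-identityʳ (2 ^ e₂)))
          (below-log r 1 (proj₁ r↓) (proj₂ r↓) e₁ e₂ (s≤s z≤n) log-r e₂<)

    certificate : Numeric → Certificate b j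
    certificate ((k≤b , _) , (N≤b , 0<α , 0<κ , π²≤) ,
      (2≤e , 0<IB , 0<IA , 8b≤e , cU≤cR , ν≤ , ν′≤ , tuples≥ , any , skewed , boxed) ,
      (log-r , log-B , log-A , fits-B , fits-A , rate-B , rate-A)) = record
      -- With m = huge², the share of N-tuples with a repetition is of order N²/huge², well within
      -- the tolerance 1/huge that `u` over `v` allows.
      { p = p ; q = huge ; d = huge ; cR = cR ; cU = cU ; cA = cA ; m = huge * huge ; e = huge ; u = suc huge ; v = huge
      ; ℓ = huge ; ν = ν ; ν′ = ν′
      ; Sr = proj₁ r↑ ; Ir = proj₂ r↑ ; SB = proj₁ b/[k-3]↑ ; IB = proj₂ b/[k-3]↑ ; SA = proj₁ b/[k-2]↑ ; IA = proj₂ b/[k-2]↑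
      ; admissible = record { N≤b = N≤b ; 0<α = 0<α ; 0<κ = 0<κ ; π²≤ = π²≤ }
      ; N<b = ≤-trans (ℕ.n≤1+n _) k≤b
      ; 0<q = 0<huge ; 0<m = ℕ.*-mono-< 0<huge 0<huge ; 0<v = 0<huge ; 0<ℓ = 0<huge ; 0<IB = 0<IB ; 0<IA = 0<IA
      ; 2≤e = 2≤e
      ; 8b≤e = 8b≤e ; cU≤cR = cU≤cR ; ν≤ℓ = ν≤ ; ν′≤ℓ = ν′≤
      ; tuples≥ = tuples≥ ; any = any ; skewed = skewed ; boxed = boxed
      ; log-r = log-r ; log-B = log-B ; log-A = log-A ; fits-B = fits-B ; fits-A = fits-A
      ; rate-B = rate-B ; rate-A = rate-A }
      where
      0<huge : 0 < huge
      0<huge = ≤-trans (s≤s z≤n) 2≤e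

    rate-below-bound : {True numeric?} → RateBelowBound b k
    rate-below-bound {ok} = p , huge , Certificate.0<q (certificate numeric) , below-bound numeric , eventually (certificate numeric)
      where
      numeric : Numeric
      numeric = toWitness ok

open Rates using (logs)
-- One precision for all pairs; that it suffices is established by the evaluation of `numeric?`, not
-- by an estimate.
open Rates.Parameters (10 ℕ.^ 12) using (rate-below-bound)

-- The fractions are convergents of the continued fractions of the logarithms.
rates : All (λ (b , k) → RateBelowBound b k) pairs
rates =
  rate-below-bound 6 2 (logs (1 , 1) (1 , 1) (1 , 1) (1 , 1) (24 , 41)) ∷
  rate-below-bound 7 2 (logs (1054 , 665) (485 , 306) (7981 , 6529) (797 , 652) (21 , 26)) ∷
  rate-below-bound 8 2 (logs (2 , 1) (2 , 1) (433 , 306) (75 , 53) (1 , 1)) ∷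
  rate-below-bound 9 2 (logs (339 , 146) (1493 , 643) (1054 , 665) (485 , 306) (55 , 47)) ∷
  rate-below-bound 10 2 (logs (1719 , 665) (791 , 306) (2965 , 1707) (733 , 422) (78 , 59)) ∷
  rate-below-bound 11 2 (logs (6718 , 2393) (1603 , 571) (881 , 470) (3091 , 1649) (54 , 37)) ∷
  rate-below-bound 12 2 (logs (3 , 1) (3 , 1) (2 , 1) (2 , 1) (65 , 41)) ∷
  rate-below-bound 13 2 (logs (2108 , 665) (23673 , 7468) (2638 , 1247) (861 , 407) (386 , 227)) ∷
  rate-below-bound 14 2 (logs (13301 , 4004) (2136 , 643) (14510 , 6529) (1449 , 652) (47 , 26)) ∷
  rate-below-bound 8 3 (logs (1054 , 665) (485 , 306) (1 , 1) (1 , 1) (19 , 28)) ∷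
  rate-below-bound 9 3 (logs (2 , 1) (2 , 1) (778 , 665) (179 , 153) (28 , 33)) ∷
  rate-below-bound 10 3 (logs (339 , 146) (1493 , 643) (193 , 146) (850 , 643) (1 , 1)) ∷
  rate-below-bound 11 3 (logs (1719 , 665) (791 , 306) (1385 , 949) (1439 , 986) (33 , 29)) ∷
  rate-below-bound 12 3 (logs (306 , 109) (1603 , 571) (1054 , 665) (485 , 306) (24 , 19)) ∷
  rate-below-bound 13 3 (logs (3 , 1) (3 , 1) (8895 , 5231) (386 , 227) (40 , 29)) ∷
  rate-below-bound 14 3 (logs (2108 , 665) (23673 , 7468) (4325 , 2393) (1032 , 571) (52 , 35)) ∷
  rate-below-bound 10 4 (logs (2 , 1) (2 , 1) (1 , 1) (1 , 1) (311 , 422)) ∷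
  rate-below-bound 11 4 (logs (339 , 146) (1493 , 643) (91 , 80) (3946 , 3469) (7 , 8)) ∷
  rate-below-bound 12 4 (logs (1719 , 665) (791 , 306) (533 , 422) (2156 , 1707) (1 , 1)) ∷
  rate-below-bound 13 4 (logs (306 , 109) (1603 , 571) (295 , 214) (834 , 605) (454 , 407)) ∷
  rate-below-bound 14 4 (logs (3 , 1) (3 , 1) (1325 , 892) (153 , 103) (797 , 652)) ∷
  rate-below-bound 11 5 (logs (2 , 1) (2 , 1) (202 , 231) (209 , 239) (15 , 23)) ∷
  rate-below-bound 12 5 (logs (339 , 146) (1493 , 643) (1 , 1) (1 , 1) (7 , 9)) ∷
  rate-below-bound 13 5 (logs (1719 , 665) (791 , 306) (1391 , 1247) (454 , 407) (117 , 131)) ∷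
  rate-below-bound 14 5 (logs (306 , 109) (1603 , 571) (7981 , 6529) (797 , 652) (1 , 1)) ∷
  rate-below-bound 13 6 (logs (339 , 146) (1493 , 643) (142 , 159) (1821 , 2039) (159 , 227)) ∷
  rate-below-bound 14 6 (logs (1719 , 665) (791 , 306) (1 , 1) (1 , 1) (21 , 26)) ∷
  rate-below-bound 14 7 (logs (339 , 146) (1493 , 643) (88 , 109) (461 , 571) (51 , 80)) ∷
  []

theorem3 : (b k : ℕ) → (b , k) ∈ pairs → RateBelowBound b k
theorem3 b k = All.lookup rates
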